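{- Let $G=C_{T_1,\dots,T_g}\in\mathcal{U}_{n,l}^g$ be obtained from the cycle $C_g=u_1\cdots u_g$ by attaching trees $T_1,\dots,T_g$ at the roots $u_1,\dots,u_g$, where $|V(T_i)|=n_i$ and the number of leaves in $T_i$ is $l_i$. Then there exist positive integers $p_1,\dots,p_g$, all equal to $1$ except at most one of them, such that $C_{B_1,\dots,B_g}\preceq C_{T_1,\dots,T_g}$, where for each $i$, $B_i$ is the tree with root $u_i$ obtained by identifying the end $u_{i,p_i}$ of the path $P_{p_i}=u_iu_{i,2}\cdots u_{i,p_i}$ (of order $p_i$; for $p_i=1$ this is just $u_i$) with the center of $BST_{n_i-p_i+1,l_i}$. Moreover, equality $C_{B_1,\dots,B_g}= C_{T_1,\dots,T_g}$ in the Laplacian coefficients (i.e. $c_k$ equal for all $k$) holds if and only if $C_{B_1,\dots,B_g}\cong C_{T_1,\dots,T_g}$.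
   Context: For a graph $G$ on $n$ vertices with Laplacian matrix $L(G)=D(G)-A(G)$, write $\det(\lambda I_n-L(G))=\sum_{k=0}^n(-1)^k c_k(G)\lambda^{n-k}$. For graphs $G,H$ of order $n$, $G\preceq H$ means $c_k(G)\le c_k(H)$ for all $0\le k\le n$. A leaf is a vertex of degree $1$ (here leaves of $T_i$ refer to the pendent vertices of the unicyclic graph lying in $T_i$). $\mathcal{U}_{n,l}^g$ is the set of connected unicyclic graphs with $n$ vertices, exactly $l$ leaves and girth $g$; $C_{T_1,\dots,T_g}$ denotes the graph obtained from the cycle $C_g=u_1\cdots u_g$ by attaching trees $T_1,\dots,T_g$ rooted at $u_1,\dots,u_g$. The balanced starlike tree $BST_{m,l}$ is the tree of order $m$ with $l$ leaves obtained by identifying one end of each of $l$ paths, each of order $\lfloor\frac{m-1}{l}\rfloor+1$ or $\lceil\frac{m-1}{l}\rceil+1$, into a single vertex, its center (with $BST_{1,0}$ a single vertex). -}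

module Defs where

open import Data.Nat as ℕ using (ℕ; zero; suc; _∸_; _≡ᵇ_; _<ᵇ_; _/_; _%_)
open import Data.Integer as ℤ using (ℤ; +_; -_)
open import Data.Fin using (Fin; zero; suc; toℕ; punchIn)
open import Data.List using (List; []; _∷_; _++_; map; foldr; allFin; replicate)
open import Data.Vec using (Vec; toList)
open import Data.Bool using (Bool; true; false; if_then_else_; _∧_; _∨_)
open import Data.Product using (Σ; _×_; _,_)
open import Relation.Binary.PropositionalEquality using (_≡_)
open import Function.Bundles using (_↔_; Inverse)

-- Rooted trees (finite, unordered trees up to isomorphism are all
-- representable as rose trees); the root is the outer 'node'.

data RTree : Set where
  node : List RTree → RTree

mutual
  size : RTree → ℕ
  size (node ts) = suc (sizes ts)

  sizes : List RTree → ℕ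
  sizes [] = 0
  sizes (t ∷ ts) = size t ℕ.+ sizes ts

-- leaves of T_i: non-root vertices without children.  In C_{T_1..T_g}
-- the root lies on the cycle (degree ≥ 2), so these are exactly the
-- pendent vertices of the unicyclic graph lying in T_i.
leavesF : List RTree → ℕ
leavesF [] = 0
leavesF (node [] ∷ ts) = suc (leavesF ts)
leavesF (node (c ∷ cs) ∷ ts) = leavesF (c ∷ cs) ℕ.+ leavesF ts

treeLeaves : RTree → ℕ
treeLeaves (node ts) = leavesF ts

-- Graphs: order n, vertices 0..n-1, an edge list

record Graph : Set where
  constructor mkGraph
  field
    order : ℕ
    edges : List (ℕ × ℕ)
open Graph public

-- edges of a rooted tree whose root gets label o, vertices labelled
-- o, o+1, ..., o + size t - 1 in preorder
mutual
  treeEdges : ℕ → RTree → List (ℕ × ℕ)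
  treeEdges o (node ts) = forestEdges o (suc o) ts

  forestEdges : ℕ → ℕ → List RTree → List (ℕ × ℕ)
  forestEdges p o [] = []
  forestEdges p o (t ∷ ts) = (p , o) ∷ (treeEdges o t ++ forestEdges p (o ℕ.+ size t) ts)

allTreeEdges : ℕ → List RTree → List (ℕ × ℕ)
allTreeEdges o [] = []
allTreeEdges o (t ∷ ts) = treeEdges o t ++ allTreeEdges (o ℕ.+ size t) ts

rootLabels : ℕ → List RTree → List ℕ
rootLabels o [] = []
rootLabels o (t ∷ ts) = o ∷ rootLabels (o ℕ.+ size t) ts

cycleGo : ℕ → List ℕ → List (ℕ × ℕ)
cycleGo first [] = []
cycleGo first (x ∷ []) = (x , first) ∷ []
cycleGo first (x ∷ y ∷ ys) = (x , y) ∷ cycleGo first (y ∷ ys)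

cycleEdges : List ℕ → List (ℕ × ℕ)
cycleEdges [] = []
cycleEdges (r ∷ rs) = cycleGo r (r ∷ rs)

cyc : {g : ℕ} → Vec RTree g → Graph
cyc T = mkGraph (sizes ts) (cycleEdges (rootLabels 0 ts) ++ allTreeEdges 0 ts)
  where ts = toList T

hit : ℕ → ℕ → ℕ × ℕ → ℕ
hit i j (a , b) = if ((a ≡ᵇ i) ∧ (b ≡ᵇ j)) ∨ ((a ≡ᵇ j) ∧ (b ≡ᵇ i)) then 1 else 0

sumℕ : List ℕ → ℕ
sumℕ = foldr ℕ._+_ 0

mult : Graph → ℕ → ℕ → ℕ
mult G i j = sumℕ (map (hit i j) (edges G))

adj : Graph → ℕ → ℕ → Bool
adj G i j = 0 <ᵇ mult G i j

deg : Graph → ℕ → ℕ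
deg G i = sumℕ (map (λ (j : Fin (order G)) → mult G i (toℕ j)) (allFin (order G)))

laplacian : (G : Graph) → Fin (order G) → Fin (order G) → ℤ
laplacian G i j =
  if toℕ i ≡ᵇ toℕ j then + deg G (toℕ i) else - (+ mult G (toℕ i) (toℕ j))

-- Polynomials over ℤ as coefficient lists (constant term first)

Poly : Set
Poly = List ℤ

_+ₚ_ : Poly → Poly → Poly
[] +ₚ q = q
(a ∷ p) +ₚ [] = a ∷ p
(a ∷ p) +ₚ (b ∷ q) = (a ℤ.+ b) ∷ (p +ₚ q)

scaleₚ : ℤ → Poly → Poly
scaleₚ a = map (a ℤ.*_)

_*ₚ_ : Poly → Poly → Poly
[] *ₚ q = []
(a ∷ p) *ₚ q = scaleₚ a q +ₚ ((+ 0) ∷ (p *ₚ q))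

coeff : Poly → ℕ → ℤ
coeff [] k = + 0
coeff (a ∷ p) zero = a
coeff (a ∷ p) (suc k) = coeff p k

sgn : ℕ → ℤ
sgn zero = + 1
sgn (suc k) = - sgn k

det : (n : ℕ) → (Fin n → Fin n → Poly) → Poly
det zero M = (+ 1) ∷ []
det (suc n) M =
  foldr _+ₚ_ []
    (map (λ j → scaleₚ (sgn (toℕ j))
                  (M zero j *ₚ det n (λ r c → M (suc r) (punchIn j c))))
         (allFin (suc n)))

charPoly : Graph → Poly
charPoly G = det (order G) (λ i j →
  (if toℕ i ≡ᵇ toℕ j then (+ 0) ∷ (+ 1) ∷ [] else [])
    +ₚ ((- laplacian G i j) ∷ []))

-- det(λI - L(G)) = Σ_k (-1)^k c_k(G) λ^{n-k}
lapCoeff : Graph → ℕ → ℤ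
lapCoeff G k = sgn k ℤ.* coeff (charPoly G) (order G ∸ k)

_⪯_ : Graph → Graph → Set
G ⪯ H = (order G ≡ order H) × ((k : ℕ) → k ℕ.≤ order G → lapCoeff G k ℤ.≤ lapCoeff H k)

sameCoeffs : Graph → Graph → Set
sameCoeffs G H = (order G ≡ order H) × ((k : ℕ) → k ℕ.≤ order G → lapCoeff G k ≡ lapCoeff H k)

_≅_ : Graph → Graph → Set
G ≅ H = Σ (Fin (order G) ↔ Fin (order H)) λ f →
  (i j : Fin (order G)) →
    adj G (toℕ i) (toℕ j) ≡ adj H (toℕ (Inverse.to f i)) (toℕ (Inverse.to f j))

-- rooted path with k+1 vertices, rooted at an end
pathTree : ℕ → RTree
pathTree zero = node []
pathTree (suc k) = node (pathTree k ∷ [])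

-- BST_{m,l}, rooted at its center: l pendant paths from the center,
-- r = (m-1) mod l of them with q+1 edges and l-r with q edges, where
-- q = ⌊(m-1)/l⌋ (i.e. of orders ⌈(m-1)/l⌉+1 resp. ⌊(m-1)/l⌋+1).
bst : ℕ → ℕ → RTree
bst m zero = node []
bst m (suc l) = node (replicate r (pathTree q) ++ replicate (suc l ∸ r) (pathTree (q ∸ 1)))
  where
    q = (m ∸ 1) / suc l
    r = (m ∸ 1) % suc l

-- hang k t: path u_i u_{i,2} ... u_{i,k+1} whose last vertex is the root of t,
-- rooted at u_i
hang : ℕ → RTree → RTree
hang zero t = t
hang (suc k) t = node (hang k t ∷ [])

Btree : ℕ → ℕ → ℕ → RTree
Btree ni li p = hang (p ∸ 1) (bst (ni ∸ p ℕ.+ 1) li)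

{-# OPTIONS --safe #-}
-- Attach to a rooted tree t the pair (F, D), where F = det(xI + L(t)) and D is the minor with the
-- root deleted. Both have nonnegative coefficients, the pairs obey a simple recursion, and the
-- Laplacian polynomial of the cycle with trees attached is, by deletion and contraction of edges, a
-- polynomial in the pairs of the trees; it is linear in each pair, C_D F + C_F D, with a context
-- (C_F, C_D) that depends on the other trees. Comparing two graphs is thus comparing pairs in all
-- contexts, with polynomials compared coefficientwise.
--
-- The basic move carries the branches at one end of a path to the other end, leaving a single leg
-- behind. It lowers all coefficients when the quotient F/D of what stands at the other end beats
-- that of the leg. Inside a tree it merges all branching vertices into one, which is the end of a
-- path starting at the root, and it equalises the legs there. Finally, if two or more of these
-- centres lie off the cycle, choose one whose tree has the longest legs: a cycle vertex sees these
-- legs at positive distance, so it beats the legs of all other trees and their centres can be moved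
-- to the cycle. All moves are strict, so equality holds only if each tree had its final shape up to
-- the order of the legs, and then the graphs are isomorphic.
module Submission where

-- Comparing needs coefficients that cannot become negative, determinants need a ring. So the pair
-- algebra is developed over any commutative semiring with a notion of positivity and used twice:
-- over all polynomials, where its identities meet the determinant, and over polynomials with
-- alternating signs in λ, where a ≼ b means b = a + z for some z of the same kind. Every inequality
-- is thus an identity with an explicit remainder; it is strict when the remainder has positive
-- value at λ = -1.
--
-- The quotient F/D acts like the conductance from the root to ground, each vertex being grounded
-- with conductance x: branches at a vertex are parallel, an edge is a unit conductance in series.
-- So longer legs and additional branches raise the quotient.
--
-- To keep deletion and contraction within one family of matrices, every vertex carries a pair: the
-- matrix is diag F + diag D · L, and a hanging tree is absorbed into the pair of its root.
--
-- The context of a tree changes whenever another tree is replaced. The distinguished tree is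
-- therefore put into its final form before all others, so that its legs are visible in each context
-- where a centre has to move to the cycle.

-- Determinants over a commutative ring.

module Determinants where
  open import Algebra.Bundles using (CommutativeRing)
  open import Data.Nat using (ℕ; zero; suc)
  open import Data.Fin using (Fin; zero; suc; toℕ; punchIn; punchOut)
  open import Data.Fin.Properties using (punchIn-punchOut; punchInᵢ≢i; _≟_)
  open import Data.Fin.Permutation using (Permutation′; _⟨$⟩ʳ_; remove; punchIn-permute)
  open import Relation.Binary.PropositionalEquality as ≡ using (_≡_; _≢_)
  open import Relation.Nullary using (yes; no; contradiction)

  module Determinant {c ℓ} (R : CommutativeRing c ℓ) where
    open CommutativeRing R hiding (zero)
    open import Algebra.Properties.Semiring.Sum semiring
    open import Algebra.Properties.Ring ring
    open import Relation.Binary.Reasoning.Setoid setoid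
    open import Algebra.Solver.Ring.NaturalCoefficients.Default commutativeSemiring

    Matrix : ℕ → Set c
    Matrix n = Fin n → Fin n → Carrier

    sg : ℕ → Carrier
    sg zero = 1#
    sg (suc k) = - sg k

    sg² : ∀ k → sg k * sg k ≈ 1#
    sg² zero = *-identityˡ 1#
    sg² (suc k) = begin
      - sg k * - sg k      ≈⟨ -‿distribˡ-* _ _ ⟨
      - (sg k * - sg k)    ≈⟨ -‿cong (-‿distribʳ-* _ _) ⟨
      - - (sg k * sg k)    ≈⟨ -‿involutive _ ⟩
      sg k * sg k          ≈⟨ sg² k ⟩
      1#                   ∎

    cancel-sg : ∀ k {a b} → sg k * a ≈ sg k * b → a ≈ b
    cancel-sg k {a} {b} h = begin
      a                    ≈⟨ *-identityˡ a ⟨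
      1# * a               ≈⟨ *-congʳ (sg² k) ⟨
      sg k * sg k * a      ≈⟨ *-assoc _ _ _ ⟩
      sg k * (sg k * a)    ≈⟨ *-congˡ h ⟩
      sg k * (sg k * b)    ≈⟨ *-assoc _ _ _ ⟨
      sg k * sg k * b      ≈⟨ *-congʳ (sg² k) ⟩
      1# * b               ≈⟨ *-identityˡ b ⟩
      b                    ∎

    minor : ∀ {n} → Matrix (suc n) → Fin (suc n) → Fin (suc n) → Matrix n
    minor M i j r c = M (punchIn i r) (punchIn j c)

    detᴿ : ∀ n → Matrix n → Carrier
    detᴿ zero M = 1#
    detᴿ (suc n) M = sum (λ j → sg (toℕ j) * (M zero j * detᴿ n (minor M zero j)))

    det-cong : ∀ n {M N : Matrix n} → (∀ i j → M i j ≈ N i j) → detᴿ n M ≈ detᴿ n N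
    det-cong zero h = refl
    det-cong (suc n) h = sum-cong-≋ λ j →
      *-congˡ {x = sg (toℕ j)} (*-cong (h zero j) (det-cong n (λ r c → h (suc r) (punchIn j c))))

    pull-sum : ∀ {n} a b (f : Fin n → Carrier) → a * (b * sum f) ≈ sum (λ i → a * (b * f i))
    pull-sum a b f = trans (*-congˡ (*-distribˡ-sum b f)) (*-distribˡ-sum a (λ i → b * f i))

    private
      exchange-signs : ∀ s t m p d → - s * (m * (t * (p * d))) ≈ - t * (p * (s * (m * d)))
      exchange-signs s t m p d = begin
        - s * (m * (t * (p * d)))    ≈⟨ -‿distribˡ-* _ _ ⟨
        - (s * (m * (t * (p * d))))
          ≈⟨ -‿cong (solve 5 (λ s t m p d → s :* (m :* (t :* (p :* d))) := t :* (p :* (s :* (m :* d)))) refl s t m p d) ⟩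
        - (t * (p * (s * (m * d))))  ≈⟨ -‿distribˡ-* _ _ ⟩
        - t * (p * (s * (m * d)))    ∎

    -- The corner term is common to both expansions. For the rest, expanding the minors of the first
    -- row along their first column, and those of the first column along their first row, gives the
    -- same double sum over pairs of deleted rows and columns.
    first-column-expansion : ∀ n (M : Matrix (suc n)) →
      detᴿ (suc n) M ≈ sum (λ i → sg (toℕ i) * (M i zero * detᴿ n (minor M i zero)))
    first-column-expansion zero M = refl
    first-column-expansion (suc n) M = +-congˡ (begin
      sum (λ j → - sg (toℕ j) * (M zero (suc j) * detᴿ (suc n) (minor M zero (suc j))))
        ≈⟨ sum-cong-≋ (λ j → *-congˡ {x = - sg (toℕ j)} (*-congˡ {x = M zero (suc j)} (first-column-expansion n (minor M zero (suc j))))) ⟩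
      sum (λ j → - sg (toℕ j) * (M zero (suc j) * sum (λ i → sg (toℕ i) * (M (suc i) zero * D i j))))
        ≈⟨ sum-cong-≋ (λ j → pull-sum (- sg (toℕ j)) (M zero (suc j)) (λ i → sg (toℕ i) * (M (suc i) zero * D i j))) ⟩
      sum (λ j → sum (λ i → - sg (toℕ j) * (M zero (suc j) * (sg (toℕ i) * (M (suc i) zero * D i j)))))
        ≈⟨ ∑-comm (λ j i → - sg (toℕ j) * (M zero (suc j) * (sg (toℕ i) * (M (suc i) zero * D i j)))) ⟩
      sum (λ i → sum (λ j → - sg (toℕ j) * (M zero (suc j) * (sg (toℕ i) * (M (suc i) zero * D i j)))))
        ≈⟨ sum-cong-≋ (λ i → sum-cong-≋ (λ j → exchange-signs (sg (toℕ j)) (sg (toℕ i)) (M zero (suc j)) (M (suc i) zero) (D i j))) ⟩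
      sum (λ i → sum (λ j → - sg (toℕ i) * (M (suc i) zero * (sg (toℕ j) * (M zero (suc j) * D i j)))))
        ≈⟨ sum-cong-≋ (λ i → pull-sum (- sg (toℕ i)) (M (suc i) zero) (λ j → sg (toℕ j) * (M zero (suc j) * D i j))) ⟨
      sum (λ i → - sg (toℕ i) * (M (suc i) zero * detᴿ (suc n) (minor M (suc i) zero))) ∎)
      where
      D : Fin (suc n) → Fin (suc n) → Carrier
      D i j = detᴿ n (λ r c → M (suc (punchIn i r)) (suc (punchIn j c)))

    det-transpose : ∀ n (M : Matrix n) → detᴿ n (λ i j → M j i) ≈ detᴿ n M
    det-transpose zero M = refl
    det-transpose (suc n) M = begin
      sum (λ j → sg (toℕ j) * (M j zero * detᴿ n (λ r c → minor M j zero c r)))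
        ≈⟨ sum-cong-≋ (λ j → *-congˡ {x = sg (toℕ j)} (*-congˡ {x = M j zero} (det-transpose n (minor M j zero)))) ⟩
      sum (λ j → sg (toℕ j) * (M j zero * detᴿ n (minor M j zero)))
        ≈⟨ first-column-expansion n M ⟨
      detᴿ (suc n) M ∎

    tail-terms : ∀ {n} → Matrix (suc (suc n)) → Fin n → Carrier
    tail-terms {n} M j = - - sg (toℕ j) * (M zero (suc (suc j)) * detᴿ (suc n) (minor M zero (suc (suc j))))

    -- In the expansion along the first row the two leading terms trade places and thereby signs.
    -- The minors of all later terms contain both columns, so induction applies to them in
    -- `swap-tail`.
    swap-first-columns : ∀ n {M N : Matrix (suc (suc n))} →
      (∀ i → M i zero ≈ N i (suc zero)) → (∀ i → M i (suc zero) ≈ N i zero) →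
      (∀ i j → M i (suc (suc j)) ≈ N i (suc (suc j))) →
      detᴿ (suc (suc n)) M ≈ - detᴿ (suc (suc n)) N

    swap-tail : ∀ n {M N : Matrix (suc (suc n))} →
      (∀ i → M i zero ≈ N i (suc zero)) → (∀ i → M i (suc zero) ≈ N i zero) →
      (∀ i j → M i (suc (suc j)) ≈ N i (suc (suc j))) →
      sum (tail-terms M) ≈ - sum (tail-terms N)
    swap-tail zero h₀ h₁ h = sym -0#≈0#
    swap-tail (suc n) {M} {N} h₀ h₁ h = begin
      sum (tail-terms M)                    ≈⟨ sum-cong-≋ step ⟩
      sum (λ j → - 1# * tail-terms N j)     ≈⟨ *-distribˡ-sum (- 1#) (tail-terms N) ⟨
      - 1# * sum (tail-terms N)             ≈⟨ -1*x≈-x _ ⟩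
      - sum (tail-terms N)                  ∎
      where
      neg : ∀ a b c → a * (b * - c) ≈ - 1# * (a * (b * c))
      neg a b c = begin
        a * (b * - c)         ≈⟨ *-congˡ (-‿distribʳ-* b c) ⟨
        a * - (b * c)         ≈⟨ -‿distribʳ-* a _ ⟨
        - (a * (b * c))       ≈⟨ -1*x≈-x _ ⟨
        - 1# * (a * (b * c))  ∎
      step : ∀ j → tail-terms M j ≈ - 1# * tail-terms N j
      step j = begin
        - - sg (toℕ j) * (M zero (suc (suc j)) * detᴿ (suc (suc n)) (minor M zero (suc (suc j))))
          ≈⟨ *-congˡ (*-cong (h zero j) (swap-first-columns n {minor M zero (suc (suc j))} {minor N zero (suc (suc j))}
               (λ i → h₀ (suc i)) (λ i → h₁ (suc i)) (λ i k → h (suc i) (punchIn j k)))) ⟩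
        - - sg (toℕ j) * (N zero (suc (suc j)) * - detᴿ (suc (suc n)) (minor N zero (suc (suc j))))
          ≈⟨ neg (- - sg (toℕ j)) (N zero (suc (suc j))) (detᴿ (suc (suc n)) (minor N zero (suc (suc j)))) ⟩
        - 1# * tail-terms N j ∎

    swap-first-columns n {M} {N} h₀ h₁ h = begin
      1# * (M zero zero * detᴿ (suc n) (minor M zero zero)) +
        (- 1# * (M zero (suc zero) * detᴿ (suc n) (minor M zero (suc zero))) + sum (tail-terms M))
        ≈⟨ +-cong (*-congˡ (*-cong (h₀ zero) (det-cong (suc n) m₀)))
            (+-cong (*-congˡ (*-cong (h₁ zero) (det-cong (suc n) m₁))) (swap-tail n {M} {N} h₀ h₁ h)) ⟩
      1# * a + (- 1# * b + - s)        ≈⟨ +-cong (*-identityˡ a) (+-congʳ (-1*x≈-x b)) ⟩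
      a + (- b + - s)                  ≈⟨ +-congʳ (trans (-‿cong (-1*x≈-x a)) (-‿involutive a)) ⟨
      - (- 1# * a) + (- b + - s)       ≈⟨ +-assoc _ _ _ ⟨
      - (- 1# * a) + - b + - s         ≈⟨ +-congʳ (+-comm _ _) ⟩
      - b + - (- 1# * a) + - s         ≈⟨ +-assoc _ _ _ ⟩
      - b + (- (- 1# * a) + - s)       ≈⟨ +-congˡ (-‿+-comm _ _) ⟩
      - b + - (- 1# * a + s)           ≈⟨ -‿+-comm _ _ ⟩
      - (b + (- 1# * a + s))           ≈⟨ -‿cong (+-congʳ (*-identityˡ b)) ⟨
      - (1# * b + (- 1# * a + s))      ∎
      where
      a = N zero (suc zero) * detᴿ (suc n) (minor N zero (suc zero))
      b = N zero zero * detᴿ (suc n) (minor N zero zero)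
      s = sum (tail-terms N)
      m₀ : ∀ i j → minor M zero zero i j ≈ minor N zero (suc zero) i j
      m₀ i zero = h₁ (suc i)
      m₀ i (suc j) = h (suc i) j
      m₁ : ∀ i j → minor M zero (suc zero) i j ≈ minor N zero zero i j
      m₁ i zero = h₀ (suc i)
      m₁ i (suc j) = h (suc i) j

    to-front : ∀ {n} {A : Set c} → Fin (suc n) → (Fin (suc n) → A) → Fin (suc n) → A
    to-front k f zero = f k
    to-front k f (suc j) = f (punchIn k j)

    to-second : ∀ {n} {A : Set c} → Fin (suc n) → (Fin (suc (suc n)) → A) → Fin (suc (suc n)) → A
    to-second k f zero = f zero
    to-second k f (suc j) = to-front k (λ i → f (suc i)) j

    mutual
      -- A column reaches the front by way of the second place: `det-to-second` brings it there by
      -- moving it to the front of every minor of the first column, and one swap finishes. Hence the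
      -- mutual recursion.
      det-to-front : ∀ n k (M : Matrix (suc n)) →
        detᴿ (suc n) (λ i → to-front k (M i)) ≈ sg (toℕ k) * detᴿ (suc n) M
      det-to-front n zero M =
        trans (det-cong (suc n) {λ i → to-front zero (M i)} {M} (λ { i zero → refl ; i (suc j) → refl })) (sym (*-identityˡ _))
      det-to-front (suc n) (suc k) M = begin
        detᴿ (suc (suc n)) (λ i → to-front (suc k) (M i))
          ≈⟨ swap-first-columns n {λ i → to-front (suc k) (M i)} {λ i → to-second k (M i)} (λ _ → refl) (λ _ → refl) (λ _ _ → refl) ⟩
        - detᴿ (suc (suc n)) (λ i → to-second k (M i))     ≈⟨ -‿cong (det-to-second n k M) ⟩
        - (sg (toℕ k) * detᴿ (suc (suc n)) M)              ≈⟨ -‿distribˡ-* _ _ ⟩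
        - sg (toℕ k) * detᴿ (suc (suc n)) M                ∎

      det-to-second : ∀ n k (M : Matrix (suc (suc n))) →
        detᴿ (suc (suc n)) (λ i → to-second k (M i)) ≈ sg (toℕ k) * detᴿ (suc (suc n)) M
      det-to-second n k M = begin
        detᴿ (suc (suc n)) (λ i → to-second k (M i))
          ≈⟨ first-column-expansion (suc n) (λ i → to-second k (M i)) ⟩
        sum (λ i → sg (toℕ i) * (M i zero * detᴿ (suc n) (λ r → to-front k (minor M i zero r))))
          ≈⟨ sum-cong-≋ (λ i → *-congˡ {sg (toℕ i)} (*-congˡ {M i zero} (det-to-front n k (minor M i zero)))) ⟩
        sum (λ i → sg (toℕ i) * (M i zero * (sg (toℕ k) * detᴿ (suc n) (minor M i zero))))
          ≈⟨ sum-cong-≋ (λ i → solve 4 (λ s m t d → s :* (m :* (t :* d)) := t :* (s :* (m :* d))) refl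
               (sg (toℕ i)) (M i zero) (sg (toℕ k)) (detᴿ (suc n) (minor M i zero))) ⟩
        sum (λ i → sg (toℕ k) * (sg (toℕ i) * (M i zero * detᴿ (suc n) (minor M i zero))))
          ≈⟨ *-distribˡ-sum (sg (toℕ k)) (λ i → sg (toℕ i) * (M i zero * detᴿ (suc n) (minor M i zero))) ⟨
        sg (toℕ k) * sum (λ i → sg (toℕ i) * (M i zero * detᴿ (suc n) (minor M i zero)))
          ≈⟨ *-congˡ (first-column-expansion (suc n) M) ⟨
        sg (toℕ k) * detᴿ (suc (suc n)) M ∎

    -- The sign of k stands on the left instead of in every term; `cancel-sg` removes it in
    -- applications.
    column-expansion : ∀ n k (M : Matrix (suc n)) →
      sg (toℕ k) * detᴿ (suc n) M ≈ sum (λ i → sg (toℕ i) * (M i k * detᴿ n (minor M i k)))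
    column-expansion n k M = trans (sym (det-to-front n k M)) (first-column-expansion n (λ i → to-front k (M i)))

    row-expansion : ∀ n k (M : Matrix (suc n)) →
      sg (toℕ k) * detᴿ (suc n) M ≈ sum (λ j → sg (toℕ j) * (M k j * detᴿ n (minor M k j)))
    row-expansion n k M = begin
      sg (toℕ k) * detᴿ (suc n) M                  ≈⟨ *-congˡ (det-transpose (suc n) M) ⟨
      sg (toℕ k) * detᴿ (suc n) (λ i j → M j i)    ≈⟨ column-expansion n k (λ i j → M j i) ⟩
      sum (λ j → sg (toℕ j) * (M k j * detᴿ n (λ r c → minor M k j c r)))
        ≈⟨ sum-cong-≋ (λ j → *-congˡ {x = sg (toℕ j)} (*-congˡ {x = M k j} (det-transpose n (minor M k j)))) ⟩
      sum (λ j → sg (toℕ j) * (M k j * detᴿ n (minor M k j))) ∎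

    -- Antisymmetry would give only 2d = 0, and 2 may be a zero divisor. In the expansion itself the
    -- two leading terms cancel, while all other minors again have two equal columns.
    equal-first-columns : ∀ n {M : Matrix (suc (suc n))} →
      (∀ i → M i zero ≈ M i (suc zero)) → detᴿ (suc (suc n)) M ≈ 0#

    equal-tail : ∀ n {M : Matrix (suc (suc n))} →
      (∀ i → M i zero ≈ M i (suc zero)) → sum (tail-terms M) ≈ 0#
    equal-tail zero h = refl
    equal-tail (suc n) {M} h = begin
      sum (tail-terms M)      ≈⟨ sum-cong-≋ step ⟩
      sum {suc n} (λ j → 0#)  ≈⟨ sum-replicate-zero (suc n) ⟩
      0#                      ∎
      where
      step : ∀ j → tail-terms M j ≈ 0#
      step j = begin
        - - sg (toℕ j) * (M zero (suc (suc j)) * detᴿ (suc (suc n)) (minor M zero (suc (suc j))))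
          ≈⟨ *-congˡ (*-congˡ (equal-first-columns n {minor M zero (suc (suc j))} (λ i → h (suc i)))) ⟩
        - - sg (toℕ j) * (M zero (suc (suc j)) * 0#)   ≈⟨ *-congˡ (zeroʳ _) ⟩
        - - sg (toℕ j) * 0#                            ≈⟨ zeroʳ _ ⟩
        0#                                             ∎

    equal-first-columns n {M} h = begin
      1# * (M zero zero * detᴿ (suc n) (minor M zero zero)) + (- 1# * (M zero (suc zero) * d) + sum (tail-terms M))
        ≈⟨ +-cong (*-congˡ (*-cong (h zero) (det-cong (suc n) m))) (+-congˡ (equal-tail n {M} h)) ⟩
      1# * (M zero (suc zero) * d) + (- 1# * (M zero (suc zero) * d) + 0#)
        ≈⟨ +-cong (*-identityˡ _) (trans (+-identityʳ _) (-1*x≈-x _)) ⟩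
      M zero (suc zero) * d + - (M zero (suc zero) * d)
        ≈⟨ -‿inverseʳ _ ⟩
      0# ∎
      where
      d = detᴿ (suc n) (minor M zero (suc zero))
      m : ∀ i j → minor M zero zero i j ≈ minor M zero (suc zero) i j
      m i zero = sym (h (suc i))
      m i (suc j) = refl

    equal-columns : ∀ n {M : Matrix n} {a b : Fin n} → a ≢ b → (∀ i → M i a ≈ M i b) → detᴿ n M ≈ 0#
    equal-columns (suc n) {M} {a} {b} a≢b h = cancel-sg (toℕ a) (begin
      sg (toℕ a) * detᴿ (suc n) M                   ≈⟨ det-to-front n a M ⟨
      detᴿ (suc n) (λ i → to-front a (M i))
        ≈⟨ front n {λ i → to-front a (M i)} (punchOut a≢b) (λ i → trans (h i) (reflexive (≡.cong (M i) (≡.sym (punchIn-punchOut a≢b))))) ⟩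
      0#                                           ≈⟨ zeroʳ _ ⟨
      sg (toℕ a) * 0#                              ∎)
      where
      front : ∀ n {M : Matrix (suc n)} k → (∀ i → M i zero ≈ M i (suc k)) → detᴿ (suc n) M ≈ 0#
      front (suc n) {M} k h = cancel-sg (toℕ k) (begin
        sg (toℕ k) * detᴿ (suc (suc n)) M             ≈⟨ det-to-second n k M ⟨
        detᴿ (suc (suc n)) (λ i → to-second k (M i))  ≈⟨ equal-first-columns n {λ i → to-second k (M i)} h ⟩
        0#                                           ≈⟨ zeroʳ _ ⟨
        sg (toℕ k) * 0#                              ∎)

    equal-rows : ∀ n {M : Matrix n} {a b : Fin n} → a ≢ b → (∀ j → M a j ≈ M b j) → detᴿ n M ≈ 0#
    equal-rows n {M} a≢b h = trans (sym (det-transpose n M)) (equal-columns n {λ i j → M j i} a≢b h)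

    row-linear : ∀ n {M N P : Matrix n} a s t →
      (∀ j → M a j ≈ s * N a j + t * P a j) →
      (∀ i → i ≢ a → ∀ j → M i j ≈ N i j) → (∀ i → i ≢ a → ∀ j → M i j ≈ P i j) →
      detᴿ n M ≈ s * detᴿ n N + t * detᴿ n P
    row-linear (suc n) {M} {N} {P} a s t ha hN hP = cancel-sg (toℕ a) (begin
      sg (toℕ a) * detᴿ (suc n) M                     ≈⟨ row-expansion n a M ⟩
      sum (λ j → sg (toℕ j) * (M a j * detᴿ n (minor M a j)))  ≈⟨ sum-cong-≋ step ⟩
      sum (λ j → s * f j + t * g j)                  ≈⟨ ∑-distrib-+ (λ j → s * f j) (λ j → t * g j) ⟩
      sum (λ j → s * f j) + sum (λ j → t * g j)      ≈⟨ +-cong (*-distribˡ-sum s f) (*-distribˡ-sum t g) ⟨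
      s * sum f + t * sum g                          ≈⟨ +-cong (*-congˡ (row-expansion n a N)) (*-congˡ (row-expansion n a P)) ⟨
      s * (sg (toℕ a) * detᴿ (suc n) N) + t * (sg (toℕ a) * detᴿ (suc n) P)
        ≈⟨ solve 5 (λ s t g x y → s :* (g :* x) :+ t :* (g :* y) := g :* (s :* x :+ t :* y)) refl s t (sg (toℕ a)) (detᴿ (suc n) N) (detᴿ (suc n) P) ⟩
      sg (toℕ a) * (s * detᴿ (suc n) N + t * detᴿ (suc n) P) ∎)
      where
      f g : Fin (suc n) → Carrier
      f j = sg (toℕ j) * (N a j * detᴿ n (minor N a j))
      g j = sg (toℕ j) * (P a j * detᴿ n (minor P a j))
      step : ∀ j → sg (toℕ j) * (M a j * detᴿ n (minor M a j)) ≈ s * f j + t * g j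
      step j = begin
        sg (toℕ j) * (M a j * d)                            ≈⟨ *-congˡ (*-congʳ (ha j)) ⟩
        sg (toℕ j) * ((s * N a j + t * P a j) * d)
          ≈⟨ solve 6 (λ g s x t y d → g :* ((s :* x :+ t :* y) :* d) := s :* (g :* (x :* d)) :+ t :* (g :* (y :* d))) refl (sg (toℕ j)) s (N a j) t (P a j) d ⟩
        s * (sg (toℕ j) * (N a j * d)) + t * (sg (toℕ j) * (P a j * d))
          ≈⟨ +-cong (*-congˡ (*-congˡ (*-congˡ (det-cong n (λ r c → hN (punchIn a r) (punchInᵢ≢i a r) (punchIn j c))))))
                    (*-congˡ (*-congˡ (*-congˡ (det-cong n (λ r c → hP (punchIn a r) (punchInᵢ≢i a r) (punchIn j c)))))) ⟩
        s * f j + t * g j ∎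
        where d = detᴿ n (minor M a j)

    sum-single : ∀ {n} (k : Fin n) (f : Fin n → Carrier) → (∀ j → j ≢ k → f j ≈ 0#) → sum f ≈ f k
    sum-single {suc n} k f h = begin
      sum f                                ≈⟨ sum-remove {i = k} f ⟩
      f k + sum (λ j → f (punchIn k j))    ≈⟨ +-congˡ (trans (sum-cong-≋ (λ j → h _ (punchInᵢ≢i k j))) (sum-replicate-zero n)) ⟩
      f k + 0#                             ≈⟨ +-identityʳ _ ⟩
      f k                                  ∎

    -- Expansion along row b leaves the diagonal term alone, so the other entries of column b do not
    -- enter. This lets a matrix be exchanged for that of a graph in which b is isolated.
    unit-row : ∀ n {M N : Matrix n} b →
      (∀ j → M b j ≈ N b j) → (∀ j → j ≢ b → M b j ≈ 0#) →
      (∀ i j → i ≢ b → j ≢ b → M i j ≈ N i j) → detᴿ n M ≈ detᴿ n N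
    unit-row (suc n) {M} {N} b hb h0 h = cancel-sg (toℕ b) (begin
      sg (toℕ b) * detᴿ (suc n) M ≈⟨ expand M h0 ⟩
      sg (toℕ b) * (M b b * detᴿ n (minor M b b))
        ≈⟨ *-congˡ (*-cong (hb b) (det-cong n (λ r c → h _ _ (punchInᵢ≢i b r) (punchInᵢ≢i b c)))) ⟩
      sg (toℕ b) * (N b b * detᴿ n (minor N b b)) ≈⟨ expand N (λ j j≢b → trans (sym (hb j)) (h0 j j≢b)) ⟨
      sg (toℕ b) * detᴿ (suc n) N ∎)
      where
      expand : ∀ (M : Matrix (suc n)) → (∀ j → j ≢ b → M b j ≈ 0#) →
        sg (toℕ b) * detᴿ (suc n) M ≈ sg (toℕ b) * (M b b * detᴿ n (minor M b b))
      expand M h0 = trans (row-expansion n b M)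
        (sum-single b (λ j → sg (toℕ j) * (M b j * detᴿ n (minor M b j)))
          (λ j j≢b → trans (*-congˡ (trans (*-congʳ (h0 j j≢b)) (zeroˡ _))) (zeroʳ (sg (toℕ j)))))

    det-neg : ∀ n (M : Matrix n) → detᴿ n (λ i j → - M i j) ≈ sg n * detᴿ n M
    det-neg zero M = sym (*-identityˡ 1#)
    det-neg (suc n) M = begin
      sum (λ j → sg (toℕ j) * (- M zero j * detᴿ n (λ r c → - minor M zero j r c)))
        ≈⟨ sum-cong-≋ (λ j → *-congˡ {x = sg (toℕ j)} (*-congˡ {x = - M zero j} (det-neg n (minor M zero j)))) ⟩
      sum (λ j → sg (toℕ j) * (- M zero j * (sg n * detᴿ n (minor M zero j))))
        ≈⟨ sum-cong-≋ (λ j → trans (*-congˡ (trans (sym (-‿distribˡ-* (M zero j) _)) (trans (-‿cong (swap (M zero j) (sg n) (detᴿ n (minor M zero j)))) (-‿distribˡ-* (sg n) _))))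
             (swap (sg (toℕ j)) (- sg n) _)) ⟩
      sum (λ j → - sg n * (sg (toℕ j) * (M zero j * detᴿ n (minor M zero j))))
        ≈⟨ *-distribˡ-sum (- sg n) (λ j → sg (toℕ j) * (M zero j * detᴿ n (minor M zero j))) ⟨
      - sg n * detᴿ (suc n) M ∎
      where
      swap : ∀ a b c → a * (b * c) ≈ b * (a * c)
      swap = solve 3 (λ a b c → a :* (b :* c) := b :* (a :* c)) refl

    -- The sign of π in the form in which repeated expansion along rows produces it. Rows and
    -- columns will be permuted together, so it enters squared.
    signature : ∀ n → Permutation′ n → Carrier
    signature zero π = 1#
    signature (suc n) π = sg (toℕ (π ⟨$⟩ʳ zero)) * signature n (remove zero π)

    signature² : ∀ n (π : Permutation′ n) → signature n π * signature n π ≈ 1#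
    signature² zero π = *-identityˡ 1#
    signature² (suc n) π = begin
      g * s * (g * s)      ≈⟨ solve 2 (λ g s → g :* s :* (g :* s) := g :* g :* (s :* s)) refl g s ⟩
      g * g * (s * s)      ≈⟨ *-cong (sg² (toℕ (π ⟨$⟩ʳ zero))) (signature² n (remove zero π)) ⟩
      1# * 1#              ≈⟨ *-identityˡ 1# ⟩
      1#                   ∎
      where
      g = sg (toℕ (π ⟨$⟩ʳ zero))
      s = signature n (remove zero π)

    permute-rows : ∀ n (π : Permutation′ n) (M : Matrix n) →
      detᴿ n (λ i j → M (π ⟨$⟩ʳ i) j) ≈ signature n π * detᴿ n M
    permute-rows zero π M = sym (*-identityˡ 1#)
    permute-rows (suc n) π M = begin
      sum (λ j → sg (toℕ j) * (M k j * detᴿ n (λ r c → M (π ⟨$⟩ʳ suc r) (punchIn j c))))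
        ≈⟨ sum-cong-≋ (λ j → *-congˡ {x = sg (toℕ j)} (*-congˡ {x = M k j} (trans
             (det-cong n (λ r c → reflexive (≡.cong (λ i → M i (punchIn j c)) (punchIn-permute π zero r))))
             (permute-rows n (remove zero π) (minor M k j))))) ⟩
      sum (λ j → sg (toℕ j) * (M k j * (s * detᴿ n (minor M k j))))
        ≈⟨ sum-cong-≋ (λ j → solve 4 (λ g m s d → g :* (m :* (s :* d)) := s :* (g :* (m :* d))) refl
             (sg (toℕ j)) (M k j) s (detᴿ n (minor M k j))) ⟩
      sum (λ j → s * (sg (toℕ j) * (M k j * detᴿ n (minor M k j))))
        ≈⟨ *-distribˡ-sum s (λ j → sg (toℕ j) * (M k j * detᴿ n (minor M k j))) ⟨
      s * sum (λ j → sg (toℕ j) * (M k j * detᴿ n (minor M k j)))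
        ≈⟨ *-congˡ (row-expansion n k M) ⟨
      s * (sg (toℕ k) * detᴿ (suc n) M)
        ≈⟨ solve 3 (λ s g d → s :* (g :* d) := g :* s :* d) refl s (sg (toℕ k)) (detᴿ (suc n) M) ⟩
      sg (toℕ k) * s * detᴿ (suc n) M ∎
      where
      k = π ⟨$⟩ʳ zero
      s = signature n (remove zero π)

    permute-rows-and-columns : ∀ n (π : Permutation′ n) (M : Matrix n) →
      detᴿ n (λ i j → M (π ⟨$⟩ʳ i) (π ⟨$⟩ʳ j)) ≈ detᴿ n M
    permute-rows-and-columns n π M = begin
      detᴿ n (λ i j → M (π ⟨$⟩ʳ i) (π ⟨$⟩ʳ j))        ≈⟨ permute-rows n π (λ i j → M i (π ⟨$⟩ʳ j)) ⟩
      s * detᴿ n (λ i j → M i (π ⟨$⟩ʳ j))             ≈⟨ *-congˡ (det-transpose n (λ i j → M i (π ⟨$⟩ʳ j))) ⟨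
      s * detᴿ n (λ i j → M j (π ⟨$⟩ʳ i))             ≈⟨ *-congˡ (permute-rows n π (λ i j → M j i)) ⟩
      s * (s * detᴿ n (λ i j → M j i))                ≈⟨ *-assoc _ _ _ ⟨
      s * s * detᴿ n (λ i j → M j i)                  ≈⟨ *-cong (signature² n π) (det-transpose n M) ⟩
      1# * detᴿ n M                                   ≈⟨ *-identityˡ _ ⟩
      detᴿ n M                                        ∎
      where s = signature n π

    add-column : ∀ n {M N : Matrix n} {a b : Fin n} → a ≢ b →
      (∀ i → N i a ≈ M i a + M i b) → (∀ i j → j ≢ a → N i j ≈ M i j) → detᴿ n N ≈ detᴿ n M
    add-column n {M} {N} {a} {b} a≢b ha h = begin
      detᴿ n N                          ≈⟨ det-transpose n N ⟨
      detᴿ n (λ i j → N j i)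
        ≈⟨ row-linear n {λ i j → N j i} {λ i j → M j i} {λ i j → P j i} a 1# 1#
             (λ j → trans (ha j) (+-cong (sym (*-identityˡ _)) (trans (sym (P-a j)) (sym (*-identityˡ _)))))
             (λ i i≢a j → h j i i≢a) (λ i i≢a j → trans (h j i i≢a) (sym (P-other j i i≢a))) ⟩
      1# * detᴿ n (λ i j → M j i) + 1# * detᴿ n (λ i j → P j i)
        ≈⟨ +-cong (trans (*-identityˡ _) (det-transpose n M)) (trans (*-identityˡ _) (det-transpose n P)) ⟩
      detᴿ n M + detᴿ n P
        ≈⟨ +-congˡ (equal-columns n {P} a≢b (λ i → trans (P-a i) (sym (P-other i b (≡.≢-sym a≢b))))) ⟩
      detᴿ n M + 0#                     ≈⟨ +-identityʳ _ ⟩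
      detᴿ n M                          ∎
      where
      P : Matrix n
      P i j with j ≟ a
      ... | yes _ = M i b
      ... | no _  = M i j
      P-a : ∀ i → P i a ≈ M i b
      P-a i with a ≟ a
      ... | yes _ = refl
      ... | no ¬p = contradiction ≡.refl ¬p
      P-other : ∀ i j → j ≢ a → P i j ≈ M i j
      P-other i j j≢a with j ≟ a
      ... | yes p = contradiction p j≢a
      ... | no _  = refl

-- Weighted Laplacians of edge lists; deletion and contraction.

module EdgeLaplacians where
  open Determinants
  open import Algebra.Bundles using (CommutativeRing)
  open import Data.Nat using (ℕ; zero; suc)
  open import Data.Nat.Properties using () renaming (_≟_ to _≟ℕ_)
  open import Data.Fin using (Fin; zero; suc; toℕ)
  open import Data.Fin.Properties using (_≟_; toℕ-injective)
  open import Data.List using (List; []; _∷_; map)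
  open import Data.Product using (_×_; _,_; proj₁; proj₂)
  open import Relation.Binary.PropositionalEquality as ≡ using (_≡_; _≢_)
  open import Relation.Nullary using (yes; no; contradiction; Dec)
  open import Data.List.Relation.Binary.Permutation.Propositional using (_↭_; prep; swap)
  import Data.List.Relation.Binary.Permutation.Propositional as Perm

  choose : ∀ {a p} {A : Set a} {P : Set p} → Dec P → A → A → A
  choose (yes _) x y = x
  choose (no _) x y = y

  module GraphDeterminant {c ℓ} (R : CommutativeRing c ℓ) where
    open CommutativeRing R hiding (zero)
    open import Algebra.Properties.Ring ring
    open import Relation.Binary.Reasoning.Setoid setoid
    open import Algebra.Solver.Ring.NaturalCoefficients.Default commutativeSemiring
    open Determinant R

    Edge : Set
    Edge = ℕ × ℕ

    Pair : Set c
    Pair = Carrier × Carrier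

    δ : ℕ → ℕ → Carrier
    δ a i = choose (a ≟ℕ i) 1# 0#

    δ-refl : ∀ a → δ a a ≈ 1#
    δ-refl a with a ≟ℕ a
    ... | yes _ = refl
    ... | no ¬p = contradiction ≡.refl ¬p

    δ-≢ : ∀ {a i} → a ≢ i → δ a i ≈ 0#
    δ-≢ {a} {i} a≢i with a ≟ℕ i
    ... | yes p = contradiction p a≢i
    ... | no _  = refl

    χ : Edge → ℕ → Carrier
    χ (a , b) i = δ a i - δ b i

    -- Sum of outer squares of incidence vectors: every edge contributes a matrix of rank at most
    -- one, independent of its orientation, and a loop contributes zero.
    lap : List Edge → ℕ → ℕ → Carrier
    lap [] i j = 0#
    lap (e ∷ es) i j = χ e i * χ e j + lap es i j

    entry : (ℕ → Pair) → List Edge → ℕ → ℕ → Carrier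
    entry w es i j = δ i j * proj₁ (w i) + proj₂ (w i) * lap es i j

    -- det(diag F + diag D · L); for F = x and D = 1 this is det(xI + L).
    Z : ℕ → (ℕ → Pair) → List Edge → Carrier
    Z n w es = detᴿ n (λ i j → entry w es (toℕ i) (toℕ j))

    _⋆_ : Pair → Pair → Pair
    (f , d) ⋆ (f′ , d′) = f * d′ + f′ * d , d * d′

    contract : ℕ → ℕ → ℕ → ℕ
    contract a b v = choose (v ≟ℕ b) a v

    contractE : ℕ → ℕ → Edge → Edge
    contractE a b (u , v) = contract a b u , contract a b v

    -- The pair (1, 0) makes an isolated vertex invisible: its row of the matrix is a unit vector.
    contractW : ℕ → ℕ → (ℕ → Pair) → ℕ → Pair
    contractW a b w v = choose (v ≟ℕ b) (1# , 0#) (choose (v ≟ℕ a) (w a ⋆ w b) (w v))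

    δ-contract : ∀ {a b i} → i ≢ b → ∀ v → δ (contract a b v) i ≈ δ v i + δ a i * δ v b
    δ-contract {a} {b} {i} i≢b v with v ≟ℕ b
    ... | yes ≡.refl = begin
      δ a i               ≈⟨ *-identityʳ _ ⟨
      δ a i * 1#          ≈⟨ +-identityˡ _ ⟨
      0# + δ a i * 1#     ≈⟨ +-congʳ (δ-≢ (λ p → i≢b (≡.sym p))) ⟨
      δ b i + δ a i * 1#  ∎
    ... | no v≢b = begin
      δ v i               ≈⟨ +-identityʳ _ ⟨
      δ v i + 0#          ≈⟨ +-congˡ (zeroʳ _) ⟨
      δ v i + δ a i * 0#  ∎

    χ-contract : ∀ {a b i} → i ≢ b → ∀ e → χ (contractE a b e) i ≈ χ e i + δ a i * χ e b
    χ-contract {a} {b} {i} i≢b (u , v) = begin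
      δ (contract a b u) i - δ (contract a b v) i
        ≈⟨ +-cong (δ-contract {a} i≢b u) (-‿cong (δ-contract {a} i≢b v)) ⟩
      (δ u i + k * δ u b) - (δ v i + k * δ v b)
        ≈⟨ +-congˡ (-‿+-comm _ _) ⟨
      (δ u i + k * δ u b) + (- δ v i + - (k * δ v b))
        ≈⟨ +-congˡ (+-congˡ (-‿distribʳ-* _ _)) ⟩
      (δ u i + k * δ u b) + (- δ v i + k * - δ v b)
        ≈⟨ solve 5 (λ p q r s k → (p :+ k :* q) :+ (r :+ k :* s) := (p :+ r) :+ k :* (q :+ s)) refl (δ u i) (δ u b) (- δ v i) (- δ v b) k ⟩
      χ (u , v) i + k * χ (u , v) b ∎
      where k = δ a i

    -- Contraction adds the entry b of each incidence vector to its entry a. In the Laplacian this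
    -- adds row b to row a and column b to column a.
    lap-contract : ∀ {a b i j} → i ≢ b → j ≢ b → ∀ es → lap (map (contractE a b) es) i j ≈
      (lap es i j + δ a j * lap es i b) + (δ a i * lap es b j + δ a i * (δ a j * lap es b b))
    lap-contract {a} {b} {i} {j} _ _ [] =
      solve 2 (λ k l → con 0 := (con 0 :+ l :* con 0) :+ (k :* con 0 :+ k :* (l :* con 0))) refl (δ a i) (δ a j)
    lap-contract {a} {b} {i} {j} i≢b j≢b (e ∷ es) = begin
      χ (contractE a b e) i * χ (contractE a b e) j + lap (map (contractE a b) es) i j
        ≈⟨ +-cong (*-cong (χ-contract {a} i≢b e) (χ-contract {a} j≢b e)) (lap-contract i≢b j≢b es) ⟩
      (χ e i + k * χ e b) * (χ e j + l * χ e b) + ((lap es i j + l * lap es i b) + (k * lap es b j + k * (l * lap es b b)))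
        ≈⟨ solve 9 (λ k l xi xj xb p q r s →
             (xi :+ k :* xb) :* (xj :+ l :* xb) :+ ((p :+ l :* q) :+ (k :* r :+ k :* (l :* s)))
             := ((xi :* xj :+ p) :+ l :* (xi :* xb :+ q)) :+ (k :* (xb :* xj :+ r) :+ k :* (l :* (xb :* xb :+ s))))
           refl k l (χ e i) (χ e j) (χ e b) (lap es i j) (lap es i b) (lap es b j) (lap es b b) ⟩
      (lap (e ∷ es) i j + l * lap (e ∷ es) i b) + (k * lap (e ∷ es) b j + k * (l * lap (e ∷ es) b b)) ∎
      where
      k = δ a i
      l = δ a j

    lap-↭ : ∀ {es es′} → es ↭ es′ → ∀ i j → lap es i j ≈ lap es′ i j
    lap-↭ Perm.refl i j = refl
    lap-↭ (prep e p) i j = +-congˡ (lap-↭ p i j)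
    lap-↭ (swap {xs} {ys} e f p) i j = begin
      u + (v + lap xs i j)  ≈⟨ +-congˡ (+-congˡ (lap-↭ p i j)) ⟩
      u + (v + lap ys i j)  ≈⟨ solve 3 (λ u v l → u :+ (v :+ l) := v :+ (u :+ l)) refl u v (lap ys i j) ⟩
      v + (u + lap ys i j)  ∎
      where
      u = χ e i * χ e j
      v = χ f i * χ f j
    lap-↭ (Perm.trans p q) i j = trans (lap-↭ p i j) (lap-↭ q i j)

    Z-↭ : ∀ n w {es es′} → es ↭ es′ → Z n w es ≈ Z n w es′
    Z-↭ n w {es} {es′} p = det-cong n {λ i j → entry w es (toℕ i) (toℕ j)} {λ i j → entry w es′ (toℕ i) (toℕ j)}
      (λ i j → +-congˡ (*-congˡ (lap-↭ p (toℕ i) (toℕ j))))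

    infix 4 _≋_
    _≋_ : Pair → Pair → Set ℓ
    (f , d) ≋ (f′ , d′) = (f ≈ f′) × (d ≈ d′)

    module _ {n} {a b : Fin n} (a≢b : a ≢ b) (M₀ : Matrix n) where
      private
        b≢a : b ≢ a
        b≢a p = a≢b (≡.sym p)

      set-rows : (r s : Fin n → Carrier) → Matrix n
      set-rows r s i j with i ≟ a
      ... | yes _ = r j
      ... | no _ with i ≟ b
      ... | yes _ = s j
      ... | no _ = M₀ i j

      set-rows-a : ∀ r s j → set-rows r s a j ≡ r j
      set-rows-a r s j with a ≟ a
      ... | yes _ = ≡.refl
      ... | no ¬p = contradiction ≡.refl ¬p

      set-rows-b : ∀ r s j → set-rows r s b j ≡ s j
      set-rows-b r s j with b ≟ a
      ... | yes p = contradiction p b≢a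
      ... | no _ with b ≟ b
      ... | yes _ = ≡.refl
      ... | no ¬p = contradiction ≡.refl ¬p

      set-rows-other : ∀ r s i → i ≢ a → i ≢ b → ∀ j → set-rows r s i j ≡ M₀ i j
      set-rows-other r s i i≢a i≢b j with i ≟ a
      ... | yes p = contradiction p i≢a
      ... | no _ with i ≟ b
      ... | yes p = contradiction p i≢b
      ... | no _ = ≡.refl

      -- The determinant viewed as an alternating bilinear form in the rows a and b.
      X : (r s : Fin n → Carrier) → Carrier
      X r s = detᴿ n (set-rows r s)

      X-char : ∀ {r s M} → (∀ j → M a j ≈ r j) → (∀ j → M b j ≈ s j) →
        (∀ i → i ≢ a → i ≢ b → ∀ j → M i j ≈ M₀ i j) → detᴿ n M ≈ X r s
      X-char {r} {s} {M} ha hb ho = det-cong n {M} {set-rows r s} h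
        where
        h : ∀ i j → M i j ≈ set-rows r s i j
        h i j with i ≟ a
        ... | yes ≡.refl = ha j
        ... | no i≢a with i ≟ b
        ... | yes ≡.refl = hb j
        ... | no i≢b = ho i i≢a i≢b j

      X-linearˡ : ∀ {r r₁ r₂} s k l → (∀ j → r j ≈ k * r₁ j + l * r₂ j) → X r s ≈ k * X r₁ s + l * X r₂ s
      X-linearˡ {r} {r₁} {r₂} s k l h = row-linear n {set-rows r s} {set-rows r₁ s} {set-rows r₂ s} a k l
        (λ j → trans (reflexive (set-rows-a r s j)) (trans (h j) (sym (+-cong (*-congˡ (reflexive (set-rows-a r₁ s j))) (*-congˡ (reflexive (set-rows-a r₂ s j)))))))
        (off r r₁) (off r r₂)
        where
        off : ∀ r r′ i → i ≢ a → ∀ j → set-rows r s i j ≈ set-rows r′ s i j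
        off r r′ i i≢a j with i ≟ a
        ... | yes p = contradiction p i≢a
        ... | no _ = refl

      X-linearʳ : ∀ r {s s₁ s₂} k l → (∀ j → s j ≈ k * s₁ j + l * s₂ j) → X r s ≈ k * X r s₁ + l * X r s₂
      X-linearʳ r {s} {s₁} {s₂} k l h = row-linear n {set-rows r s} {set-rows r s₁} {set-rows r s₂} b k l
        (λ j → trans (reflexive (set-rows-b r s j)) (trans (h j) (sym (+-cong (*-congˡ (reflexive (set-rows-b r s₁ j))) (*-congˡ (reflexive (set-rows-b r s₂ j)))))))
        (off s s₁) (off s s₂)
        where
        off : ∀ s s′ i → i ≢ b → ∀ j → set-rows r s i j ≈ set-rows r s′ i j
        off s s′ i i≢b j with i ≟ a
        ... | yes _ = refl
        ... | no _ with i ≟ b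
        ... | yes p = contradiction p i≢b
        ... | no _ = refl

      X-alternating : ∀ r → X r r ≈ 0#
      X-alternating r = equal-rows n {set-rows r r} a≢b
        (λ j → trans (reflexive (set-rows-a r r j)) (reflexive (≡.sym (set-rows-b r r j))))

      X-antisymmetric : ∀ r s → X r s ≈ - X s r
      X-antisymmetric r s = +-inverseˡ-unique _ _ (begin
        X r s + X s r
          ≈⟨ solve 2 (λ u v → u :+ v := con 1 :* (con 1 :* con 0 :+ con 1 :* u) :+ con 1 :* (con 1 :* v :+ con 1 :* con 0)) refl (X r s) (X s r) ⟩
        1# * (1# * 0# + 1# * X r s) + 1# * (1# * X s r + 1# * 0#)
          ≈⟨ +-cong (*-congˡ (+-congʳ (*-congˡ (X-alternating r)))) (*-congˡ (+-congˡ (*-congˡ (X-alternating s)))) ⟨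
        1# * (1# * X r r + 1# * X r s) + 1# * (1# * X s r + 1# * X s s)
          ≈⟨ +-cong (*-congˡ (X-linearʳ r 1# 1# (λ _ → refl))) (*-congˡ (X-linearʳ s 1# 1# (λ _ → refl))) ⟨
        1# * X r t + 1# * X s t      ≈⟨ X-linearˡ t 1# 1# (λ _ → refl) ⟨
        X t t                        ≈⟨ X-alternating t ⟩
        0#                           ∎)
        where
        t : Fin n → Carrier
        t j = 1# * r j + 1# * s j

      -- A new edge alters only rows a and b, both by multiples of one vector v. The term quadratic
      -- in v vanishes by alternation; in the two linear terms antisymmetry moves v to the same
      -- slot, where they merge into one determinant.
      X-rank-one : ∀ ra rb v D E → X (λ j → ra j + D * v j) (λ j → rb j + E * - v j) ≈
        X ra rb + X (λ j → E * ra j + D * rb j) (λ j → - v j)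
      X-rank-one ra rb v D E = begin
        X (λ j → ra j + D * v j) s
          ≈⟨ X-linearˡ s 1# D (λ j → +-congʳ (sym (*-identityˡ _))) ⟩
        1# * X ra s + D * X v s
          ≈⟨ +-cong (*-congˡ (X-linearʳ ra 1# E (λ j → +-congʳ (sym (*-identityˡ _)))))
                    (*-congˡ (X-linearʳ v 1# (- E) (λ j → +-cong (sym (*-identityˡ _)) (trans (sym (-‿distribʳ-* E (v j))) (-‿distribˡ-* E (v j)))))) ⟩
        1# * (1# * X ra rb + E * X ra v⁻) + D * (1# * X v rb + - E * X v v)
          ≈⟨ +-congˡ (*-congˡ (+-cong (*-congˡ (trans (X-antisymmetric v rb) (sym neg))) (*-congˡ (X-alternating v)))) ⟩
        1# * (1# * X ra rb + E * X ra v⁻) + D * (1# * X rb v⁻ + - E * 0#)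
          ≈⟨ solve 6 (λ p E q D r m → con 1 :* (con 1 :* p :+ E :* q) :+ D :* (con 1 :* r :+ m :* con 0) := p :+ (E :* q :+ D :* r))
               refl (X ra rb) E (X ra v⁻) D (X rb v⁻) (- E) ⟩
        X ra rb + (E * X ra v⁻ + D * X rb v⁻)
          ≈⟨ +-congˡ (X-linearˡ v⁻ E D (λ _ → refl)) ⟨
        X ra rb + X (λ j → E * ra j + D * rb j) v⁻ ∎
        where
        v⁻ s : Fin n → Carrier
        v⁻ j = - v j
        s j = rb j + E * - v j
        neg : X rb v⁻ ≈ - X rb v
        neg = begin
          X rb v⁻                          ≈⟨ X-linearʳ rb {v⁻} {v} {v} (- 1#) 0# (λ j → trans (sym (-1*x≈-x (v j))) (sym (trans (+-congˡ (zeroˡ _)) (+-identityʳ _)))) ⟩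
          - 1# * X rb v + 0# * X rb v      ≈⟨ +-cong (-1*x≈-x _) (zeroˡ _) ⟩
          - X rb v + 0#                    ≈⟨ +-identityʳ _ ⟩
          - X rb v                         ∎

    -- The part of the bilinear expansion free of v is the deletion. In the other part row b is -v,
    -- and adding column b to column a turns it into the unit vector at b. Row a is then D b times
    -- the old row a plus D a times the old row b, which is the row of a merged vertex with pair
    -- `w a ⋆ w b`.
    deletion-contraction : ∀ n {a b : Fin n} → a ≢ b → ∀ w es →
      Z n w ((toℕ a , toℕ b) ∷ es) ≈
      Z n w es + Z n (contractW (toℕ a) (toℕ b) w) (map (contractE (toℕ a) (toℕ b)) es)
    deletion-contraction n {a} {b} a≢b w es = begin
      Z n w ((A , B) ∷ es)
        ≈⟨ X-char a≢b M₀ row-a row-b row-other ⟩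
      X a≢b M₀ (λ j → ra j + D a * v j) (λ j → rb j + D b * - v j)
        ≈⟨ X-rank-one a≢b M₀ ra rb v (D a) (D b) ⟩
      X a≢b M₀ ra rb + X a≢b M₀ y (λ j → - v j)
        ≈⟨ +-cong (sym (X-char a≢b M₀ (λ _ → refl) (λ _ → refl) (λ _ _ _ _ → refl))) contracted ⟩
      Z n w es + Z n w′ es′ ∎
      where
      A = toℕ a
      B = toℕ b
      A≢B : A ≢ B
      A≢B p = a≢b (toℕ-injective p)
      w′ = contractW A B w
      es′ = map (contractE A B) es
      F D : Fin n → Carrier
      F i = proj₁ (w (toℕ i))
      D i = proj₂ (w (toℕ i))
      M₀ : Matrix n
      M₀ i j = entry w es (toℕ i) (toℕ j)
      L : Fin n → Fin n → Carrier
      L i j = lap es (toℕ i) (toℕ j)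
      ra rb v y : Fin n → Carrier
      ra j = M₀ a j
      rb j = M₀ b j
      v j = χ (A , B) (toℕ j)
      y j = D b * ra j + D a * rb j

      χ-a : χ (A , B) A ≈ 1#
      χ-a = begin
        δ A A - δ B A    ≈⟨ +-cong (δ-refl A) (-‿cong (δ-≢ (λ p → A≢B (≡.sym p)))) ⟩
        1# - 0#          ≈⟨ +-congˡ -0#≈0# ⟩
        1# + 0#          ≈⟨ +-identityʳ _ ⟩
        1#               ∎
      χ-b : χ (A , B) B ≈ - 1#
      χ-b = begin
        δ A B - δ B B    ≈⟨ +-cong (δ-≢ A≢B) (-‿cong (δ-refl B)) ⟩
        0# - 1#          ≈⟨ +-identityˡ _ ⟩
        - 1#             ∎
      χ-other : ∀ {i} → i ≢ A → i ≢ B → χ (A , B) i ≈ 0#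
      χ-other i≢A i≢B = begin
        δ A _ - δ B _    ≈⟨ +-cong (δ-≢ (λ p → i≢A (≡.sym p))) (-‿cong (δ-≢ (λ p → i≢B (≡.sym p)))) ⟩
        0# - 0#          ≈⟨ -‿inverseʳ 0# ⟩
        0#               ∎

      row : ∀ i c → χ (A , B) (toℕ i) ≈ c → ∀ j →
        entry w ((A , B) ∷ es) (toℕ i) (toℕ j) ≈ M₀ i j + D i * (c * v j)
      row i c h j = begin
        p + D i * (χ (A , B) (toℕ i) * v j + L i j)  ≈⟨ +-congˡ (*-congˡ (+-congʳ (*-congʳ h))) ⟩
        p + D i * (c * v j + L i j)
          ≈⟨ solve 5 (λ p d c v l → p :+ d :* (c :* v :+ l) := (p :+ d :* l) :+ d :* (c :* v)) refl p (D i) c (v j) (L i j) ⟩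
        M₀ i j + D i * (c * v j) ∎
        where p = δ (toℕ i) (toℕ j) * F i
      row-a : ∀ j → entry w ((A , B) ∷ es) A (toℕ j) ≈ ra j + D a * v j
      row-a j = trans (row a 1# χ-a j) (+-congˡ (*-congˡ (*-identityˡ _)))
      row-b : ∀ j → entry w ((A , B) ∷ es) B (toℕ j) ≈ rb j + D b * - v j
      row-b j = trans (row b (- 1#) χ-b j) (+-congˡ (*-congˡ (-1*x≈-x _)))
      row-other : ∀ i → i ≢ a → i ≢ b → ∀ j → entry w ((A , B) ∷ es) (toℕ i) (toℕ j) ≈ M₀ i j
      row-other i i≢a i≢b j = begin
        entry w ((A , B) ∷ es) (toℕ i) (toℕ j)
          ≈⟨ row i 0# (χ-other (λ p → i≢a (toℕ-injective p)) (λ p → i≢b (toℕ-injective p))) j ⟩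
        M₀ i j + D i * (0# * v j)  ≈⟨ solve 3 (λ m d v → m :+ d :* (con 0 :* v) := m) refl (M₀ i j) (D i) (v j) ⟩
        M₀ i j                     ∎

      P N : Matrix n
      P = set-rows a≢b M₀ y (λ j → - v j)
      N i j with j ≟ a
      ... | yes _ = P i a + P i b
      ... | no _  = P i j

      N-a : ∀ i → N i a ≈ P i a + P i b
      N-a i with a ≟ a
      ... | yes _ = refl
      ... | no ¬p = contradiction ≡.refl ¬p
      N-other : ∀ i j → j ≢ a → N i j ≈ P i j
      N-other i j j≢a with j ≟ a
      ... | yes p = contradiction p j≢a
      ... | no _  = refl

      P-a : ∀ j → P a j ≈ y j
      P-a j = reflexive (set-rows-a a≢b M₀ y (λ j → - v j) j)
      P-b : ∀ j → P b j ≈ - v j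
      P-b j = reflexive (set-rows-b a≢b M₀ y (λ j → - v j) j)
      P-other : ∀ i → i ≢ a → i ≢ b → ∀ j → P i j ≈ M₀ i j
      P-other i p q j = reflexive (set-rows-other a≢b M₀ y (λ j → - v j) i p q j)

      w′-b : w′ B ≡ (1# , 0#)
      w′-b with B ≟ℕ B
      ... | yes _ = ≡.refl
      ... | no ¬p = contradiction ≡.refl ¬p
      w′-a : w′ A ≡ (w A ⋆ w B)
      w′-a with A ≟ℕ B
      ... | yes p = contradiction p A≢B
      ... | no _ with A ≟ℕ A
      ... | yes _ = ≡.refl
      ... | no ¬p = contradiction ≡.refl ¬p
      w′-other : ∀ {i} → i ≢ A → i ≢ B → w′ i ≡ w i
      w′-other {i} i≢A i≢B with i ≟ℕ B
      ... | yes p = contradiction p i≢B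
      ... | no _ with i ≟ℕ A
      ... | yes p = contradiction p i≢A
      ... | no _ = ≡.refl

      toℕ-≢ : ∀ {i j : Fin n} → i ≢ j → toℕ i ≢ toℕ j
      toℕ-≢ h p = h (toℕ-injective p)

      N-row-b : ∀ j → N b j ≈ δ B (toℕ j)
      N-row-b j with j ≟ a
      ... | yes ≡.refl = begin
        P b a + P b b     ≈⟨ +-cong (trans (P-b a) (-‿cong χ-a)) (trans (P-b b) (trans (-‿cong χ-b) (-‿involutive _))) ⟩
        - 1# + 1#         ≈⟨ -‿inverseˡ 1# ⟩
        0#                ≈⟨ δ-≢ (λ p → A≢B (≡.sym p)) ⟨
        δ B A             ∎
      ... | no j≢a with j ≟ b
      ... | yes ≡.refl = begin
        P b b             ≈⟨ trans (P-b b) (trans (-‿cong χ-b) (-‿involutive _)) ⟩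
        1#                ≈⟨ δ-refl B ⟨
        δ B B             ∎
      ... | no j≢b = begin
        P b j             ≈⟨ trans (P-b j) (-‿cong (χ-other (toℕ-≢ j≢a) (toℕ-≢ j≢b))) ⟩
        - 0#              ≈⟨ -0#≈0# ⟩
        0#                ≈⟨ δ-≢ (λ p → toℕ-≢ j≢b (≡.sym p)) ⟨
        δ B (toℕ j)       ∎

      M′-row-b : ∀ j → entry w′ es′ B (toℕ j) ≈ δ B (toℕ j)
      M′-row-b j = begin
        δ B (toℕ j) * proj₁ (w′ B) + proj₂ (w′ B) * l
          ≈⟨ +-cong (*-congˡ (reflexive (≡.cong proj₁ w′-b))) (*-congʳ (reflexive (≡.cong proj₂ w′-b))) ⟩
        δ B (toℕ j) * 1# + 0# * l   ≈⟨ +-cong (*-identityʳ _) (zeroˡ _) ⟩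
        δ B (toℕ j) + 0#            ≈⟨ +-identityʳ _ ⟩
        δ B (toℕ j)                 ∎
        where l = lap es′ B (toℕ j)

      M′-entry : ∀ i j {f d} → i ≢ b → j ≢ b → w′ (toℕ i) ≡ (f , d) → ∀ k l → δ A (toℕ i) ≈ k → δ A (toℕ j) ≈ l →
        entry w′ es′ (toℕ i) (toℕ j) ≈
        δ (toℕ i) (toℕ j) * f + d * ((L i j + l * L i b) + (k * L b j + k * (l * L b b)))
      M′-entry i j i≢b j≢b wi k l hk hl =
        +-cong (*-congˡ (reflexive (≡.cong proj₁ wi)))
          (*-cong (reflexive (≡.cong proj₂ wi))
            (trans (lap-contract {A} (toℕ-≢ i≢b) (toℕ-≢ j≢b) es)
              (+-cong (+-congˡ (*-congʳ hl)) (+-cong (*-congʳ hk) (*-cong hk (*-congʳ hl))))))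

      N≈M′ : ∀ i j → i ≢ b → j ≢ b → N i j ≈ entry w′ es′ (toℕ i) (toℕ j)
      N≈M′ i j i≢b j≢b with i ≟ a | j ≟ a
      ... | yes ≡.refl | yes ≡.refl = begin
        P a a + P a b                                ≈⟨ +-cong (P-a a) (P-a b) ⟩
        (D b * (δ A A * F a + D a * L a a) + D a * (δ B A * F b + D b * L b a))
          + (D b * (δ A B * F a + D a * L a b) + D a * (δ B B * F b + D b * L b b))
          ≈⟨ +-cong (+-cong (*-congˡ (+-congʳ (*-congʳ (δ-refl A)))) (*-congˡ (+-congʳ (*-congʳ (δ-≢ (λ p → A≢B (≡.sym p)))))))
                    (+-cong (*-congˡ (+-congʳ (*-congʳ (δ-≢ A≢B)))) (*-congˡ (+-congʳ (*-congʳ (δ-refl B))))) ⟩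
        (D b * (1# * F a + D a * L a a) + D a * (0# * F b + D b * L b a))
          + (D b * (0# * F a + D a * L a b) + D a * (1# * F b + D b * L b b))
          ≈⟨ solve 8 (λ Fa Da Fb Db aa ab ba bb →
               (Db :* (con 1 :* Fa :+ Da :* aa) :+ Da :* (con 0 :* Fb :+ Db :* ba))
                 :+ (Db :* (con 0 :* Fa :+ Da :* ab) :+ Da :* (con 1 :* Fb :+ Db :* bb))
               := con 1 :* (Fa :* Db :+ Fb :* Da) :+ (Da :* Db) :* ((aa :+ con 1 :* ab) :+ (con 1 :* ba :+ con 1 :* (con 1 :* bb))))
             refl (F a) (D a) (F b) (D b) (L a a) (L a b) (L b a) (L b b) ⟩
        1# * (F a * D b + F b * D a) + (D a * D b) * ((L a a + 1# * L a b) + (1# * L b a + 1# * (1# * L b b)))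
          ≈⟨ +-congʳ (*-congʳ (δ-refl A)) ⟨
        δ A A * (F a * D b + F b * D a) + (D a * D b) * ((L a a + 1# * L a b) + (1# * L b a + 1# * (1# * L b b)))
          ≈⟨ M′-entry a a i≢b j≢b w′-a 1# 1# (δ-refl A) (δ-refl A) ⟨
        entry w′ es′ A A ∎
      ... | yes ≡.refl | no j≢a = begin
        P a j   ≈⟨ P-a j ⟩
        D b * (δ A (toℕ j) * F a + D a * L a j) + D a * (δ B (toℕ j) * F b + D b * L b j)
          ≈⟨ +-cong (*-congˡ (+-congʳ (*-congʳ (δ-≢ (λ p → toℕ-≢ j≢a (≡.sym p)))))) (*-congˡ (+-congʳ (*-congʳ (δ-≢ (λ p → toℕ-≢ j≢b (≡.sym p)))))) ⟩
        D b * (0# * F a + D a * L a j) + D a * (0# * F b + D b * L b j)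
          ≈⟨ solve 8 (λ Fa Da Fb Db aj ab bj bb →
               Db :* (con 0 :* Fa :+ Da :* aj) :+ Da :* (con 0 :* Fb :+ Db :* bj)
               := con 0 :* (Fa :* Db :+ Fb :* Da) :+ (Da :* Db) :* ((aj :+ con 0 :* ab) :+ (con 1 :* bj :+ con 1 :* (con 0 :* bb))))
             refl (F a) (D a) (F b) (D b) (L a j) (L a b) (L b j) (L b b) ⟩
        0# * (F a * D b + F b * D a) + (D a * D b) * ((L a j + 0# * L a b) + (1# * L b j + 1# * (0# * L b b)))
          ≈⟨ +-congʳ (*-congʳ (δ-≢ (λ p → toℕ-≢ j≢a (≡.sym p)))) ⟨
        δ A (toℕ j) * (F a * D b + F b * D a) + (D a * D b) * ((L a j + 0# * L a b) + (1# * L b j + 1# * (0# * L b b)))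
          ≈⟨ M′-entry a j i≢b j≢b w′-a 1# 0# (δ-refl A) (δ-≢ (λ p → toℕ-≢ j≢a (≡.sym p))) ⟨
        entry w′ es′ A (toℕ j) ∎
      ... | no i≢a | yes ≡.refl = begin
        P i a + P i b   ≈⟨ +-cong (P-other i i≢a i≢b a) (P-other i i≢a i≢b b) ⟩
        (δ I A * F i + D i * L i a) + (δ I B * F i + D i * L i b)
          ≈⟨ +-congˡ (+-congʳ (*-congʳ (δ-≢ (toℕ-≢ i≢b)))) ⟩
        (δ I A * F i + D i * L i a) + (0# * F i + D i * L i b)
          ≈⟨ solve 7 (λ k f d la lb ba bb → (k :* f :+ d :* la) :+ (con 0 :* f :+ d :* lb)
               := k :* f :+ d :* ((la :+ con 1 :* lb) :+ (con 0 :* ba :+ con 0 :* (con 1 :* bb))))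
             refl (δ I A) (F i) (D i) (L i a) (L i b) (L b a) (L b b) ⟩
        δ I A * F i + D i * ((L i a + 1# * L i b) + (0# * L b a + 0# * (1# * L b b)))
          ≈⟨ M′-entry i a i≢b j≢b (w′-other (toℕ-≢ i≢a) (toℕ-≢ i≢b)) 0# 1# (δ-≢ (λ p → toℕ-≢ i≢a (≡.sym p))) (δ-refl A) ⟨
        entry w′ es′ I A ∎
        where I = toℕ i
      ... | no i≢a | no j≢a = begin
        P i j   ≈⟨ P-other i i≢a i≢b j ⟩
        δ I J * F i + D i * L i j
          ≈⟨ solve 7 (λ k f d l lb bj bb → k :* f :+ d :* l
               := k :* f :+ d :* ((l :+ con 0 :* lb) :+ (con 0 :* bj :+ con 0 :* (con 0 :* bb))))
             refl (δ I J) (F i) (D i) (L i j) (L i b) (L b j) (L b b) ⟩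
        δ I J * F i + D i * ((L i j + 0# * L i b) + (0# * L b j + 0# * (0# * L b b)))
          ≈⟨ M′-entry i j i≢b j≢b (w′-other (toℕ-≢ i≢a) (toℕ-≢ i≢b)) 0# 0# (δ-≢ (λ p → toℕ-≢ i≢a (≡.sym p))) (δ-≢ (λ p → toℕ-≢ j≢a (≡.sym p))) ⟨
        entry w′ es′ I J ∎
        where
        I = toℕ i
        J = toℕ j

      contracted : X a≢b M₀ y (λ j → - v j) ≈ Z n w′ es′
      contracted = begin
        detᴿ n P     ≈⟨ add-column n {P} {N} a≢b N-a N-other ⟨
        detᴿ n N
          ≈⟨ unit-row n {N} {λ i j → entry w′ es′ (toℕ i) (toℕ j)} b
               (λ j → trans (N-row-b j) (sym (M′-row-b j)))
               (λ j j≢b → trans (N-row-b j) (δ-≢ (λ p → toℕ-≢ j≢b (≡.sym p)))) N≈M′ ⟩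
        Z n w′ es′  ∎

    -- The pair at a occurs only in row a, as F times a unit vector plus D times a row of the
    -- Laplacian.
    row-pair-linear : ∀ n (a : Fin n) {w w₁ w₂} k l es →
      proj₁ (w (toℕ a)) ≈ k * proj₁ (w₁ (toℕ a)) + l * proj₁ (w₂ (toℕ a)) →
      proj₂ (w (toℕ a)) ≈ k * proj₂ (w₁ (toℕ a)) + l * proj₂ (w₂ (toℕ a)) →
      (∀ i → i ≢ a → w (toℕ i) ≋ w₁ (toℕ i)) → (∀ i → i ≢ a → w (toℕ i) ≋ w₂ (toℕ i)) →
      Z n w es ≈ k * Z n w₁ es + l * Z n w₂ es
    row-pair-linear n a {w} {w₁} {w₂} k l es hf hd h₁ h₂ =
      row-linear n {m w} {m w₁} {m w₂} a k l
        (λ j → trans (+-cong (*-congˡ hf) (*-congʳ hd))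
          (solve 8 (λ k l f g d e x y → x :* (k :* f :+ l :* g) :+ (k :* d :+ l :* e) :* y
                      := k :* (x :* f :+ d :* y) :+ l :* (x :* g :+ e :* y)) refl
             k l (proj₁ (w₁ (toℕ a))) (proj₁ (w₂ (toℕ a))) (proj₂ (w₁ (toℕ a))) (proj₂ (w₂ (toℕ a)))
             (δ (toℕ a) (toℕ j)) (lap es (toℕ a) (toℕ j))))
        (λ i i≢a j → +-cong (*-congˡ (proj₁ (h₁ i i≢a))) (*-congʳ (proj₂ (h₁ i i≢a))))
        (λ i i≢a j → +-cong (*-congˡ (proj₁ (h₂ i i≢a))) (*-congʳ (proj₂ (h₂ i i≢a))))
      where
      m : (ℕ → Pair) → Matrix n
      m w i j = entry w es (toℕ i) (toℕ j)

-- Integer polynomials, and the semiring of those with alternating signs.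

module AlternatingPolynomials where
  open import Defs
  open import Algebra.Bundles using (CommutativeRing; CommutativeSemiring)
  open import Data.Nat using (zero; suc; z≤n; s≤s)
  open import Data.Integer as ℤ using (ℤ; +_; -_; 0ℤ; 1ℤ; +≤+; +<+)
  import Data.Integer.Properties as ℤ
  open import Data.Integer.Solver using (module +-*-Solver)
  open import Data.List using (List; []; _∷_)
  open import Data.Product using (Σ; _,_; proj₁)
  open import Level using (0ℓ)
  open import Relation.Nullary using (¬_)
  open import Relation.Binary.PropositionalEquality as ≡ using (_≡_)

  infix 4 _≈ₚ_
  -- Coefficient lists may end in zeros, so distinct lists can denote the same polynomial.
  record _≈ₚ_ (p q : Poly) : Set where
    constructor coeffs≡
    field at : ∀ k → coeff p k ≡ coeff q k
  open _≈ₚ_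

  open ≡.≡-Reasoning

  coeff-+ : ∀ p q k → coeff (p +ₚ q) k ≡ coeff p k ℤ.+ coeff q k
  coeff-+ [] q k = ≡.sym (ℤ.+-identityˡ _)
  coeff-+ (a ∷ p) [] k = ≡.sym (ℤ.+-identityʳ _)
  coeff-+ (a ∷ p) (b ∷ q) zero = ≡.refl
  coeff-+ (a ∷ p) (b ∷ q) (suc k) = coeff-+ p q k

  coeff-scale : ∀ a p k → coeff (scaleₚ a p) k ≡ a ℤ.* coeff p k
  coeff-scale a [] k = ≡.sym (ℤ.*-zeroʳ a)
  coeff-scale a (b ∷ p) zero = ≡.refl
  coeff-scale a (b ∷ p) (suc k) = coeff-scale a p k

  reflₚ : ∀ {p} → p ≈ₚ p
  reflₚ = coeffs≡ λ _ → ≡.refl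
  symₚ : ∀ {p q} → p ≈ₚ q → q ≈ₚ p
  symₚ e = coeffs≡ λ k → ≡.sym (at e k)
  transₚ : ∀ {p q r} → p ≈ₚ q → q ≈ₚ r → p ≈ₚ r
  transₚ e f = coeffs≡ λ k → ≡.trans (at e k) (at f k)

  +-congₚ : ∀ {p q r s} → p ≈ₚ q → r ≈ₚ s → p +ₚ r ≈ₚ q +ₚ s
  +-congₚ {p} {q} {r} {s} e f = coeffs≡ λ k →
    ≡.trans (coeff-+ p r k) (≡.trans (≡.cong₂ ℤ._+_ (at e k) (at f k)) (≡.sym (coeff-+ q s k)))

  +-assocₚ : ∀ p q r → (p +ₚ q) +ₚ r ≈ₚ p +ₚ (q +ₚ r)
  +-assocₚ p q r = coeffs≡ λ k → begin
    coeff ((p +ₚ q) +ₚ r) k                        ≡⟨ coeff-+ (p +ₚ q) r k ⟩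
    coeff (p +ₚ q) k ℤ.+ coeff r k                 ≡⟨ ≡.cong (ℤ._+ coeff r k) (coeff-+ p q k) ⟩
    coeff p k ℤ.+ coeff q k ℤ.+ coeff r k          ≡⟨ ℤ.+-assoc (coeff p k) (coeff q k) (coeff r k) ⟩
    coeff p k ℤ.+ (coeff q k ℤ.+ coeff r k)        ≡⟨ ≡.cong (λ u → coeff p k ℤ.+ u) (coeff-+ q r k) ⟨
    coeff p k ℤ.+ coeff (q +ₚ r) k                 ≡⟨ coeff-+ p (q +ₚ r) k ⟨
    coeff (p +ₚ (q +ₚ r)) k ∎

  +-commₚ : ∀ p q → p +ₚ q ≈ₚ q +ₚ p
  +-commₚ p q = coeffs≡ λ k →
    ≡.trans (coeff-+ p q k) (≡.trans (ℤ.+-comm (coeff p k) _) (≡.sym (coeff-+ q p k)))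

  +-identityʳₚ : ∀ p → p +ₚ [] ≈ₚ p
  +-identityʳₚ p = +-commₚ p []

  -ₚ_ : Poly → Poly
  -ₚ p = scaleₚ (- 1ℤ) p

  +-inverseʳₚ : ∀ p → p +ₚ (-ₚ p) ≈ₚ []
  +-inverseʳₚ p = coeffs≡ λ k → begin
    coeff (p +ₚ (-ₚ p)) k                   ≡⟨ coeff-+ p (-ₚ p) k ⟩
    coeff p k ℤ.+ coeff (-ₚ p) k            ≡⟨ ≡.cong (λ u → coeff p k ℤ.+ u) (coeff-scale (- 1ℤ) p k) ⟩
    coeff p k ℤ.+ - 1ℤ ℤ.* coeff p k        ≡⟨ ≡.cong (λ u → coeff p k ℤ.+ u) (ℤ.-1*i≡-i (coeff p k)) ⟩
    coeff p k ℤ.+ - coeff p k               ≡⟨ ℤ.+-inverseʳ (coeff p k) ⟩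
    0ℤ                                      ∎

  scale-cong : ∀ a {p q} → p ≈ₚ q → scaleₚ a p ≈ₚ scaleₚ a q
  scale-cong a {p} {q} e = coeffs≡ λ k →
    ≡.trans (coeff-scale a p k) (≡.trans (≡.cong (a ℤ.*_) (at e k)) (≡.sym (coeff-scale a q k)))

  scale-+ : ∀ a p q → scaleₚ a (p +ₚ q) ≈ₚ scaleₚ a p +ₚ scaleₚ a q
  scale-+ a p q = coeffs≡ λ k → begin
    coeff (scaleₚ a (p +ₚ q)) k                   ≡⟨ coeff-scale a (p +ₚ q) k ⟩
    a ℤ.* coeff (p +ₚ q) k                        ≡⟨ ≡.cong (a ℤ.*_) (coeff-+ p q k) ⟩
    a ℤ.* (coeff p k ℤ.+ coeff q k)               ≡⟨ ℤ.*-distribˡ-+ a (coeff p k) (coeff q k) ⟩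
    a ℤ.* coeff p k ℤ.+ a ℤ.* coeff q k           ≡⟨ ≡.cong₂ ℤ._+_ (coeff-scale a p k) (coeff-scale a q k) ⟨
    coeff (scaleₚ a p) k ℤ.+ coeff (scaleₚ a q) k ≡⟨ coeff-+ (scaleₚ a p) (scaleₚ a q) k ⟨
    coeff (scaleₚ a p +ₚ scaleₚ a q) k            ∎

  scale-+ˡ : ∀ a b p → scaleₚ (a ℤ.+ b) p ≈ₚ scaleₚ a p +ₚ scaleₚ b p
  scale-+ˡ a b p = coeffs≡ λ k → begin
    coeff (scaleₚ (a ℤ.+ b) p) k                  ≡⟨ coeff-scale (a ℤ.+ b) p k ⟩
    (a ℤ.+ b) ℤ.* coeff p k                       ≡⟨ ℤ.*-distribʳ-+ (coeff p k) a b ⟩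
    a ℤ.* coeff p k ℤ.+ b ℤ.* coeff p k           ≡⟨ ≡.cong₂ ℤ._+_ (coeff-scale a p k) (coeff-scale b p k) ⟨
    coeff (scaleₚ a p) k ℤ.+ coeff (scaleₚ b p) k ≡⟨ coeff-+ (scaleₚ a p) (scaleₚ b p) k ⟨
    coeff (scaleₚ a p +ₚ scaleₚ b p) k            ∎

  scale-scale : ∀ a b p → scaleₚ (a ℤ.* b) p ≈ₚ scaleₚ a (scaleₚ b p)
  scale-scale a b p = coeffs≡ λ k → begin
    coeff (scaleₚ (a ℤ.* b) p) k        ≡⟨ coeff-scale (a ℤ.* b) p k ⟩
    a ℤ.* b ℤ.* coeff p k               ≡⟨ ℤ.*-assoc a b (coeff p k) ⟩
    a ℤ.* (b ℤ.* coeff p k)             ≡⟨ ≡.cong (a ℤ.*_) (coeff-scale b p k) ⟨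
    a ℤ.* coeff (scaleₚ b p) k          ≡⟨ coeff-scale a (scaleₚ b p) k ⟨
    coeff (scaleₚ a (scaleₚ b p)) k     ∎

  scale-0 : ∀ p → scaleₚ 0ℤ p ≈ₚ []
  scale-0 p = coeffs≡ λ k → coeff-scale 0ℤ p k

  scale-1 : ∀ p → scaleₚ 1ℤ p ≈ₚ p
  scale-1 p = coeffs≡ λ k → ≡.trans (coeff-scale 1ℤ p k) (ℤ.*-identityˡ (coeff p k))

  shift-cong : ∀ {a b p q} → a ≡ b → p ≈ₚ q → a ∷ p ≈ₚ b ∷ q
  shift-cong a≡b e = coeffs≡ λ { zero → a≡b ; (suc k) → at e k }

  infixr 2 _⟫_
  _⟫_ : ∀ {p q r} → p ≈ₚ q → q ≈ₚ r → p ≈ₚ r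
  _⟫_ = transₚ

  interchange : ∀ p q r s → (p +ₚ q) +ₚ (r +ₚ s) ≈ₚ (p +ₚ r) +ₚ (q +ₚ s)
  interchange p q r s =
    +-assocₚ p q (r +ₚ s) ⟫
    +-congₚ (reflₚ {p}) (symₚ (+-assocₚ q r s) ⟫ +-congₚ (+-commₚ q r) reflₚ ⟫ +-assocₚ r q s) ⟫
    symₚ (+-assocₚ p r (q +ₚ s))

  *-congˡₚ : ∀ p {q r} → q ≈ₚ r → p *ₚ q ≈ₚ p *ₚ r
  *-congˡₚ [] e = reflₚ
  *-congˡₚ (a ∷ p) e = +-congₚ (scale-cong a e) (shift-cong ≡.refl (*-congˡₚ p e))

  *-zeroʳₚ : ∀ p → p *ₚ [] ≈ₚ []
  *-zeroʳₚ [] = reflₚ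
  *-zeroʳₚ (a ∷ p) = coeffs≡ λ { zero → ≡.refl ; (suc k) → at (*-zeroʳₚ p) k }

  -- The defining recursion on the first factor, carried over to the second; commutativity follows
  -- by induction.
  *-∷ : ∀ p b q → p *ₚ (b ∷ q) ≈ₚ scaleₚ b p +ₚ (0ℤ ∷ (p *ₚ q))
  *-∷ [] b q = coeffs≡ λ { zero → ≡.refl ; (suc k) → ≡.refl }
  *-∷ (a ∷ p) b q = shift-cong (≡.cong (ℤ._+ 0ℤ) (ℤ.*-comm a b))
    (+-congₚ (reflₚ {scaleₚ a q}) (*-∷ p b q) ⟫
     symₚ (+-assocₚ (scaleₚ a q) (scaleₚ b p) _) ⟫
     +-congₚ (+-commₚ (scaleₚ a q) (scaleₚ b p)) reflₚ ⟫
     +-assocₚ (scaleₚ b p) (scaleₚ a q) _)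

  *-commₚ : ∀ p q → p *ₚ q ≈ₚ q *ₚ p
  *-commₚ [] q = symₚ (*-zeroʳₚ q)
  *-commₚ (a ∷ p) q =
    +-congₚ (reflₚ {scaleₚ a q}) (shift-cong ≡.refl (*-commₚ p q)) ⟫ symₚ (*-∷ q a p)

  *-congₚ : ∀ {p q r s} → p ≈ₚ q → r ≈ₚ s → p *ₚ r ≈ₚ q *ₚ s
  *-congₚ {p} {q} {r} {s} e f = *-congˡₚ p f ⟫ *-commₚ p s ⟫ *-congˡₚ s e ⟫ *-commₚ s q

  *-distribʳₚ : ∀ r p q → (p +ₚ q) *ₚ r ≈ₚ (p *ₚ r) +ₚ (q *ₚ r)
  *-distribʳₚ r [] q = reflₚ
  *-distribʳₚ r (a ∷ p) [] = symₚ (+-identityʳₚ _)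
  *-distribʳₚ r (a ∷ p) (b ∷ q) =
    +-congₚ (scale-+ˡ a b r) (shift-cong {q = (p *ₚ r) +ₚ (q *ₚ r)} (≡.sym (ℤ.+-identityˡ 0ℤ)) (*-distribʳₚ r p q)) ⟫
    interchange (scaleₚ a r) (scaleₚ b r) (0ℤ ∷ (p *ₚ r)) (0ℤ ∷ (q *ₚ r))

  scale-*-assoc : ∀ a p q → scaleₚ a p *ₚ q ≈ₚ scaleₚ a (p *ₚ q)
  scale-*-assoc a [] q = reflₚ
  scale-*-assoc a (b ∷ p) q =
    +-congₚ (scale-scale a b q) (shift-cong {q = scaleₚ a (p *ₚ q)} (≡.sym (ℤ.*-zeroʳ a)) (scale-*-assoc a p q)) ⟫
    symₚ (scale-+ a (scaleₚ b q) (0ℤ ∷ (p *ₚ q)))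

  *-assocₚ : ∀ p q r → (p *ₚ q) *ₚ r ≈ₚ p *ₚ (q *ₚ r)
  *-assocₚ [] q r = reflₚ
  *-assocₚ (a ∷ p) q r =
    *-distribʳₚ r (scaleₚ a q) (0ℤ ∷ (p *ₚ q)) ⟫
    +-congₚ (scale-*-assoc a q r)
      (+-congₚ (scale-0 r) (reflₚ {0ℤ ∷ ((p *ₚ q) *ₚ r)}) ⟫ shift-cong ≡.refl (*-assocₚ p q r))

  *-identityˡₚ : ∀ p → (1ℤ ∷ []) *ₚ p ≈ₚ p
  *-identityˡₚ p = +-congₚ (scale-1 p) (coeffs≡ λ { zero → ≡.refl ; (suc k) → ≡.refl }) ⟫ +-identityʳₚ p

  polyRing : CommutativeRing 0ℓ 0ℓ
  polyRing = record
    { Carrier = Poly ; _≈_ = _≈ₚ_ ; _+_ = _+ₚ_ ; _*_ = _*ₚ_ ; -_ = -ₚ_ ; 0# = [] ; 1# = 1ℤ ∷ []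
    ; isCommutativeRing = record
      { isRing = record
        { +-isAbelianGroup = record
          { isGroup = record
            { isMonoid = record
              { isSemigroup = record
                { isMagma = record
                  { isEquivalence = record { refl = reflₚ ; sym = symₚ ; trans = transₚ }
                  ; ∙-cong = +-congₚ }
                ; assoc = +-assocₚ }
              ; identity = (λ p → reflₚ) , +-identityʳₚ }
            ; inverse = (λ p → +-commₚ (-ₚ p) p ⟫ +-inverseʳₚ p) , +-inverseʳₚ
            ; ⁻¹-cong = scale-cong (- 1ℤ) }
          ; comm = +-commₚ }
        ; *-cong = *-congₚ
        ; *-assoc = *-assocₚ
        ; *-identity = *-identityˡₚ , (λ p → *-commₚ p (1ℤ ∷ []) ⟫ *-identityˡₚ p)
        ; distrib = (λ p q r → *-commₚ p (q +ₚ r) ⟫ *-distribʳₚ p q r ⟫ +-congₚ (*-commₚ q p) (*-commₚ r p)) , *-distribʳₚ }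
      ; *-comm = *-commₚ } }

  -- Polynomials in λ whose coefficients alternate in sign, i.e. have nonnegative coefficients as
  -- polynomials in -λ; the general sign s is needed for the induction on the first factor of a product.
  Alternating : ℤ → Poly → Set
  Alternating s p = ∀ k → 0ℤ ℤ.≤ s ℤ.* (sgn k ℤ.* coeff p k)

  0≤+ : ∀ {a b} → 0ℤ ℤ.≤ a → 0ℤ ℤ.≤ b → 0ℤ ℤ.≤ a ℤ.+ b
  0≤+ = ℤ.+-mono-≤

  0≤* : ∀ {a b} → 0ℤ ℤ.≤ a → 0ℤ ℤ.≤ b → 0ℤ ℤ.≤ a ℤ.* b
  0≤* {+ a} {+ b} _ _ = ≡.subst (0ℤ ℤ.≤_) (ℤ.pos-* a b) (+≤+ z≤n)

  Alternating-+ : ∀ s p q → Alternating s p → Alternating s q → Alternating s (p +ₚ q)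
  Alternating-+ s p q hp hq k = ≡.subst (0ℤ ℤ.≤_) (≡.sym (begin
    s ℤ.* (sgn k ℤ.* coeff (p +ₚ q) k)                 ≡⟨ ≡.cong (λ u → s ℤ.* (sgn k ℤ.* u)) (coeff-+ p q k) ⟩
    s ℤ.* (sgn k ℤ.* (coeff p k ℤ.+ coeff q k))
      ≡⟨ solve 4 (λ s g a b → s :* (g :* (a :+ b)) := s :* (g :* a) :+ s :* (g :* b)) ≡.refl s (sgn k) (coeff p k) (coeff q k) ⟩
    s ℤ.* (sgn k ℤ.* coeff p k) ℤ.+ s ℤ.* (sgn k ℤ.* coeff q k) ∎)) (0≤+ (hp k) (hq k))
    where open +-*-Solver

  Alternating-tail : ∀ s a p → Alternating s (a ∷ p) → Alternating (- s) p
  Alternating-tail s a p h k = ≡.subst (0ℤ ℤ.≤_)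
    (solve 3 (λ s g c → s :* (:- g :* c) := :- s :* (g :* c)) ≡.refl s (sgn k) (coeff p k)) (h (suc k))
    where open +-*-Solver

  Alternating-shift : ∀ s p → Alternating (- s) p → Alternating s (0ℤ ∷ p)
  Alternating-shift s p h zero = ℤ.≤-reflexive (≡.sym (ℤ.*-zeroʳ s))
  Alternating-shift s p h (suc k) = ≡.subst (0ℤ ℤ.≤_)
    (solve 3 (λ s g c → :- s :* (g :* c) := s :* (:- g :* c)) ≡.refl s (sgn k) (coeff p k)) (h k)
    where open +-*-Solver

  Alternating-head : ∀ s a p → Alternating s (a ∷ p) → 0ℤ ℤ.≤ s ℤ.* a
  Alternating-head s a p h = ≡.subst (λ u → 0ℤ ℤ.≤ s ℤ.* u) (ℤ.*-identityˡ a) (h 0)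

  Alternating-* : ∀ s p q → Alternating s p → Alternating 1ℤ q → Alternating s (p *ₚ q)
  Alternating-* s [] q hp hq k = hp k
  Alternating-* s (a ∷ p) q hp hq = Alternating-+ s (scaleₚ a q) (0ℤ ∷ (p *ₚ q))
    (λ k → ≡.subst (0ℤ ℤ.≤_) (≡.sym (begin
      s ℤ.* (sgn k ℤ.* coeff (scaleₚ a q) k)    ≡⟨ ≡.cong (λ u → s ℤ.* (sgn k ℤ.* u)) (coeff-scale a q k) ⟩
      s ℤ.* (sgn k ℤ.* (a ℤ.* coeff q k))
        ≡⟨ solve 4 (λ s g a c → s :* (g :* (a :* c)) := s :* a :* (con 1ℤ :* (g :* c))) ≡.refl s (sgn k) a (coeff q k) ⟩
      s ℤ.* a ℤ.* (1ℤ ℤ.* (sgn k ℤ.* coeff q k)) ∎)) (0≤* (Alternating-head s a p hp) (hq k)))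
    (Alternating-shift s (p *ₚ q) (Alternating-* (- s) p q (Alternating-tail s a p hp) hq))
    where open +-*-Solver

  -- Evaluation at λ = -1, where an alternating polynomial is the sum of the absolute values of its coefficients.
  ev : Poly → ℤ
  ev [] = 0ℤ
  ev (a ∷ p) = a ℤ.- ev p

  ev-+ : ∀ p q → ev (p +ₚ q) ≡ ev p ℤ.+ ev q
  ev-+ [] q = ≡.sym (ℤ.+-identityˡ _)
  ev-+ (a ∷ p) [] = ≡.sym (ℤ.+-identityʳ _)
  ev-+ (a ∷ p) (b ∷ q) = ≡.trans (≡.cong (λ u → a ℤ.+ b ℤ.- u) (ev-+ p q))
    (solve 4 (λ a b u v → a :+ b :- (u :+ v) := (a :- u) :+ (b :- v)) ≡.refl a b (ev p) (ev q))
    where open +-*-Solver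

  ev-scale : ∀ a p → ev (scaleₚ a p) ≡ a ℤ.* ev p
  ev-scale a [] = ≡.sym (ℤ.*-zeroʳ a)
  ev-scale a (b ∷ p) = ≡.trans (≡.cong (λ u → a ℤ.* b ℤ.- u) (ev-scale a p))
    (solve 3 (λ a b u → a :* b :- a :* u := a :* (b :- u)) ≡.refl a b (ev p))
    where open +-*-Solver

  ev-* : ∀ p q → ev (p *ₚ q) ≡ ev p ℤ.* ev q
  ev-* [] q = ≡.refl
  ev-* (a ∷ p) q = begin
    ev (scaleₚ a q +ₚ (0ℤ ∷ (p *ₚ q)))               ≡⟨ ev-+ (scaleₚ a q) (0ℤ ∷ (p *ₚ q)) ⟩
    ev (scaleₚ a q) ℤ.+ (0ℤ ℤ.- ev (p *ₚ q))         ≡⟨ ≡.cong₂ (λ u v → u ℤ.+ (0ℤ ℤ.- v)) (ev-scale a q) (ev-* p q) ⟩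
    a ℤ.* ev q ℤ.+ (0ℤ ℤ.- ev p ℤ.* ev q)
      ≡⟨ solve 3 (λ a p q → a :* q :+ (con 0ℤ :- p :* q) := (a :- p) :* q) ≡.refl a (ev p) (ev q) ⟩
    (a ℤ.- ev p) ℤ.* ev q                            ∎
    where open +-*-Solver

  ev-0 : ∀ p → (∀ k → coeff p k ≡ 0ℤ) → ev p ≡ 0ℤ
  ev-0 [] h = ≡.refl
  ev-0 (a ∷ p) h = ≡.cong₂ ℤ._-_ (h 0) (ev-0 p (λ k → h (suc k)))

  ev-cong : ∀ {p q} → p ≈ₚ q → ev p ≡ ev q
  ev-cong {p} {[]} e = ev-0 p (at e)
  ev-cong {[]} {b ∷ q} e = ≡.sym (ev-0 (b ∷ q) (λ k → ≡.sym (at e k)))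
  ev-cong {a ∷ p} {b ∷ q} e = ≡.cong₂ ℤ._-_ (at e 0) (ev-cong {p} {q} (coeffs≡ (λ k → at e (suc k))))

  ev-Alternating : ∀ s p → Alternating s p → 0ℤ ℤ.≤ s ℤ.* ev p
  ev-Alternating s [] h = ℤ.≤-reflexive (≡.sym (ℤ.*-zeroʳ s))
  ev-Alternating s (a ∷ p) h = ≡.subst (0ℤ ℤ.≤_)
    (solve 3 (λ s a u → s :* a :+ :- s :* u := s :* (a :- u)) ≡.refl s a (ev p))
    (0≤+ (Alternating-head s a p h) (ev-Alternating (- s) p (Alternating-tail s a p h)))
    where open +-*-Solver

  -- Closed under sums and products but not under differences, which is why the order on this
  -- semiring is phrased by the existence of a remainder.
  AltPoly : Set
  AltPoly = Σ Poly (Alternating 1ℤ)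

  altSemiring : CommutativeSemiring 0ℓ 0ℓ
  altSemiring = record
    { Carrier = AltPoly
    ; _≈_ = λ p q → proj₁ p ≈ₚ proj₁ q
    ; _+_ = λ (p , hp) (q , hq) → p +ₚ q , Alternating-+ 1ℤ p q hp hq
    ; _*_ = λ (p , hp) (q , hq) → p *ₚ q , Alternating-* 1ℤ p q hp hq
    ; 0# = [] , (λ k → ℤ.≤-reflexive (≡.sym (≡.trans (ℤ.*-identityˡ _) (ℤ.*-zeroʳ (sgn k)))))
    ; 1# = (1ℤ ∷ []) , λ { zero → +≤+ z≤n ; (suc k) → ℤ.≤-reflexive (≡.sym (≡.trans (ℤ.*-identityˡ _) (ℤ.*-zeroʳ (- sgn k)))) }
    ; isCommutativeSemiring = record
      { isSemiring = record
        { isSemiringWithoutAnnihilatingZero = record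
          { +-isCommutativeMonoid = record
            { isMonoid = record
              { isSemigroup = record
                { isMagma = record
                  { isEquivalence = record { refl = reflₚ ; sym = symₚ ; trans = transₚ }
                  ; ∙-cong = +-congₚ }
                ; assoc = λ p q r → +-assocₚ (proj₁ p) (proj₁ q) (proj₁ r) }
              ; identity = (λ p → reflₚ) , (λ p → +-identityʳₚ (proj₁ p)) }
            ; comm = λ p q → +-commₚ (proj₁ p) (proj₁ q) }
          ; *-cong = *-congₚ
          ; *-assoc = λ p q r → *-assocₚ (proj₁ p) (proj₁ q) (proj₁ r)
          ; *-identity = (λ p → R.*-identityˡ (proj₁ p)) , (λ p → R.*-identityʳ (proj₁ p))
          ; distrib = (λ p q r → R.distribˡ (proj₁ p) (proj₁ q) (proj₁ r)) , (λ p q r → R.distribʳ (proj₁ p) (proj₁ q) (proj₁ r)) }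
        ; zero = (λ p → reflₚ) , (λ p → *-zeroʳₚ (proj₁ p)) }
      ; *-comm = λ p q → *-commₚ (proj₁ p) (proj₁ q) } }
    where module R = CommutativeRing polyRing

  -- x = -λ
  xₐ : AltPoly
  xₐ = (0ℤ ∷ - 1ℤ ∷ []) ,
    λ { zero → +≤+ z≤n ; (suc zero) → +≤+ z≤n
      ; (suc (suc k)) → ℤ.≤-reflexive (≡.sym (≡.trans (ℤ.*-identityˡ _) (ℤ.*-zeroʳ (- - sgn k)))) }

  -- Since the value at λ = -1 adds up the absolute values of the coefficients, this says that p is
  -- nonzero. Being a condition on a ring homomorphism, it passes to products at once.
  record Positive (p : AltPoly) : Set where
    constructor positive
    field ev>0 : 0ℤ ℤ.< ev (proj₁ p)
  open Positive

  private module K = CommutativeSemiring altSemiring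

  Positive-1 : Positive K.1#
  Positive-1 = positive (+<+ (s≤s z≤n))

  Positive-x : Positive xₐ
  Positive-x = positive (+<+ (s≤s z≤n))

  Positive-resp : ∀ {p q} → p K.≈ q → Positive p → Positive q
  Positive-resp e (positive h) = positive (≡.subst (0ℤ ℤ.<_) (ev-cong e) h)

  Positive-+ : ∀ {p} q → Positive p → Positive (p K.+ q)
  Positive-+ {p , _} (q , hq) (positive h) = positive (≡.subst (0ℤ ℤ.<_) (≡.sym (ev-+ p q))
    (ℤ.+-mono-<-≤ h (≡.subst (0ℤ ℤ.≤_) (ℤ.*-identityˡ (ev q)) (ev-Alternating 1ℤ q hq))))

  Positive-* : ∀ {p q} → Positive p → Positive q → Positive (p K.* q)
  Positive-* {p , _} {q , _} (positive h) (positive h′) = positive (≡.subst (0ℤ ℤ.<_) (≡.sym (ev-* p q)) (pos h h′))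
    where
    pos : ∀ {a b} → 0ℤ ℤ.< a → 0ℤ ℤ.< b → 0ℤ ℤ.< a ℤ.* b
    pos {+ suc a} {+ suc b} _ _ = +<+ (s≤s z≤n)
    pos {+ zero} (+<+ ())
    pos {+ suc a} {+ zero} _ (+<+ ())

  Positive-difference : ∀ {p q z : AltPoly} → p K.≈ q K.+ z → Positive z → ¬ (proj₁ p ≈ₚ proj₁ q)
  Positive-difference {p , _} {q , _} {z , _} e (positive h) e′ = ℤ.<-irrefl {0ℤ} ≡.refl (≡.subst (0ℤ ℤ.<_) (begin
    ev z                          ≡⟨ solve 2 (λ q z → z := (q :+ z) :- q) ≡.refl (ev q) (ev z) ⟩
    ev q ℤ.+ ev z ℤ.- ev q        ≡⟨ ≡.cong (ℤ._- ev q) (ev-+ q z) ⟨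
    ev (q +ₚ z) ℤ.- ev q          ≡⟨ ≡.cong (ℤ._- ev q) (ev-cong e) ⟨
    ev p ℤ.- ev q                 ≡⟨ ≡.cong (ℤ._- ev q) (ev-cong e′) ⟩
    ev q ℤ.- ev q                 ≡⟨ ℤ.+-inverseʳ (ev q) ⟩
    0ℤ                            ∎) h)
    where open +-*-Solver

-- Algebra of rooted pairs: paths, legs, moves of branches, cycles.

module RootedPairs where
  open import Algebra.Bundles using (CommutativeSemiring; CommutativeMonoid)
  open import Data.List using (List; []; _∷_; _++_; foldr)
  open import Data.List.Properties using (++-assoc; ++-identityʳ)
  open import Data.List.Relation.Unary.All using (All; []; _∷_)
  open import Data.Nat as ℕ using (ℕ; zero; suc; z≤n; s≤s)
  import Data.Nat.Properties as ℕ
  open import Data.Product using (Σ; _×_; _,_; proj₁; proj₂)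
  open import Level using (Level; _⊔_) renaming (suc to lsuc)
  open import Relation.Binary.PropositionalEquality as ≡ using (_≡_)

  -- Positivity is abstract so that the same algebra can run over the full polynomial ring, where
  -- every element is declared positive and the identities are what is wanted.
  record PositivityStructure {c ℓ} (K : CommutativeSemiring c ℓ) : Set (lsuc (c ⊔ ℓ)) where
    open CommutativeSemiring K
    field
      x : Carrier
      Pos : Carrier → Set ℓ
      Pos-1 : Pos 1#
      Pos-x : Pos x
      Pos-resp : ∀ {a b} → a ≈ b → Pos a → Pos b
      Pos-+ : ∀ {a} b → Pos a → Pos (a + b)
      Pos-* : ∀ {a b} → Pos a → Pos b → Pos (a * b)

  module PairAlgebra {c ℓ} (K : CommutativeSemiring c ℓ) (S : PositivityStructure K) where
    open CommutativeSemiring K hiding (zero)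
    open PositivityStructure S
    open import Relation.Binary.Reasoning.Setoid setoid
    open import Algebra.Solver.Ring.NaturalCoefficients.Default K

    infix 4 _≼_ _≺_ _≋_ _⊵_ _▷_
    _≼_ _≺_ : Carrier → Carrier → Set (c ⊔ ℓ)
    a ≼ b = Σ Carrier λ z → b ≈ a + z
    a ≺ b = Σ Carrier λ z → Pos z × b ≈ a + z

    Pos-+ʳ : ∀ a {b} → Pos b → Pos (a + b)
    Pos-+ʳ a {b} h = Pos-resp (+-comm b a) (Pos-+ a h)

    ≼-reflexive : ∀ {a b} → a ≈ b → a ≼ b
    ≼-reflexive e = 0# , trans (sym e) (sym (+-identityʳ _))

    ≺⇒≼ : ∀ {a b} → a ≺ b → a ≼ b
    ≺⇒≼ (z , _ , e) = z , e

    ≼-trans : ∀ {a b c} → a ≼ b → b ≼ c → a ≼ c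
    ≼-trans (y , e) (z , f) = y + z , trans f (trans (+-congʳ e) (+-assoc _ _ _))

    ≺-≼-trans : ∀ {a b c} → a ≺ b → b ≼ c → a ≺ c
    ≺-≼-trans (y , h , e) (z , f) = y + z , Pos-+ z h , trans f (trans (+-congʳ e) (+-assoc _ _ _))

    ≼-≺-trans : ∀ {a b c} → a ≼ b → b ≺ c → a ≺ c
    ≼-≺-trans (y , e) (z , h , f) = y + z , Pos-+ʳ y h , trans f (trans (+-congʳ e) (+-assoc _ _ _))

    ≺-resp : ∀ {a a′ b b′} → a ≈ a′ → b ≈ b′ → a ≺ b → a′ ≺ b′
    ≺-resp e f h = ≼-≺-trans (≼-reflexive (sym e)) (≺-≼-trans h (≼-reflexive f))

    Pair : Set c
    Pair = Carrier × Carrier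

    _≋_ : Pair → Pair → Set ℓ
    (f , d) ≋ (f′ , d′) = (f ≈ f′) × (d ≈ d′)

    infixl 8 _⋆_
    infixl 7 _·_
    -- Gluing at the roots. The fractions f/d are added with denominators multiplied out:
    -- conductances in parallel.
    _⋆_ : Pair → Pair → Pair
    (f , d) ⋆ (f′ , d′) = f * d′ + f′ * d , d * d′

    -- With a context p and a rooted tree q this is the determinant of the whole graph; it is linear
    -- in either argument.
    _·_ : Pair → Pair → Carrier
    p · q = proj₁ (p ⋆ q)

    -- `free` is a mere gluing point, the unit of `⋆`. The summand x of a vertex is supplied once,
    -- by `vertex`.
    free vertex : Pair
    free = 0# , 1#
    vertex = x , 1#

    -- The old root becomes the neighbour of a new free root: f/(f + d) is the conductance f/d in
    -- series with a unit conductance.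
    edge : Pair → Pair
    edge (f , d) = f , f + d

    ⋆-commutativeMonoid : CommutativeMonoid c ℓ
    ⋆-commutativeMonoid = record
      { Carrier = Pair ; _≈_ = _≋_ ; _∙_ = _⋆_ ; ε = free
      ; isCommutativeMonoid = record
        { isMonoid = record
          { isSemigroup = record
            { isMagma = record
              { isEquivalence = record
                { refl = refl , refl ; sym = λ (p , q) → sym p , sym q
                ; trans = λ (p , q) (r , s) → trans p r , trans q s }
              ; ∙-cong = λ (p , q) (r , s) → +-cong (*-cong p s) (*-cong r q) , *-cong q s }
            ; assoc = λ (a , b) (f , d) (g , h) →
                solve 6 (λ a b f d g h → (a :* d :+ f :* b) :* h :+ g :* (b :* d) := a :* (d :* h) :+ (f :* h :+ g :* d) :* b) refl a b f d g h
                , *-assoc b d h }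
          ; identity =
              (λ (f , d) → solve 2 (λ f d → con 0 :* d :+ f :* con 1 := f) refl f d , *-identityˡ d)
            , (λ (f , d) → solve 2 (λ f d → f :* con 1 :+ con 0 :* d := f) refl f d , *-identityʳ d) }
        ; comm = λ (f , d) (g , h) → +-comm _ _ , *-comm d h } }

    module ⋆ = CommutativeMonoid ⋆-commutativeMonoid
    open import Algebra.Solver.CommutativeMonoid ⋆-commutativeMonoid public
      using (_⊕_; _⊜_) renaming (solve to ⋆-solve)

    edge-cong : ∀ {p q} → p ≋ q → edge p ≋ edge q
    edge-cong (e , f) = e , +-cong e f

    ·-cong : ∀ {p q r s} → p ≋ q → r ≋ s → p · r ≈ q · s
    ·-cong e f = proj₁ (⋆.∙-cong e f)

    ·-comm : ∀ p q → p · q ≈ q · p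
    ·-comm p q = proj₁ (⋆.comm p q)

    -- Both sides describe r and s joined by an edge, read from its two ends.
    edge-adjoint : ∀ r s → r · edge s ≈ s · edge r
    edge-adjoint (f , d) (g , h) = solve 4 (λ f d g h → f :* (g :+ h) :+ g :* d := g :* (f :+ d) :+ f :* h) refl f d g h

    grow : Pair → Pair
    grow p = vertex ⋆ edge p

    grow^ : ℕ → Pair → Pair
    grow^ zero p = p
    grow^ (suc k) p = grow (grow^ k p)

    grow^-cong : ∀ k {p q} → p ≋ q → grow^ k p ≋ grow^ k q
    grow^-cong zero e = e
    grow^-cong (suc k) e = ⋆.∙-congˡ (edge-cong (grow^-cong k e))

    -- path n is the pair of the path with n vertices rooted at an end; leg n is that path hung from a vertex.
    path leg : ℕ → Pair
    path zero = free
    path (suc n) = grow (path n)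
    leg n = edge (path n)

    leg-grow : ∀ k a → edge (grow^ k (vertex ⋆ leg a)) ≋ leg (a ℕ.+ suc k)
    leg-grow k a rewrite ℕ.+-suc a k | ℕ.+-comm a k = edge-cong (go k)
      where
      go : ∀ k → grow^ k (path (suc a)) ≋ path (suc (k ℕ.+ a))
      go zero = ⋆.refl
      go (suc k) = ⋆.∙-congˡ (edge-cong (go k))

    legs : List ℕ → Pair
    legs = foldr (λ n p → leg n ⋆ p) free

    legs-++ : ∀ A B → legs (A ++ B) ≋ legs A ⋆ legs B
    legs-++ [] B = ⋆.sym (⋆.identityˡ _)
    legs-++ (a ∷ A) B = ⋆.trans (⋆.∙-congˡ (legs-++ A B)) (⋆.sym (⋆.assoc _ _ _))

    Pos² : Pair → Set ℓ
    Pos² (f , d) = Pos f × Pos d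

    Pos-⋆ : ∀ {p q} → Pos² p → Pos² q → Pos² (p ⋆ q)
    Pos-⋆ (h , i) (j , k) = Pos-+ _ (Pos-* h k) , Pos-* i k

    Pos-⋆ʳ : ∀ {p q} → Pos² p → Pos (proj₂ q) → Pos² (p ⋆ q)
    Pos-⋆ʳ (h , i) k = Pos-+ _ (Pos-* h k) , Pos-* i k

    Pos-edge : ∀ {p} → Pos² p → Pos² (edge p)
    Pos-edge (h , i) = h , Pos-+ _ h

    Pos-grow : ∀ {p} → Pos (proj₂ p) → Pos² (grow p)
    Pos-grow i = Pos-⋆ʳ (Pos-x , Pos-1) (Pos-+ʳ _ i)

    Pos-grow^ : ∀ k {p} → Pos² p → Pos² (grow^ k p)
    Pos-grow^ zero h = h
    Pos-grow^ (suc k) h = Pos-grow (proj₂ (Pos-grow^ k h))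

    Pos-path : ∀ n → Pos² (path (suc n))
    Pos-path zero = Pos-grow Pos-1
    Pos-path (suc n) = Pos-grow (proj₂ (Pos-path n))

    Pos-path₂ : ∀ n → Pos (proj₂ (path n))
    Pos-path₂ zero = Pos-1
    Pos-path₂ (suc n) = proj₂ (Pos-path n)

    Pos-leg : ∀ n → Pos² (leg (suc n))
    Pos-leg n = Pos-edge (Pos-path n)

    Pos-leg₂ : ∀ n → Pos (proj₂ (leg n))
    Pos-leg₂ n = Pos-+ʳ _ (Pos-path₂ n)

    Pos-legs₂ : ∀ A → Pos (proj₂ (legs A))
    Pos-legs₂ [] = Pos-1
    Pos-legs₂ (a ∷ A) = Pos-* (Pos-leg₂ a) (Pos-legs₂ A)

    Pos-legs : ∀ a A → Pos² (legs (suc a ∷ A))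
    Pos-legs a A = Pos-⋆ʳ (Pos-leg a) (Pos-legs₂ A)

    -- p ⊵ q compares the quotients f/d of the two pairs, after clearing denominators.
    _⊵_ _▷_ : Pair → Pair → Set (c ⊔ ℓ)
    (f , d) ⊵ (g , h) = g * d ≼ f * h
    (f , d) ▷ (g , h) = g * d ≺ f * h

    ⊵-edge : ∀ {p q} → p ⊵ q → edge p ⊵ edge q
    ⊵-edge {f , d} {g , h} (z , e) = z , (begin
      f * (g + h)        ≈⟨ distribˡ f g h ⟩
      f * g + f * h      ≈⟨ +-congˡ e ⟩
      f * g + (g * d + z)
        ≈⟨ solve 4 (λ f d g z → f :* g :+ (g :* d :+ z) := g :* (f :+ d) :+ z) refl f d g z ⟩
      g * (f + d) + z    ∎)

    ▷-edge : ∀ {p q} → p ▷ q → edge p ▷ edge q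
    ▷-edge {p} {q} (z , h , e) = z , h , proj₂ (⊵-edge {p} {q} (z , e))

    ⊵-vertex : ∀ {p q} → p ⊵ q → vertex ⋆ p ⊵ vertex ⋆ q
    ⊵-vertex {f , d} {g , h} (z , e) = z , (begin
      (x * d + f * 1#) * (1# * h)
        ≈⟨ solve 4 (λ x d f h → (x :* d :+ f :* con 1) :* (con 1 :* h) := x :* d :* h :+ f :* h) refl x d f h ⟩
      x * d * h + f * h           ≈⟨ +-congˡ e ⟩
      x * d * h + (g * d + z)
        ≈⟨ solve 5 (λ x d g h z → x :* d :* h :+ (g :* d :+ z) := (x :* h :+ g :* con 1) :* (con 1 :* d) :+ z) refl x d g h z ⟩
      (x * h + g * 1#) * (1# * d) + z ∎)

    ▷-vertex : ∀ {p q} → p ▷ q → vertex ⋆ p ▷ vertex ⋆ q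
    ▷-vertex {p} {q} (z , h , e) = z , h , proj₂ (⊵-vertex {p} {q} (z , e))

    ⊵-⋆-identity : ∀ {f d g h s t z} → f * h ≈ g * d + z → (s * d + f * t) * h ≈ g * (t * d) + (s * (d * h) + t * z)
    ⊵-⋆-identity {f} {d} {g} {h} {s} {t} {z} e = begin
      (s * d + f * t) * h         ≈⟨ solve 5 (λ s d f t h → (s :* d :+ f :* t) :* h := s :* (d :* h) :+ t :* (f :* h)) refl s d f t h ⟩
      s * (d * h) + t * (f * h)   ≈⟨ +-congˡ (*-congˡ e) ⟩
      s * (d * h) + t * (g * d + z)
        ≈⟨ solve 6 (λ s d g h t z → s :* (d :* h) :+ t :* (g :* d :+ z) := g :* (t :* d) :+ (s :* (d :* h) :+ t :* z)) refl s d g h t z ⟩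
      g * (t * d) + (s * (d * h) + t * z) ∎

    ⊵-⋆ : ∀ s {p q} → p ⊵ q → s ⋆ p ⊵ q
    ⊵-⋆ (s , t) {f , d} {g , h} (z , e) = _ , ⊵-⋆-identity e

    ⊵-⋆-strict : ∀ {s p q} → Pos² s → Pos (proj₂ p) → Pos (proj₂ q) → p ⊵ q → s ⋆ p ▷ q
    ⊵-⋆-strict {s , t} {f , d} {g , h} (i , _) j k (z , e) = _ , Pos-+ _ (Pos-* i (Pos-* j k)) , ⊵-⋆-identity e

    ▷-resp : ∀ {p p′ q} → p ≋ p′ → p ▷ q → p′ ▷ q
    ▷-resp (e , f) (z , h , i) = z , h , trans (*-congʳ (sym e)) (trans i (+-congʳ (*-congˡ f)))

    -- Prefixing a vertex and an edge is monotone, so the comparison reduces to the point where the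
    -- shorter path has become `free`, of quotient 0.
    path-⊵ : ∀ {a b} → a ℕ.≤ b → path b ⊵ path a
    path-⊵ {b = zero} z≤n = 0# , solve 0 (con 0 :* con 1 := con 0 :* con 1 :+ con 0) refl
    path-⊵ {b = suc b} z≤n = _ , solve 2 (λ f d → f :* con 1 := con 0 :* d :+ f) refl (proj₁ (path (suc b))) (proj₂ (path (suc b)))
    path-⊵ {suc a} {suc b} (s≤s h) = ⊵-vertex {leg b} {leg a} (⊵-edge {path b} {path a} (path-⊵ h))

    leg-⊵ : ∀ {a b} → a ℕ.≤ b → leg b ⊵ leg a
    leg-⊵ {a} {b} h = ⊵-edge {path b} {path a} (path-⊵ h)

    ▷-free : ∀ {p} → Pos (proj₁ p) → p ▷ free
    ▷-free {f , d} h = f , h , solve 2 (λ f d → f :* con 1 := con 0 :* d :+ f) refl f d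

    path-▷ : ∀ {a b} → a ℕ.< b → path b ▷ path a
    path-▷ {zero} {suc b} _ = ▷-free (proj₁ (Pos-path b))
    path-▷ {suc a} {suc b} (s≤s h) = ▷-vertex {leg b} {leg a} (▷-edge {path b} {path a} (path-▷ h))

    leg-▷ : ∀ {a b} → a ℕ.< b → leg b ▷ leg a
    leg-▷ {a} {b} h = ▷-edge {path b} {path a} (path-▷ h)

    -- The recursion multiplies w + v N by 1 + N, using N² = x N + x for N = (x x ; 1 0).
    growth : ℕ → Pair
    growth zero = 0# , 1#
    growth (suc k) = let v , w = growth k in w + x * v + v , x * v + w

    combine : Pair → Pair → Pair
    combine (v , w) (f , d) = (w + x * v) * f + x * v * d , v * f + w * d

    -- grow is the linear map with matrix 1 + N, N = (x x ; 1 0), so its k-th power is w + v N with (v , w) = growth k.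
    grow^-linear : ∀ k p → grow^ k p ≋ combine (growth k) p
    grow^-linear zero (f , d) =
        solve 3 (λ x f d → f := (con 1 :+ x :* con 0) :* f :+ x :* con 0 :* d) refl x f d
      , solve 2 (λ f d → d := con 0 :* f :+ con 1 :* d) refl f d
    grow^-linear (suc k) (f , d) =
      ⋆.trans (⋆.∙-congˡ {vertex} (edge-cong (grow^-linear k (f , d))))
        ( solve 5 (λ x v w f d → let g = (w :+ x :* v) :* f :+ x :* v :* d ; h = v :* f :+ w :* d in
            x :* (g :+ h) :+ g :* con 1 := ((x :* v :+ w) :+ x :* (w :+ x :* v :+ v)) :* f :+ x :* (w :+ x :* v :+ v) :* d) refl x v w f d
        , solve 5 (λ x v w f d → let g = (w :+ x :* v) :* f :+ x :* v :* d ; h = v :* f :+ w :* d in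
            con 1 :* (g :+ h) := (w :+ x :* v :+ v) :* f :+ (x :* v :+ w) :* d) refl x v w f d )
      where
      v = proj₁ (growth k)
      w = proj₂ (growth k)

    Pos-growth₂ : ∀ k → Pos (proj₂ (growth k))
    Pos-growth₂ zero = Pos-1
    Pos-growth₂ (suc k) = Pos-+ʳ _ (Pos-growth₂ k)

    -- Again one graph read from both ends, the ends being joined by a path of k + 1 edges.
    edge-grow^-adjoint : ∀ k r s → r · edge (grow^ k s) ≈ s · edge (grow^ k r)
    edge-grow^-adjoint k (f , d) (g , h) = let v = proj₁ (growth k) ; w = proj₂ (growth k) in
      trans (·-cong (⋆.refl {f , d}) (edge-cong (grow^-linear k (g , h))))
        (trans (solve 7 (λ x v w f d g h →
            let p = (w :+ x :* v) :* g :+ x :* v :* h ; q = v :* g :+ w :* h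
                p′ = (w :+ x :* v) :* f :+ x :* v :* d ; q′ = v :* f :+ w :* d in
            f :* (p :+ q) :+ p :* d := g :* (p′ :+ q′) :+ p′ :* h) refl x v w f d g h)
          (sym (·-cong (⋆.refl {g , h}) (edge-cong (grow^-linear k (f , d))))))

    -- Moving the branches s from the far end of an edge path to its near end, when the quotient of the
    -- rest r at the near end beats that of the leg q left behind.
    push-identity : ∀ k r s q z → let v = proj₁ (growth k) ; w = proj₂ (growth k) in
      proj₁ r * proj₂ q ≈ proj₁ q * proj₂ r + z →
      (vertex ⋆ r) · edge (grow^ k (vertex ⋆ q ⋆ s)) ≈
      (vertex ⋆ r ⋆ s) · edge (grow^ k (vertex ⋆ q)) + proj₁ s * ((w + x * v + v) * z)
    push-identity k (a , b) (g , h) (f , e) z i = let v = proj₁ (growth k) ; w = proj₂ (growth k) in begin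
      (vertex ⋆ (a , b)) · edge (grow^ k (vertex ⋆ (f , e) ⋆ (g , h)))
        ≈⟨ ·-cong (⋆.refl {vertex ⋆ (a , b)}) (edge-cong (grow^-linear k (vertex ⋆ (f , e) ⋆ (g , h)))) ⟩
      _ ≈⟨ solve 9 (λ x v w a b g h f e →
             let m = (x :* e :+ f :* con 1) ; n = con 1 :* e
                 F = m :* h :+ g :* n ; D = n :* h
                 P = (w :+ x :* v) :* F :+ x :* v :* D ; Q = v :* F :+ w :* D
             in (x :* b :+ a :* con 1) :* (P :+ Q) :+ P :* (con 1 :* b)
                := ((x :* b :+ a) :* (((w :+ x :* v) :+ v) :* (x :* e :+ f) :+ (x :* v :+ w) :* e) :+ b :* ((w :+ x :* v) :* (x :* e :+ f) :+ x :* v :* e)) :* h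
                   :+ (g :* ((w :+ x :* v :+ v) :* (x :* b :* e)) :+ g :* ((w :+ x :* v) :* e :* b) :+ g :* ((w :+ x :* v :+ v) :* (a :* e))))
           refl x v w a b g h f e ⟩
      -- The product `a * e` has been isolated in the last summand, where the hypothesis on the
      -- quotients replaces it.
      M v w + (g * ((w + x * v + v) * (x * b * e)) + g * ((w + x * v) * e * b) + g * ((w + x * v + v) * (a * e)))
        ≈⟨ +-congˡ (+-congˡ (*-congˡ (*-congˡ i))) ⟩
      M v w + (g * ((w + x * v + v) * (x * b * e)) + g * ((w + x * v) * e * b) + g * ((w + x * v + v) * (f * b + z)))
        ≈⟨ solve 10 (λ x v w a b g h f e z →
             let m = (x :* e :+ f :* con 1) ; n = con 1 :* e
                 P = (w :+ x :* v) :* m :+ x :* v :* n ; Q = v :* m :+ w :* n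
                 α = x :* b :+ a :* con 1 ; β = con 1 :* b
             in ((x :* b :+ a) :* (((w :+ x :* v) :+ v) :* (x :* e :+ f) :+ (x :* v :+ w) :* e) :+ b :* ((w :+ x :* v) :* (x :* e :+ f) :+ x :* v :* e)) :* h
                   :+ (g :* ((w :+ x :* v :+ v) :* (x :* b :* e)) :+ g :* ((w :+ x :* v) :* e :* b) :+ g :* ((w :+ x :* v :+ v) :* (f :* b :+ z)))
                := (α :* h :+ g :* β) :* (P :+ Q) :+ P :* (β :* h) :+ g :* ((w :+ x :* v :+ v) :* z))
           refl x v w a b g h f e z ⟩
      _ ≈⟨ +-congʳ (·-cong (⋆.refl {vertex ⋆ (a , b) ⋆ (g , h)}) (edge-cong (grow^-linear k (vertex ⋆ (f , e))))) ⟨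
      (vertex ⋆ (a , b) ⋆ (g , h)) · edge (grow^ k (vertex ⋆ (f , e))) + g * ((w + x * v + v) * z) ∎
      where
      M : Carrier → Carrier → Carrier
      M v w = ((x * b + a) * (((w + x * v) + v) * (x * e + f) + (x * v + w) * e) + b * ((w + x * v) * (x * e + f) + x * v * e)) * h

    -- The remainder of `push-identity` is the numerator of s times the gap between the quotients
    -- times a positive factor depending on k. On the moved side the leg left behind and the path
    -- fuse into one longer leg.
    push : ∀ k a {r s} → r ▷ leg a → Pos (proj₁ s) →
      (vertex ⋆ r ⋆ s) · leg (a ℕ.+ suc k) ≺ (vertex ⋆ r) · edge (grow^ k (vertex ⋆ leg a ⋆ s))
    push k a {r} {s} (z , h , e) i =
      _ , Pos-* i (Pos-* (Pos-+ _ (Pos-+ _ (Pos-growth₂ k))) h) ,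
      trans (push-identity k r s (leg a) z e) (+-congʳ (·-cong (⋆.refl {vertex ⋆ r ⋆ s}) (leg-grow k a)))

    -- At a vertex with context X and further branches Y, the near end of the path is X ⋆ Y.
    push-root : ∀ X Y k a A → X ⋆ Y ▷ leg a → Pos (proj₁ (legs A)) →
      X · (vertex ⋆ (leg (a ℕ.+ suc k) ⋆ (legs A ⋆ Y))) ≺ X · (vertex ⋆ (edge (grow^ k (vertex ⋆ legs (a ∷ A))) ⋆ Y))
    push-root X Y k a A h i = ≺-resp
      (proj₁ (⋆-solve 5 (λ v X Y A l → ((v ⊕ (X ⊕ Y)) ⊕ A) ⊕ l ⊜ X ⊕ (v ⊕ (l ⊕ (A ⊕ Y)))) ⋆.refl vertex X Y (legs A) (leg (a ℕ.+ suc k))))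
      (trans (·-cong (⋆.refl {vertex ⋆ (X ⋆ Y)}) (edge-cong (grow^-cong k (⋆.assoc vertex (leg a) (legs A)))))
        (proj₁ (⋆-solve 4 (λ v X Y E → (v ⊕ (X ⊕ Y)) ⊕ E ⊜ X ⊕ (v ⊕ (E ⊕ Y))) ⋆.refl vertex X Y (edge (grow^ k (vertex ⋆ legs (a ∷ A)))))))
      (push k a {X ⋆ Y} {legs A} h i)

    -- Demanding all legs up to b, not just leg b, makes the property stable under putting a vertex
    -- and an edge in front, which compares leg a + 1 by way of leg a.
    Dom : ℕ → Pair → Set (c ⊔ ℓ)
    Dom b p = ∀ a → a ℕ.≤ b → p ⊵ leg a

    ⊵-leg-0 : ∀ p → p ⊵ leg 0
    ⊵-leg-0 (f , d) = f , solve 2 (λ f d → f :* (con 0 :+ con 1) := con 0 :* d :+ f) refl f d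

    ⊵-resp : ∀ {p p′ q} → p ≋ p′ → p ⊵ q → p′ ⊵ q
    ⊵-resp (e , f) (z , i) = z , trans (*-congʳ (sym e)) (trans i (+-congʳ (*-congˡ f)))

    Dom-legs : ∀ b B → Dom b (legs (b ∷ B))
    Dom-legs b B a h = ⊵-resp (⋆.comm (legs B) (leg b)) (⊵-⋆ (legs B) {leg b} {leg a} (leg-⊵ h))

    Dom-edge : ∀ {b p} → Dom b p → Dom b (edge (vertex ⋆ p))
    Dom-edge {b} {p} h zero _ = ⊵-leg-0 (edge (vertex ⋆ p))
    Dom-edge {b} {p} h (suc a) (s≤s i) =
      ⊵-edge {vertex ⋆ p} {vertex ⋆ leg a} (⊵-vertex {p} {leg a} (h a (ℕ.m≤n⇒m≤1+n i)))

    Dom-broom : ∀ {b p} k → Dom b p → Dom b (edge (grow^ k (vertex ⋆ p)))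
    Dom-broom {p = p} zero h = Dom-edge {p = p} h
    Dom-broom {p = p} (suc k) h = Dom-edge {p = edge (grow^ k (vertex ⋆ p))} (Dom-broom k h)

    -- Of two branching vertices joined by a path of k + 1 edges, the one owning the shorter of the two
    -- chosen legs a and b keeps that leg, lengthened by the path, and gives up all its other branches.
    merge-at-root : ∀ X a b k A B → Pos² X → Pos (proj₁ (legs A)) → a ℕ.≤ b →
      X · (vertex ⋆ legs (b ∷ (a ℕ.+ suc k) ∷ B ++ A)) ≺ X · (vertex ⋆ (edge (grow^ k (vertex ⋆ legs (a ∷ A))) ⋆ legs (b ∷ B)))
    merge-at-root X a b k A B h i a≤b = ≺-resp
      (trans (proj₁ (⋆-solve 6 (λ v X A B b l → X ⊕ (v ⊕ (l ⊕ (A ⊕ (b ⊕ B)))) ⊜ X ⊕ (v ⊕ (b ⊕ (l ⊕ (B ⊕ A))))) ⋆.refl vertex X (legs A) (legs B) (leg b) (leg (a ℕ.+ suc k))))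
        (·-cong (⋆.refl {X}) (⋆.∙-congˡ {vertex} (⋆.∙-congˡ {leg b} (⋆.∙-congˡ {leg (a ℕ.+ suc k)} (⋆.sym (legs-++ B A)))))))
      refl
      (push-root X (legs (b ∷ B)) k a A (⊵-⋆-strict {X} {legs (b ∷ B)} {leg a} h (Pos-legs₂ (b ∷ B)) (Pos-leg₂ a) (Dom-legs b B a a≤b)) i)

    -- The path is read from the centre, so the branches carried over include the context X itself:
    -- the root moves to the centre, and its leg b stays behind, lengthened by the path. The outcome
    -- is once more a star at the root.
    merge-at-centre : ∀ X a b k A B → Pos² X → Pos (proj₁ (legs A)) → b ℕ.≤ a →
      X · (vertex ⋆ legs (a ∷ (b ℕ.+ suc k) ∷ B ++ A)) ≺ X · (vertex ⋆ (edge (grow^ k (vertex ⋆ legs (a ∷ A))) ⋆ legs (b ∷ B)))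
    merge-at-centre X a b k A B h i b≤a = ≺-resp
      (trans (proj₁ (⋆-solve 6 (λ v X A B a l → ((v ⊕ (A ⊕ a)) ⊕ (X ⊕ B)) ⊕ l ⊜ X ⊕ (v ⊕ (a ⊕ (l ⊕ (B ⊕ A))))) ⋆.refl vertex X (legs A) (legs B) (leg a) (leg (b ℕ.+ suc k))))
        (·-cong (⋆.refl {X}) (⋆.∙-congˡ {vertex} (⋆.∙-congˡ {leg a} (⋆.∙-congˡ {leg (b ℕ.+ suc k)} (⋆.sym (legs-++ B A)))))))
      (trans (edge-grow^-adjoint k (vertex ⋆ (legs A ⋆ leg a)) (vertex ⋆ leg b ⋆ (X ⋆ legs B)))
        (trans (·-cong (⋆.refl {vertex ⋆ leg b ⋆ (X ⋆ legs B)}) (edge-cong (grow^-cong k (⋆.∙-congˡ {vertex} (⋆.comm (legs A) (leg a))))))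
          (proj₁ (⋆-solve 5 (λ v X B b E → ((v ⊕ b) ⊕ (X ⊕ B)) ⊕ E ⊜ X ⊕ (v ⊕ (E ⊕ (b ⊕ B)))) ⋆.refl vertex X (legs B) (leg b) (edge (grow^ k (vertex ⋆ legs (a ∷ A))))))))
      (push k b {legs A ⋆ leg a} {X ⋆ legs B}
        (⊵-⋆-strict {legs A} {leg a} {leg b} (i , Pos-legs₂ A) (Pos-leg₂ a) (Pos-leg₂ b) (leg-⊵ b≤a))
        (proj₁ (Pos-⋆ʳ {X} {legs B} h (Pos-legs₂ B))))

    -- The longer leg is an edge leading to a vertex with leg c. Carrying everything except leg a
    -- across this edge lengthens leg a by one and shortens the other leg by one; it pays because
    -- leg c beats leg a.
    balance-step : ∀ X Y a c → Pos (proj₁ (X ⋆ Y)) → a ℕ.< c →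
      X · (vertex ⋆ (leg (suc a) ⋆ (leg c ⋆ Y))) ≺ X · (vertex ⋆ (leg a ⋆ (leg (suc c) ⋆ Y)))
    balance-step X Y a c h a<c = ≺-resp
      (trans (·-cong (⋆.refl {vertex ⋆ leg c ⋆ (X ⋆ Y)}) (≡⇒≋ (≡.cong leg (ℕ.+-comm a 1))))
        (proj₁ (⋆-solve 5 (λ v X Y c l → ((v ⊕ c) ⊕ (X ⊕ Y)) ⊕ l ⊜ X ⊕ (v ⊕ (l ⊕ (c ⊕ Y)))) ⋆.refl vertex X Y (leg c) (leg (suc a)))))
      (trans (edge-adjoint (vertex ⋆ leg c) (vertex ⋆ leg a ⋆ (X ⋆ Y)))
        (proj₁ (⋆-solve 5 (λ v X Y a l → ((v ⊕ a) ⊕ (X ⊕ Y)) ⊕ l ⊜ X ⊕ (v ⊕ (a ⊕ (l ⊕ Y)))) ⋆.refl vertex X Y (leg a) (leg (suc c)))))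
      (push 0 a {leg c} {X ⋆ Y} (leg-▷ a<c) h)
      where
      ≡⇒≋ : ∀ {p q} → p ≡ q → p ≋ q
      ≡⇒≋ ≡.refl = ⋆.refl

    -- The context seen from the far end of a path of k edges hung in the context X.
    pull : ℕ → Pair → Pair
    pull zero X = X
    pull (suc k) X = pull k (edge (vertex ⋆ X))

    ·-pull : ∀ k X p → X · grow^ k p ≈ pull k X · p
    ·-pull zero X p = refl
    ·-pull (suc k) X p = begin
      X · (vertex ⋆ edge q)       ≈⟨ proj₁ (⋆-solve 3 (λ X v e → X ⊕ (v ⊕ e) ⊜ (v ⊕ X) ⊕ e) ⋆.refl X vertex (edge q)) ⟩
      (vertex ⋆ X) · edge q       ≈⟨ edge-adjoint (vertex ⋆ X) q ⟩
      q · edge (vertex ⋆ X)       ≈⟨ ·-comm q _ ⟩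
      edge (vertex ⋆ X) · q       ≈⟨ ·-pull k (edge (vertex ⋆ X)) p ⟩
      pull (suc k) X · p          ∎
      where q = grow^ k p

    Pos-pull : ∀ k {X} → Pos² X → Pos² (pull k X)
    Pos-pull zero h = h
    Pos-pull (suc k) h = Pos-pull k (Pos-edge (Pos-⋆ (Pos-x , Pos-1) h))

    -- The state (Δ; p, q, r, s) stands for the transfer matrix Δ + (p q ; r s) of a chain of cycle
    -- vertices. A single vertex with pair (F, D) has the matrix (F + D , F ; D , D), and closing the
    -- chain to a cycle gives trace - 2Δ = p + s, since the determinant of the matrix is Δ².
    record State : Set c where
      constructor state
      field Δ p q r s : Carrier

    1ₛ : State
    1ₛ = state 1# 0# 0# 0# 0#

    infixr 5 _◁_
    -- The matrix product with d Δ taken off the diagonal, expanded so that nothing is subtracted.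
    _◁_ : Pair → State → State
    (f , d) ◁ state Δ p q r s = state (d * Δ)
      (f * (Δ + p) + d * p + f * r) (f * (Δ + s) + f * q + d * q) (d * (Δ + p) + d * r) (d * (q + s))

    infixl 5 _▹_
    _▹_ : State → Pair → State
    state Δ p q r s ▹ (f , d) = state (d * Δ)
      (Δ * f + p * f + p * d + q * d) ((Δ + p) * f + q * d) (r * (f + d) + (Δ + s) * d) (r * f + s * d)

    record _≈ₛ_ (M N : State) : Set ℓ where
      constructor mk≈ₛ
      field
        Δ≈ : State.Δ M ≈ State.Δ N
        p≈ : State.p M ≈ State.p N
        q≈ : State.q M ≈ State.q N
        r≈ : State.r M ≈ State.r N
        s≈ : State.s M ≈ State.s N

    ≈ₛ-trans : ∀ {L M N} → L ≈ₛ M → M ≈ₛ N → L ≈ₛ N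
    ≈ₛ-trans (mk≈ₛ a b c d e) (mk≈ₛ a′ b′ c′ d′ e′) = mk≈ₛ (trans a a′) (trans b b′) (trans c c′) (trans d d′) (trans e e′)

    ◁-cong : ∀ {v w M N} → v ≋ w → M ≈ₛ N → (v ◁ M) ≈ₛ (w ◁ N)
    ◁-cong (f , d) (mk≈ₛ Δ p q r s) = mk≈ₛ (*-cong d Δ)
      (+-cong (+-cong (*-cong f (+-cong Δ p)) (*-cong d p)) (*-cong f r))
      (+-cong (+-cong (*-cong f (+-cong Δ s)) (*-cong f q)) (*-cong d q))
      (+-cong (*-cong d (+-cong Δ p)) (*-cong d r))
      (*-cong d (+-cong q s))

    chain : List Pair → State
    chain = foldr _◁_ 1ₛ

    cycle : List Pair → Carrier
    cycle vs = let M = chain vs in State.p M + State.s M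

    -- Read off from the entry p + s of v ◁ M, which is linear in v.
    context : State → Pair
    context (state Δ p q r s) = p + q + s , Δ + p + r

    cycle-context : ∀ v vs → cycle (v ∷ vs) ≈ context (chain vs) · v
    cycle-context (f , d) vs = let state Δ p q r s = chain vs in
      solve 7 (λ f d Δ p q r s → f :* (Δ :+ p) :+ d :* p :+ f :* r :+ d :* (q :+ s) := (p :+ q :+ s) :* d :+ f :* (Δ :+ p :+ r)) refl f d Δ p q r s

    ◁-▹ : ∀ v M w → (v ◁ (M ▹ w)) ≈ₛ ((v ◁ M) ▹ w)
    ◁-▹ (f , d) (state Δ p q r s) (g , h) = mk≈ₛ
      (solve 3 (λ d h Δ → d :* (h :* Δ) := h :* (d :* Δ)) refl d h Δ)
      (solve 9 (λ f d g h Δ p q r s → let p′ = Δ :* g :+ p :* g :+ p :* h :+ q :* h ; r′ = r :* (g :+ h) :+ (Δ :+ s) :* h in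
          f :* (h :* Δ :+ p′) :+ d :* p′ :+ f :* r′
          := d :* Δ :* g :+ (f :* (Δ :+ p) :+ d :* p :+ f :* r) :* g :+ (f :* (Δ :+ p) :+ d :* p :+ f :* r) :* h :+ (f :* (Δ :+ s) :+ f :* q :+ d :* q) :* h)
        refl f d g h Δ p q r s)
      (solve 9 (λ f d g h Δ p q r s → let q′ = (Δ :+ p) :* g :+ q :* h ; s′ = r :* g :+ s :* h in
          f :* (h :* Δ :+ s′) :+ f :* q′ :+ d :* q′
          := (d :* Δ :+ (f :* (Δ :+ p) :+ d :* p :+ f :* r)) :* g :+ (f :* (Δ :+ s) :+ f :* q :+ d :* q) :* h)
        refl f d g h Δ p q r s)
      (solve 8 (λ d g h Δ p q r s → let p′ = Δ :* g :+ p :* g :+ p :* h :+ q :* h ; r′ = r :* (g :+ h) :+ (Δ :+ s) :* h in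
          d :* (h :* Δ :+ p′) :+ d :* r′
          := (d :* (Δ :+ p) :+ d :* r) :* (g :+ h) :+ (d :* Δ :+ d :* (q :+ s)) :* h)
        refl d g h Δ p q r s)
      (solve 8 (λ d g h Δ p q r s → d :* ((Δ :+ p) :* g :+ q :* h :+ (r :* g :+ s :* h))
          := (d :* (Δ :+ p) :+ d :* r) :* g :+ d :* (q :+ s) :* h)
        refl d g h Δ p q r s)

    chain-snoc : ∀ vs w → chain (vs ++ w ∷ []) ≈ₛ (chain vs ▹ w)
    chain-snoc [] (f , d) = mk≈ₛ refl
      (solve 2 (λ f d → f :* (con 1 :+ con 0) :+ d :* con 0 :+ f :* con 0 := con 1 :* f :+ con 0 :* f :+ con 0 :* d :+ con 0 :* d) refl f d)
      (solve 2 (λ f d → f :* (con 1 :+ con 0) :+ f :* con 0 :+ d :* con 0 := (con 1 :+ con 0) :* f :+ con 0 :* d) refl f d)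
      (solve 2 (λ f d → d :* (con 1 :+ con 0) :+ d :* con 0 := con 0 :* (f :+ d) :+ (con 1 :+ con 0) :* d) refl f d)
      (solve 2 (λ f d → d :* (con 0 :+ con 0) := con 0 :* f :+ con 0 :* d) refl f d)
    chain-snoc (v ∷ vs) w = ≈ₛ-trans (◁-cong ⋆.refl (chain-snoc vs w)) (◁-▹ v (chain vs) w)

    -- Cyclic invariance of the trace.
    cycle-rotate₁ : ∀ v vs → cycle (v ∷ vs) ≈ cycle (vs ++ v ∷ [])
    cycle-rotate₁ (f , d) vs = let state Δ p q r s = chain vs ; mk≈ₛ _ p≈ _ _ s≈ = chain-snoc vs (f , d) in
      trans
        (solve 7 (λ f d Δ p q r s → f :* (Δ :+ p) :+ d :* p :+ f :* r :+ d :* (q :+ s)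
          := Δ :* f :+ p :* f :+ p :* d :+ q :* d :+ (r :* f :+ s :* d)) refl f d Δ p q r s)
        (sym (+-cong p≈ s≈))

    cycle-rotate : ∀ us vs → cycle (us ++ vs) ≈ cycle (vs ++ us)
    cycle-rotate [] vs = reflexive (≡.cong cycle (≡.sym (++-identityʳ vs)))
    cycle-rotate (u ∷ us) vs = begin
      cycle (u ∷ us ++ vs)           ≈⟨ cycle-rotate₁ u (us ++ vs) ⟩
      cycle ((us ++ vs) ++ u ∷ [])   ≈⟨ reflexive (≡.cong cycle (++-assoc us vs (u ∷ []))) ⟩
      cycle (us ++ vs ++ u ∷ [])     ≈⟨ cycle-rotate us (vs ++ u ∷ []) ⟩
      cycle ((vs ++ u ∷ []) ++ us)   ≈⟨ reflexive (≡.cong cycle (++-assoc vs (u ∷ []) us)) ⟩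
      cycle (vs ++ u ∷ us)           ∎

    cycle-context-at : ∀ us v vs → cycle (us ++ v ∷ vs) ≈ context (chain (vs ++ us)) · v
    cycle-context-at us v vs = trans (cycle-rotate us (v ∷ vs)) (cycle-context v (vs ++ us))

    Pos-chain-Δ : ∀ {vs} → All Pos² vs → Pos (State.Δ (chain vs))
    Pos-chain-Δ [] = Pos-1
    Pos-chain-Δ (h ∷ hs) = Pos-* (proj₂ h) (Pos-chain-Δ hs)

    Pos-◁-q : ∀ {v M} → Pos² v → Pos (State.Δ M) → Pos (State.q (v ◁ M))
    Pos-◁-q (h , _) i = Pos-+ _ (Pos-+ _ (Pos-* h (Pos-+ _ i)))

    -- Stated for nonempty chains because the empty one has context (0 , 1), whose numerator
    -- vanishes.
    Pos-context : ∀ {v vs} → All Pos² (v ∷ vs) → Pos² (context (chain (v ∷ vs)))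
    Pos-context {v} {vs} (h ∷ hs) =
        Pos-+ _ (Pos-+ʳ _ (Pos-◁-q {v} {chain vs} h (Pos-chain-Δ hs)))
      , Pos-+ _ (Pos-+ _ (Pos-chain-Δ (h ∷ hs)))

    Rooted : Pair → Set (c ⊔ ℓ)
    Rooted v = Σ Pair λ u → v ≡ vertex ⋆ u × Pos (proj₂ u)

    Rooted⇒Pos² : ∀ {v} → Rooted v → Pos² v
    Rooted⇒Pos² (u , ≡.refl , h) = Pos-⋆ʳ (Pos-x , Pos-1) h

    -- The first condition says that the open chain beats path m. The second one says that the context of
    -- a cycle vertex beats leg m, a common summand being removed; the first drives its induction.
    record Beats (m : ℕ) (M : State) : Set (c ⊔ ℓ) where
      open State M
      field
        open-chain : (q , Δ + s) ⊵ path m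
        closed-chain : (r + Δ) * proj₁ (path m) ≺ p * proj₂ (path m) + (q + s) * (proj₁ (path m) + proj₂ (path m))

    beats-0 : ∀ {M} → Pos (State.q M) → Beats 0 M
    beats-0 {state Δ p q r s} h = record
      { open-chain = q , solve 2 (λ q t → q :* con 1 := con 0 :* t :+ q) refl q (Δ + s)
      ; closed-chain = p + (q + s) , Pos-+ʳ _ (Pos-+ _ h)
          , solve 5 (λ Δ p q r s → p :* con 1 :+ (q :+ s) :* (con 0 :+ con 1) := (r :+ Δ) :* con 0 :+ (p :+ (q :+ s))) refl Δ p q r s }

    -- When J comes first, its own quotient settles both conditions and the chain M behind it only
    -- adds to the remainders. Strictness comes from the summand Δ * z.
    beats-start : ∀ {m J M} → J ▷ path m → Pos² J → Pos (State.Δ M) → Beats m (J ◁ M)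
    beats-start {m} {F , D} {state Δ p q r s} (z , h , e) (i , j) k = record
      { open-chain = (Δ + q + s) * z + D * q * d , (begin
          (F * (Δ + s) + F * q + D * q) * d
            ≈⟨ solve 6 (λ F D Δ q s d → (F :* (Δ :+ s) :+ F :* q :+ D :* q) :* d := (Δ :+ q :+ s) :* (F :* d) :+ D :* q :* d) refl F D Δ q s d ⟩
          (Δ + q + s) * (F * d) + D * q * d        ≈⟨ +-congʳ (*-congˡ e) ⟩
          (Δ + q + s) * (f * D + z) + D * q * d
            ≈⟨ solve 7 (λ f D Δ q s d z → (Δ :+ q :+ s) :* (f :* D :+ z) :+ D :* q :* d := f :* (D :* Δ :+ D :* (q :+ s)) :+ ((Δ :+ q :+ s) :* z :+ D :* q :* d)) refl f D Δ q s d z ⟩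
          f * (D * Δ + D * (q + s)) + ((Δ + q + s) * z + D * q * d) ∎)
      ; closed-chain = Δ * z + rest , Pos-+ _ (Pos-* k h) , (begin
          (F * (Δ + p) + D * p + F * r) * d + ((F * (Δ + s) + F * q + D * q) + D * (q + s)) * (f + d)
            ≈⟨ solve 9 (λ F D Δ p q r s f d →
                 (F :* (Δ :+ p) :+ D :* p :+ F :* r) :* d :+ ((F :* (Δ :+ s) :+ F :* q :+ D :* q) :+ D :* (q :+ s)) :* (f :+ d)
                 := (Δ :+ p :+ r :+ (q :+ s :+ Δ)) :* (F :* d) :+ (D :* p :* d :+ (q :+ s :+ Δ) :* F :* f :+ D :* (q :+ q :+ s) :* (f :+ d))) refl F D Δ p q r s f d ⟩
          (Δ + p + r + (q + s + Δ)) * (F * d) + (D * p * d + (q + s + Δ) * F * f + D * (q + q + s) * (f + d))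
            ≈⟨ +-congʳ (*-congˡ e) ⟩
          (Δ + p + r + (q + s + Δ)) * (f * D + z) + (D * p * d + (q + s + Δ) * F * f + D * (q + q + s) * (f + d))
            ≈⟨ solve 10 (λ F D Δ p q r s f d z →
                 (Δ :+ p :+ r :+ (q :+ s :+ Δ)) :* (f :* D :+ z) :+ (D :* p :* d :+ (q :+ s :+ Δ) :* F :* f :+ D :* (q :+ q :+ s) :* (f :+ d))
                 := (D :* (Δ :+ p) :+ D :* r :+ D :* Δ) :* f :+ (Δ :* z :+ ((p :+ r :+ (q :+ s :+ Δ)) :* z :+ (q :+ s) :* f :* D
                    :+ (D :* p :* d :+ (q :+ s :+ Δ) :* F :* f :+ D :* (q :+ q :+ s) :* (f :+ d))))) refl F D Δ p q r s f d z ⟩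
          (D * (Δ + p) + D * r + D * Δ) * f + (Δ * z + rest) ∎) }
      where
      f = proj₁ (path m)
      d = proj₂ (path m)
      rest = (p + r + (q + s + Δ)) * z + (q + s) * f * D + (D * p * d + (q + s + Δ) * F * f + D * (q + q + s) * (f + d))

    -- A further cycle vertex puts a vertex and an edge in front, just as on the way from path m to
    -- path m + 1. The closed condition at m + 1 draws on both conditions at m, hence the companion
    -- condition on the open chain.
    beats-step : ∀ {m M} u → Pos (proj₂ u) → Beats m M → Beats (suc m) (vertex ⋆ u ◁ M)
    beats-step {m} {state Δ p q r s} (u , D) i b = record
      { open-chain = D * z₁ + u * (Δ + q + s) * e , (begin
          ((x * D + u * 1#) * (Δ + s) + (x * D + u * 1#) * q + 1# * D * q) * (1# * (f + d))
            ≈⟨ solve 8 (λ x u D Δ q s f d → let F = x :* D :+ u :* con 1 in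
                 (F :* (Δ :+ s) :+ F :* q :+ con 1 :* D :* q) :* (con 1 :* (f :+ d))
                 := D :* (q :* d) :+ (D :* (x :* (Δ :+ q :+ s) :* (f :+ d) :+ q :* f) :+ u :* (Δ :+ q :+ s) :* (f :+ d))) refl x u D Δ q s f d ⟩
          D * (q * d) + (D * (x * (Δ + q + s) * e + q * f) + u * (Δ + q + s) * e)
            ≈⟨ +-congʳ (*-congˡ h₁) ⟩
          D * (f * (Δ + s) + z₁) + (D * (x * (Δ + q + s) * e + q * f) + u * (Δ + q + s) * e)
            ≈⟨ solve 9 (λ x u D Δ q s f d z → let e = f :+ d in
                 D :* (f :* (Δ :+ s) :+ z) :+ (D :* (x :* (Δ :+ q :+ s) :* e :+ q :* f) :+ u :* (Δ :+ q :+ s) :* e)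
                 := (x :* e :+ f :* con 1) :* (con 1 :* D :* Δ :+ con 1 :* D :* (q :+ s)) :+ (D :* z :+ u :* (Δ :+ q :+ s) :* e)) refl x u D Δ q s f d z₁ ⟩
          (x * e + f * 1#) * (1# * D * Δ + 1# * D * (q + s)) + (D * z₁ + u * (Δ + q + s) * e) ∎)
      ; closed-chain = D * z₂ + rest , Pos-+ _ (Pos-* i pos) , (begin
          (F * (Δ + p) + 1# * D * p + F * r) * (1# * e) + ((F * (Δ + s) + F * q + 1# * D * q) + 1# * D * (q + s)) * ((x * e + f * 1#) + 1# * e)
            ≈⟨ solve 10 (λ x u D Δ p q r s f d → let e = f :+ d ; F = x :* D :+ u :* con 1 ; U = q :+ s ; g = x :* e :+ f in
                 (F :* (Δ :+ p) :+ con 1 :* D :* p :+ F :* r) :* (con 1 :* e) :+ ((F :* (Δ :+ s) :+ F :* q :+ con 1 :* D :* q) :+ con 1 :* D :* (q :+ s)) :* ((x :* e :+ f :* con 1) :+ con 1 :* e)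
                 := D :* (p :* d :+ U :* e) :+ D :* (q :* d) :+ (D :* (p :* f :+ x :* (Δ :+ p :+ r) :* e :+ x :* (U :+ Δ) :* (g :+ e) :+ U :* g :+ q :* f :+ q :* g)
                    :+ u :* ((Δ :+ p :+ r) :* e :+ (U :+ Δ) :* (g :+ e)))) refl x u D Δ p q r s f d ⟩
          D * (p * d + U * e) + D * (q * d) + (D * (p * f + x * (Δ + p + r) * e + x * (U + Δ) * (g + e) + U * g + q * f + q * g) + tail)
            ≈⟨ +-congʳ (+-cong (*-congˡ h₂) (*-congˡ h₁)) ⟩
          D * ((r + Δ) * f + z₂) + D * (f * (Δ + s) + z₁) + (D * (p * f + x * (Δ + p + r) * e + x * (U + Δ) * (g + e) + U * g + q * f + q * g) + tail)
            ≈⟨ solve 12 (λ x D Δ p q r s f d z₁ z₂ t → let e = f :+ d ; U = q :+ s ; g = x :* e :+ f in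
                 D :* ((r :+ Δ) :* f :+ z₂) :+ D :* (f :* (Δ :+ s) :+ z₁) :+ (D :* (p :* f :+ x :* (Δ :+ p :+ r) :* e :+ x :* (U :+ Δ) :* (g :+ e) :+ U :* g :+ q :* f :+ q :* g) :+ t)
                 := (con 1 :* D :* (Δ :+ p) :+ con 1 :* D :* r :+ con 1 :* D :* Δ) :* (x :* e :+ f :* con 1)
                    :+ (D :* z₂ :+ (D :* (z₁ :+ f :* s :+ x :* U :* (g :+ e) :+ x :* Δ :* g :+ U :* g :+ q :* f :+ q :* g) :+ t)))
               refl x D Δ p q r s f d z₁ z₂ tail ⟩
          (1# * D * (Δ + p) + 1# * D * r + 1# * D * Δ) * (x * e + f * 1#) + (D * z₂ + rest) ∎) }
      where
      f = proj₁ (path m)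
      d = proj₂ (path m)
      e = f + d
      F = x * D + u * 1#
      U = q + s
      g = x * e + f
      z₁ = proj₁ (Beats.open-chain b)
      h₁ = proj₂ (Beats.open-chain b)
      z₂ = proj₁ (Beats.closed-chain b)
      pos = proj₁ (proj₂ (Beats.closed-chain b))
      h₂ = proj₂ (proj₂ (Beats.closed-chain b))
      tail = u * ((Δ + p + r) * e + (U + Δ) * (g + e))
      rest = D * (z₁ + f * s + x * U * (g + e) + x * Δ * g + U * g + q * f + q * g) + tail

    -- Every vertex in front of J lowers m by one in the recursion. Either J is reached with some m
    -- ≤ n left, or m becomes 0 earlier and positivity of the chain suffices.
    beats-chain : ∀ {n J} us vs → (∀ m → m ℕ.≤ n → J ▷ path m) → Pos² J → All Rooted us → All Pos² vs →
      ∀ m → m ℕ.≤ n → Beats m (chain (us ++ J ∷ vs))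
    beats-chain {J = J} [] vs h i [] hs m m≤n = beats-start {m} {J} {chain vs} (h m m≤n) i (Pos-chain-Δ hs)
    beats-chain {J = J} (u ∷ us) vs h i (k ∷ ks) hs zero _ =
      beats-0 (Pos-◁-q {u} {chain (us ++ J ∷ vs)} (Rooted⇒Pos² k) (Pos-chain-Δ (all us ks)))
      where
      all : ∀ us → All Rooted us → All Pos² (us ++ J ∷ vs)
      all [] [] = i ∷ hs
      all (_ ∷ us) (k ∷ ks) = Rooted⇒Pos² k ∷ all us ks
    beats-chain {J = J} (u ∷ us) vs h i ((t , ≡.refl , k) ∷ ks) hs (suc m) m<n =
      beats-step {m} {chain (us ++ J ∷ vs)} t k (beats-chain us vs h i ks hs m (ℕ.<⇒≤ m<n))

    context-▷ : ∀ {m M} → Beats m M → context M ▷ leg m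
    context-▷ {m} {state Δ p q r s} b = let z , h , e = Beats.closed-chain b in z , h , (begin
      (p + q + s) * (f + d)
        ≈⟨ solve 5 (λ p q s f d → (p :+ q :+ s) :* (f :+ d) := p :* f :+ (p :* d :+ (q :+ s) :* (f :+ d))) refl p q s f d ⟩
      p * f + (p * d + (q + s) * (f + d))   ≈⟨ +-congˡ e ⟩
      p * f + ((r + Δ) * f + z)
        ≈⟨ solve 5 (λ Δ p r f z → p :* f :+ ((r :+ Δ) :* f :+ z) := f :* (Δ :+ p :+ r) :+ z) refl Δ p r f z ⟩
      f * (Δ + p + r) + z ∎)
      where
      f = proj₁ (path m)
      d = proj₂ (path m)

    -- The determinant of the cycle with one edge deleted: the path is eliminated from one end, each
    -- vertex becoming a branch of the next.
    open-chain : Pair → List Pair → Pair → Carrier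
    open-chain v [] u = u · edge v
    open-chain v (w ∷ vs) u = open-chain (w ⋆ edge v) vs u

    through : State → Pair → Pair → Carrier
    through (state Δ p q r s) (f , d) (g , h) = (f + d) * ((Δ + p) * g + q * h) + f * (r * g + (Δ + s) * h)

    open-chain-through : ∀ v vs u → open-chain v vs u ≈ through (chain vs) v u
    open-chain-through (f , d) [] (g , h) =
      solve 4 (λ f d g h → g :* (f :+ d) :+ f :* h := (f :+ d) :* ((con 1 :+ con 0) :* g :+ con 0 :* h) :+ f :* (con 0 :* g :+ (con 1 :+ con 0) :* h)) refl f d g h
    open-chain-through (f , d) ((a , b) ∷ vs) (g , h) = let state Δ p q r s = chain vs in
      trans (open-chain-through ((a , b) ⋆ edge (f , d)) vs (g , h))
        (solve 11 (λ f d a b g h Δ p q r s → let F = a :* (f :+ d) :+ f :* b ; D = b :* (f :+ d) in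
            (F :+ D) :* ((Δ :+ p) :* g :+ q :* h) :+ F :* (r :* g :+ (Δ :+ s) :* h)
            := (f :+ d) :* ((b :* Δ :+ (a :* (Δ :+ p) :+ b :* p :+ a :* r)) :* g :+ (a :* (Δ :+ s) :+ a :* q :+ b :* q) :* h)
               :+ f :* ((b :* (Δ :+ p) :+ b :* r) :* g :+ (b :* Δ :+ b :* (q :+ s)) :* h))
          refl f d a b g h Δ p q r s)

    -- The recursion that determinants satisfy by deletion and contraction of a cycle edge; through
    -- it `cycle` is later identified with a determinant.
    cycle-deletion-contraction : ∀ u v vs → cycle (u ∷ v ∷ vs) ≈ open-chain v vs u + cycle (u ⋆ v ∷ vs)
    cycle-deletion-contraction (g , h) (f , d) vs = let state Δ p q r s = chain vs in
      trans
        (solve 9 (λ g h f d Δ p q r s →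
            let p′ = f :* (Δ :+ p) :+ d :* p :+ f :* r ; q′ = f :* (Δ :+ s) :+ f :* q :+ d :* q
                r′ = d :* (Δ :+ p) :+ d :* r ; s′ = d :* (q :+ s) ; Δ′ = d :* Δ
                F = g :* d :+ f :* h ; D = h :* d in
            g :* (Δ′ :+ p′) :+ h :* p′ :+ g :* r′ :+ h :* (q′ :+ s′)
            := (f :+ d) :* ((Δ :+ p) :* g :+ q :* h) :+ f :* (r :* g :+ (Δ :+ s) :* h) :+ (F :* (Δ :+ p) :+ D :* p :+ F :* r :+ D :* (q :+ s)))
          refl g h f d Δ p q r s)
        (+-congʳ (sym (open-chain-through (f , d) vs (g , h))))

-- Reduction of a rooted tree to a path ending in a balanced star.

module TreeReduction where
  open import Defs
  open RootedPairs
  open import Algebra.Bundles using (CommutativeSemiring)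
  open import Data.List using (List; []; _∷_; _++_; map; length; replicate)
  open import Data.Nat.ListAction using (sum)
  open import Data.Nat.ListAction.Properties using (sum-++; sum-↭)
  open import Data.Nat as ℕ using (ℕ; zero; suc; z≤n; s≤s)
  import Data.Nat.Properties as ℕ
  open import Data.Nat.DivMod using (_/_; _%_; [m+kn]%n≡m%n; m<n⇒m%n≡m; +-distrib-/-∣ʳ; m<n⇒m/n≡0; m*n/n≡m)
  open import Data.Nat.Divisibility using (n∣m*n)
  open import Data.Nat.Solver using (module +-*-Solver)
  open import Data.List.Properties using (length-++; map-++; map-replicate; length-replicate)
  open import Data.List.Relation.Unary.All as All using (All; []; _∷_)
  open import Data.List.Relation.Binary.Permutation.Propositional using (_↭_; prep; swap; ↭-refl; ↭-trans; ↭-sym)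
  import Data.List.Relation.Binary.Permutation.Propositional as Perm
  open import Data.List.Relation.Binary.Permutation.Propositional.Properties using (map⁺; shift; ↭-length)
  open import Data.Product using (Σ; _×_; _,_; proj₁; proj₂)
  open import Data.Sum using (_⊎_; inj₁; inj₂)
  open import Level using (_⊔_)
  open import Relation.Nullary using (contradiction)
  open import Relation.Binary.PropositionalEquality as ≡ using (_≡_; _≢_)

  -- An entry a in a list of legs stands for `pathTree a`, which has a + 1 vertices.
  total : List ℕ → ℕ
  total L = sum (map suc L)

  size-pathTree : ∀ n → size (pathTree n) ≡ suc n
  size-pathTree zero = ≡.refl
  size-pathTree (suc n) = ≡.cong suc (≡.trans (ℕ.+-identityʳ _) (size-pathTree n))

  sizes-paths : ∀ L → sizes (map pathTree L) ≡ total L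
  sizes-paths [] = ≡.refl
  sizes-paths (a ∷ L) = ≡.cong₂ ℕ._+_ (size-pathTree a) (sizes-paths L)

  size-hang : ∀ k t → size (hang k t) ≡ k ℕ.+ size t
  size-hang zero t = ≡.refl
  size-hang (suc k) t = ≡.cong suc (≡.trans (ℕ.+-identityʳ _) (size-hang k t))

  leavesF-∷ : ∀ t ts → leavesF (t ∷ ts) ≡ leavesF (t ∷ []) ℕ.+ leavesF ts
  leavesF-∷ (node []) ts = ≡.refl
  leavesF-∷ (node (c ∷ cs)) ts = ≡.cong (ℕ._+ leavesF ts) (≡.sym (ℕ.+-identityʳ _))

  leavesF-path : ∀ n → leavesF (pathTree n ∷ []) ≡ 1
  leavesF-path zero = ≡.refl
  leavesF-path (suc n) = ≡.trans (ℕ.+-identityʳ _) (leavesF-path n)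

  leavesF-paths : ∀ L → leavesF (map pathTree L) ≡ length L
  leavesF-paths [] = ≡.refl
  leavesF-paths (a ∷ L) = ≡.trans (leavesF-∷ (pathTree a) (map pathTree L)) (≡.cong₂ ℕ._+_ (leavesF-path a) (leavesF-paths L))

  leavesF-hang : ∀ k t ts → leavesF (hang k (node (t ∷ ts)) ∷ []) ≡ leavesF (t ∷ ts)
  leavesF-hang zero t ts = ℕ.+-identityʳ _
  leavesF-hang (suc k) t ts = ≡.trans (ℕ.+-identityʳ _) (leavesF-hang k t ts)

  -- A broom names two of its legs, so its centre really branches; `bare` is the case without
  -- branching. The number k counts the edges from root to centre.
  data Shape : Set where
    bare  : ℕ → Shape
    broom : ℕ → ℕ → ℕ → List ℕ → Shape

  data ForestShape : Set where
    single : Shape → ForestShape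
    star   : ℕ → ℕ → List ℕ → ForestShape

  toTree : Shape → RTree
  toTree (bare n) = pathTree n
  toTree (broom k a b L) = hang k (node (map pathTree (a ∷ b ∷ L)))

  toForest : ForestShape → List RTree
  toForest (single s) = toTree s ∷ []
  toForest (star a b L) = map pathTree (a ∷ b ∷ L)

  data Similar (t u : RTree) : Set where
    similar : ∀ k {L M} → L ↭ M → t ≡ hang k (node (map pathTree L)) → u ≡ hang k (node (map pathTree M)) → Similar t u

  -- The l + 1 legs of a balanced star with N vertices besides the centre. Entries are one less than
  -- vertex counts, hence q and q - 1; the longer legs come first, so the head is a longest leg.
  balanced : ℕ → ℕ → List ℕ
  balanced N l = replicate r q ++ replicate (suc l ℕ.∸ r) (q ℕ.∸ 1)
    where
    q = N / suc l
    r = N % suc l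

  Btree-broom : ∀ n l k {N} → n ℕ.∸ suc k ℕ.+ 1 ℕ.∸ 1 ≡ N →
    Btree n (suc l) (suc k) ≡ hang k (node (map pathTree (balanced N l)))
  Btree-broom n l k {N} ≡.refl = ≡.cong (λ ts → hang k (node ts)) (≡.sym
    (≡.trans (map-++ pathTree (replicate (N % suc l) (N / suc l)) _)
      (≡.cong₂ _++_ (map-replicate pathTree (N % suc l) (N / suc l)) (map-replicate pathTree (suc l ℕ.∸ N % suc l) (N / suc l ℕ.∸ 1)))))

  extract-min : ∀ a L → Σ ℕ λ m → Σ (List ℕ) λ R → a ∷ L ↭ m ∷ R × All (m ℕ.≤_) R
  extract-min a [] = a , [] , ↭-refl , []
  extract-min a (b ∷ L) with extract-min b L
  ... | m , R , p , h with ℕ.≤-total a m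
  ... | inj₁ a≤m = a , m ∷ R , prep a p , a≤m ∷ All.map (ℕ.≤-trans a≤m) h
  ... | inj₂ m≤a = m , a ∷ R , ↭-trans (prep a p) (swap a m ↭-refl) , m≤a ∷ h

  -- Moving a vertex to the shortest leg m helps exactly when some leg exceeds it by two or more. If
  -- none does, only m and m + 1 occur and the legs are balanced.
  find-excess : ∀ m R → All (m ℕ.≤_) R →
    (Σ ℕ λ c → Σ (List ℕ) λ R′ → R ↭ suc c ∷ R′ × m ℕ.< c) ⊎
    (Σ ℕ λ i → Σ ℕ λ j → R ↭ replicate i (suc m) ++ replicate j m)
  find-excess m [] [] = inj₂ (0 , 0 , ↭-refl)
  find-excess m (y ∷ R) (m≤y ∷ h) with find-excess m R h
  ... | inj₁ (c , R′ , p , m<c) = inj₁ (c , y ∷ R′ , ↭-trans (prep y p) (swap y (suc c) ↭-refl) , m<c)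
  ... | inj₂ (i , j , p) with ℕ.m≤n⇒m<n∨m≡n m≤y
  ... | inj₂ ≡.refl = inj₂ (i , suc j , ↭-trans (prep m p) (↭-sym (shift m (replicate i (suc m)) (replicate j m))))
  ... | inj₁ (s≤s {n = y′} m≤y′) with ℕ.m≤n⇒m<n∨m≡n m≤y′
  ... | inj₂ ≡.refl = inj₂ (suc i , j , prep (suc m) p)
  ... | inj₁ m<y′ = inj₁ (y′ , R , ↭-refl , m<y′)

  total-↭ : ∀ {L M} → L ↭ M → total L ≡ total M
  total-↭ p = sum-↭ (map⁺ suc p)

  total-replicate : ∀ i m → total (replicate i m) ≡ i ℕ.* suc m
  total-replicate zero m = ≡.refl
  total-replicate (suc i) m = ≡.cong (suc m ℕ.+_) (total-replicate i m)

  total-++ : ∀ A B → total (A ++ B) ≡ total A ℕ.+ total B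
  total-++ A B = ≡.trans (≡.cong sum (map-++ suc A B)) (sum-++ (map suc A) (map suc B))

  -- Uniqueness of quotient and remainder: the smaller value occurs at least once, so i is less than
  -- l + 1 and is the remainder.
  two-valued-balanced : ∀ i j m {N l} → i ℕ.+ suc j ≡ suc l → i ℕ.+ suc m ℕ.* suc l ≡ N →
    replicate i (suc m) ++ replicate (suc j) m ≡ balanced N l
  two-valued-balanced i j m {N} {l} hl ≡.refl = ≡.cong₂ _++_
    (≡.cong₂ replicate r≡ q≡)
    (≡.cong₂ replicate (≡.trans (≡.sym (ℕ.m+n∸m≡n i (suc j))) (≡.cong₂ ℕ._∸_ hl r≡)) (≡.cong (ℕ._∸ 1) q≡))
    where
    i<l : i ℕ.< suc l
    i<l = ≡.subst (i ℕ.<_) hl (ℕ.m<m+n i (s≤s z≤n))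
    r≡ : i ≡ N % suc l
    r≡ = ≡.sym (≡.trans ([m+kn]%n≡m%n i (suc m) (suc l)) (m<n⇒m%n≡m i<l))
    q≡ : suc m ≡ N / suc l
    q≡ = ≡.sym (≡.trans (+-distrib-/-∣ʳ i (n∣m*n (suc m))) (≡.cong₂ ℕ._+_ (m<n⇒m/n≡0 i<l) (m*n/n≡m (suc m) (suc l))))

  -- Termination measure of balancing: it drops when a vertex passes from a leg to one shorter by at
  -- least two.
  square-sum : List ℕ → ℕ
  square-sum L = sum (map (λ a → a ℕ.* a) L)

  square-sum-↭ : ∀ {L M} → L ↭ M → square-sum L ≡ square-sum M
  square-sum-↭ p = sum-↭ (map⁺ _ p)

  square-sum-step : ∀ {a c} R → a ℕ.< c → square-sum (suc a ∷ c ∷ R) ℕ.< square-sum (a ∷ suc c ∷ R)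
  square-sum-step {a} {c} R a<c = begin-strict
    suc a ℕ.* suc a ℕ.+ (c ℕ.* c ℕ.+ t)
      ≡⟨ solve 3 (λ a c t → (con 1 :+ a) :* (con 1 :+ a) :+ (c :* c :+ t) := con 1 :+ (a :+ a) :+ (a :* a :+ c :* c :+ t)) ≡.refl a c t ⟩
    suc (a ℕ.+ a) ℕ.+ (a ℕ.* a ℕ.+ c ℕ.* c ℕ.+ t)
      <⟨ ℕ.+-monoˡ-< (a ℕ.* a ℕ.+ c ℕ.* c ℕ.+ t) (s≤s (ℕ.+-mono-< a<c a<c)) ⟩
    suc (c ℕ.+ c) ℕ.+ (a ℕ.* a ℕ.+ c ℕ.* c ℕ.+ t)
      ≡⟨ solve 3 (λ a c t → con 1 :+ (c :+ c) :+ (a :* a :+ c :* c :+ t) := a :* a :+ ((con 1 :+ c) :* (con 1 :+ c) :+ t)) ≡.refl a c t ⟩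
    a ℕ.* a ℕ.+ (suc c ℕ.* suc c ℕ.+ t) ∎
    where
    open ℕ.≤-Reasoning
    open +-*-Solver
    t = square-sum R

  module TreePairs {c ℓ} (K : CommutativeSemiring c ℓ) (S : PositivityStructure K) where
    open CommutativeSemiring K using (_≈_; refl; sym; trans)
    open PositivityStructure S
    open PairAlgebra K S

    mutual
      pairT : RTree → Pair
      pairT (node ts) = vertex ⋆ branches ts

      branches : List RTree → Pair
      branches [] = free
      branches (t ∷ ts) = edge (pairT t) ⋆ branches ts

    mutual
      Pos-pairT : ∀ t → Pos² (pairT t)
      Pos-pairT (node ts) = Pos-⋆ʳ (Pos-x , Pos-1) (Pos-branches ts)

      Pos-branches : ∀ ts → Pos (proj₂ (branches ts))
      Pos-branches [] = Pos-1
      Pos-branches (t ∷ ts) = Pos-* (proj₂ (Pos-edge (Pos-pairT t))) (Pos-branches ts)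

    Rooted-pairT : ∀ t → Rooted (pairT t)
    Rooted-pairT (node ts) = branches ts , ≡.refl , Pos-branches ts

    pairT-path : ∀ n → pairT (pathTree n) ≋ vertex ⋆ leg n
    pairT-path zero = ⋆.∙-congˡ {vertex} (refl , sym (CommutativeSemiring.+-identityˡ K _))
    pairT-path (suc n) = ⋆.∙-congˡ {vertex} (⋆.trans (⋆.identityʳ _) (edge-cong (pairT-path n)))

    pairT-hang : ∀ k t → pairT (hang k t) ≋ grow^ k (pairT t)
    pairT-hang zero t = ⋆.refl
    pairT-hang (suc k) t = ⋆.∙-congˡ {vertex} (⋆.trans (⋆.identityʳ _) (edge-cong (pairT-hang k t)))

    legs⁺ : List ℕ → Pair
    legs⁺ L = legs (map suc L)

    branches-paths : ∀ L → branches (map pathTree L) ≋ legs⁺ L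
    branches-paths [] = ⋆.refl
    branches-paths (a ∷ L) = ⋆.∙-cong (edge-cong (pairT-path a)) (branches-paths L)

    pairT-broom : ∀ k L → pairT (hang k (node (map pathTree L))) ≋ grow^ k (vertex ⋆ legs⁺ L)
    pairT-broom k L = ⋆.trans (pairT-hang k _) (grow^-cong k (⋆.∙-congˡ {vertex} (branches-paths L)))

    -- Strictness in every positive context lets an improvement inside a tree survive its embedding
    -- into a larger graph.
    Better : RTree → RTree → Set (c ⊔ ℓ)
    Better t t′ = ∀ X → Pos² X → X · pairT t′ ≺ X · pairT t

    BetterF : List RTree → List RTree → Set (c ⊔ ℓ)
    BetterF ts ts′ = Better (node ts) (node ts′)

    Improves : List RTree → List RTree → Set (c ⊔ ℓ)
    Improves ts ts′ = ts ≡ ts′ ⊎ BetterF ts ts′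

    BetterF-trans : ∀ {ts us vs} → BetterF ts us → BetterF us vs → BetterF ts vs
    BetterF-trans h i X j = ≺-≼-trans (i X j) (≺⇒≼ (h X j))

    Improves-trans : ∀ {ts us vs} → Improves ts us → Improves us vs → Improves ts vs
    Improves-trans (inj₁ ≡.refl) i = i
    Improves-trans (inj₂ h) (inj₁ ≡.refl) = inj₂ h
    Improves-trans {ts} {us} {vs} (inj₂ h) (inj₂ i) = inj₂ (BetterF-trans {ts} {us} {vs} h i)

    -- Seen from t, its parent with siblings and context X lies behind one edge; all this forms the
    -- new context.
    BetterF-head : ∀ {t t′} ts → Better t t′ → BetterF (t ∷ ts) (t′ ∷ ts)
    BetterF-head {t} {t′} ts h X i = ≺-resp (lemma t′) (lemma t) (h (edge (vertex ⋆ X ⋆ branches ts))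
      (Pos-edge (Pos-⋆ʳ (Pos-⋆ (Pos-x , Pos-1) i) (Pos-branches ts))))
      where
      lemma : ∀ t → edge (vertex ⋆ X ⋆ branches ts) · pairT t ≈ X · pairT (node (t ∷ ts))
      lemma t = trans (·-comm _ (pairT t)) (trans (edge-adjoint (pairT t) (vertex ⋆ X ⋆ branches ts))
        (proj₁ (⋆-solve 4 (λ v X B e → ((v ⊕ X) ⊕ B) ⊕ e ⊜ X ⊕ (v ⊕ (e ⊕ B))) ⋆.refl vertex X (branches ts) (edge (pairT t)))))

    BetterF-tail : ∀ t {ts ts′} → BetterF ts ts′ → BetterF (t ∷ ts) (t ∷ ts′)
    BetterF-tail t {ts} {ts′} h X i = ≺-resp (lemma ts′) (lemma ts) (h (X ⋆ edge (pairT t)) (Pos-⋆ i (Pos-edge (Pos-pairT t))))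
      where
      lemma : ∀ ts → (X ⋆ edge (pairT t)) · pairT (node ts) ≈ X · pairT (node (t ∷ ts))
      lemma ts = proj₁ (⋆-solve 4 (λ v X B e → (X ⊕ e) ⊕ (v ⊕ B) ⊜ X ⊕ (v ⊕ (e ⊕ B))) ⋆.refl vertex X (branches ts) (edge (pairT t)))

    record MergedStar (k a : ℕ) (A : List ℕ) (n : ℕ) (B : List ℕ) : Set (c ⊔ ℓ) where
      field
        a′ b′ : ℕ
        L′ : List ℕ
        total≡ : suc k ℕ.+ total (a ∷ A) ℕ.+ total (n ∷ B) ≡ total (a′ ∷ b′ ∷ L′)
        length≡ : length (a ∷ A) ℕ.+ length (n ∷ B) ≡ length (a′ ∷ b′ ∷ L′)
        improves : ∀ X → Pos² X →
          X · (vertex ⋆ legs⁺ (a′ ∷ b′ ∷ L′)) ≺ X · (vertex ⋆ (edge (grow^ k (vertex ⋆ legs⁺ (a ∷ A))) ⋆ legs⁺ (n ∷ B)))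

    -- Any leg of either centre may serve as the chosen one; comparing a with n decides which centre
    -- gives up its other branches.
    mergeStar : ∀ k a a₁ A n B → MergedStar k a (a₁ ∷ A) n B
    mergeStar k a a₁ A n B with ℕ.≤-total a n
    ... | inj₁ a≤n = record
      { a′ = n ; b′ = a ℕ.+ suc k ; L′ = B ++ a₁ ∷ A
      ; total≡ = ≡.trans (+-*-Solver.solve 5 (λ k a n A B → con 1 :+ k :+ (con 1 :+ a :+ A) :+ (con 1 :+ n :+ B) := con 1 :+ n :+ (con 1 :+ (a :+ (con 1 :+ k)) :+ (B :+ A))) ≡.refl k a n (total (a₁ ∷ A)) (total B))
          (≡.cong (λ u → suc n ℕ.+ (suc (a ℕ.+ suc k) ℕ.+ u)) (≡.sym (total-++ B (a₁ ∷ A))))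
      ; length≡ = ≡.trans (+-*-Solver.solve 2 (λ A B → con 1 :+ A :+ (con 1 :+ B) := con 1 :+ (con 1 :+ (B :+ A))) ≡.refl (length (a₁ ∷ A)) (length B))
          (≡.cong (λ u → suc (suc u)) (≡.sym (length-++ B)))
      ; improves = λ X h → ≺-resp (reflexive (≡.cong (λ L → X · (vertex ⋆ legs (suc n ∷ (suc a ℕ.+ suc k) ∷ L))) (≡.sym (map-++ suc B (a₁ ∷ A))))) refl
          (merge-at-root X (suc a) (suc n) k (map suc (a₁ ∷ A)) (map suc B) h (proj₁ (Pos-legs a₁ (map suc A))) (s≤s a≤n)) }
      where
      open +-*-Solver using (con; _:+_; _:=_)
      open CommutativeSemiring K using (reflexive)
    ... | inj₂ n≤a = record
      { a′ = a ; b′ = n ℕ.+ suc k ; L′ = B ++ a₁ ∷ A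
      ; total≡ = ≡.trans (+-*-Solver.solve 5 (λ k a n A B → con 1 :+ k :+ (con 1 :+ a :+ A) :+ (con 1 :+ n :+ B) := con 1 :+ a :+ (con 1 :+ (n :+ (con 1 :+ k)) :+ (B :+ A))) ≡.refl k a n (total (a₁ ∷ A)) (total B))
          (≡.cong (λ u → suc a ℕ.+ (suc (n ℕ.+ suc k) ℕ.+ u)) (≡.sym (total-++ B (a₁ ∷ A))))
      ; length≡ = ≡.trans (+-*-Solver.solve 2 (λ A B → con 1 :+ A :+ (con 1 :+ B) := con 1 :+ (con 1 :+ (B :+ A))) ≡.refl (length (a₁ ∷ A)) (length B))
          (≡.cong (λ u → suc (suc u)) (≡.sym (length-++ B)))
      ; improves = λ X h → ≺-resp (reflexive (≡.cong (λ L → X · (vertex ⋆ legs (suc a ∷ (suc n ℕ.+ suc k) ∷ L))) (≡.sym (map-++ suc B (a₁ ∷ A))))) refl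
          (merge-at-centre X (suc a) (suc n) k (map suc (a₁ ∷ A)) (map suc B) h (proj₁ (Pos-legs a₁ (map suc A))) (s≤s n≤a)) }
      where
      open +-*-Solver using (con; _:+_; _:=_)
      open CommutativeSemiring K using (reflexive)

    sizes-↭ : ∀ {ts us} → ts ↭ us → sizes ts ≡ sizes us
    sizes-↭ Perm.refl = ≡.refl
    sizes-↭ (prep t p) = ≡.cong (size t ℕ.+_) (sizes-↭ p)
    sizes-↭ (swap {ts} t u p) = ≡.trans (≡.sym (ℕ.+-assoc (size t) (size u) (sizes ts)))
      (≡.trans (≡.cong₂ ℕ._+_ (ℕ.+-comm (size t) (size u)) (sizes-↭ p)) (ℕ.+-assoc (size u) (size t) _))
    sizes-↭ (Perm.trans p q) = ≡.trans (sizes-↭ p) (sizes-↭ q)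

    leavesF-↭ : ∀ {ts us} → ts ↭ us → leavesF ts ≡ leavesF us
    leavesF-↭ Perm.refl = ≡.refl
    leavesF-↭ (prep {ts} {us} t p) = ≡.trans (leavesF-∷ t ts) (≡.trans (≡.cong (leavesF (t ∷ []) ℕ.+_) (leavesF-↭ p)) (≡.sym (leavesF-∷ t us)))
    leavesF-↭ (swap {ts} {us} t u p) = begin
      leavesF (t ∷ u ∷ ts)                  ≡⟨ ≡.trans (leavesF-∷ t (u ∷ ts)) (≡.cong (l t ℕ.+_) (leavesF-∷ u ts)) ⟩
      l t ℕ.+ (l u ℕ.+ leavesF ts)          ≡⟨ ℕ.+-assoc (l t) (l u) _ ⟨
      l t ℕ.+ l u ℕ.+ leavesF ts            ≡⟨ ≡.cong₂ ℕ._+_ (ℕ.+-comm (l t) (l u)) (leavesF-↭ p) ⟩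
      l u ℕ.+ l t ℕ.+ leavesF us            ≡⟨ ℕ.+-assoc (l u) (l t) _ ⟩
      l u ℕ.+ (l t ℕ.+ leavesF us)          ≡⟨ ≡.trans (leavesF-∷ u (t ∷ us)) (≡.cong (l u ℕ.+_) (leavesF-∷ t us)) ⟨
      leavesF (u ∷ t ∷ us)                  ∎
      where
      open ≡.≡-Reasoning
      l : RTree → ℕ
      l t = leavesF (t ∷ [])
    leavesF-↭ (Perm.trans p q) = ≡.trans (leavesF-↭ p) (leavesF-↭ q)

    branches-↭ : ∀ {ts us} → ts ↭ us → branches ts ≋ branches us
    branches-↭ Perm.refl = ⋆.refl
    branches-↭ (prep t p) = ⋆.∙-congˡ {edge (pairT t)} (branches-↭ p)
    branches-↭ (swap {ts} {us} t u p) = ⋆.trans (⋆.∙-congˡ {edge (pairT t)} (⋆.∙-congˡ {edge (pairT u)} (branches-↭ p)))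
      (⋆-solve 3 (λ t u B → t ⊕ (u ⊕ B) ⊜ u ⊕ (t ⊕ B)) ⋆.refl (edge (pairT t)) (edge (pairT u)) (branches us))
    branches-↭ (Perm.trans p q) = ⋆.trans (branches-↭ p) (branches-↭ q)

    record StrictF (ts : List RTree) : Set (c ⊔ ℓ) where
      field
        shape : ForestShape
        sizes≡ : sizes ts ≡ sizes (toForest shape)
        leaves≡ : leavesF ts ≡ leavesF (toForest shape)
        better : BetterF ts (toForest shape)

    StrictF-resp-↭ : ∀ {ts us} → us ↭ ts → StrictF ts → StrictF us
    StrictF-resp-↭ {ts} {us} p h = record
      { shape = shape ; sizes≡ = ≡.trans (sizes-↭ p) sizes≡ ; leaves≡ = ≡.trans (leavesF-↭ p) leaves≡
      ; better = λ X i → ≺-resp refl (·-cong (⋆.refl {X}) (⋆.∙-congˡ {vertex} (⋆.sym (branches-↭ p)))) (better X i) }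
      where open StrictF h

    StrictF-weaken : ∀ {ts us} → sizes ts ≡ sizes us → leavesF ts ≡ leavesF us → BetterF ts us → StrictF us → StrictF ts
    StrictF-weaken {ts} {us} e f h i = record
      { shape = shape ; sizes≡ = ≡.trans e sizes≡ ; leaves≡ = ≡.trans f leaves≡
      ; better = BetterF-trans {ts} {us} {toForest shape} h better }
      where open StrictF i

    record ReducesF (ts : List RTree) : Set (c ⊔ ℓ) where
      field
        shape : ForestShape
        sizes≡ : sizes ts ≡ sizes (toForest shape)
        leaves≡ : leavesF ts ≡ leavesF (toForest shape)
        improves : Improves ts (toForest shape)

    record Reduces (t : RTree) : Set (c ⊔ ℓ) where
      field
        shape : Shape
        size≡ : size t ≡ size (toTree shape)
        leaves≡ : leavesF (t ∷ []) ≡ leavesF (toTree shape ∷ [])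
        improves : t ≡ toTree shape ⊎ Better t (toTree shape)

    sizes-broom : ∀ k L → size (hang k (node (map pathTree L))) ≡ suc k ℕ.+ total L
    sizes-broom k L = ≡.trans (size-hang k _) (≡.trans (ℕ.+-suc k _) (≡.cong (λ u → suc (k ℕ.+ u)) (sizes-paths L)))

    leaves-broom : ∀ k a L → leavesF (hang k (node (map pathTree (a ∷ L))) ∷ []) ≡ length (a ∷ L)
    leaves-broom k a L = ≡.trans (leavesF-hang k (pathTree a) (map pathTree L)) (leavesF-paths (a ∷ L))

    broom-and-paths : ∀ k a b L n B → StrictF (toTree (broom k a b L) ∷ map pathTree (n ∷ B))
    broom-and-paths k a b L n B = record
      { shape = star a′ b′ L′
      ; sizes≡ = ≡.trans (≡.cong₂ ℕ._+_ (sizes-broom k (a ∷ b ∷ L)) (sizes-paths (n ∷ B)))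
          (≡.trans total≡ (≡.sym (sizes-paths (a′ ∷ b′ ∷ L′))))
      ; leaves≡ = ≡.trans (leavesF-∷ (toTree (broom k a b L)) (map pathTree (n ∷ B)))
          (≡.trans (≡.cong₂ ℕ._+_ (leaves-broom k a (b ∷ L)) (leavesF-paths (n ∷ B)))
            (≡.trans length≡ (≡.sym (leavesF-paths (a′ ∷ b′ ∷ L′)))))
      ; better = λ X h → ≺-resp
          (·-cong (⋆.refl {X}) (⋆.∙-congˡ {vertex} (⋆.sym (branches-paths (a′ ∷ b′ ∷ L′)))))
          (·-cong (⋆.refl {X}) (⋆.∙-congˡ {vertex} (⋆.sym (⋆.∙-cong (edge-cong (pairT-broom k (a ∷ b ∷ L))) (branches-paths (n ∷ B))))))
          (improves X h) }
      where open MergedStar (mergeStar k a b L n B)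


    -- The root owns no leg to compare with. In its stead the second broom, hung from the root,
    -- beats all legs no longer than its leg c, so the branches of the first can move to the root;
    -- this leaves one broom beside bare legs.
    two-brooms : ∀ k a b L l c d M → a ℕ.≤ c → StrictF (toTree (broom k a b L) ∷ toTree (broom l c d M) ∷ [])
    two-brooms k a b L l c d M a≤c = StrictF-weaken {s ∷ t ∷ []} {u}
      (≡.trans (≡.cong₂ ℕ._+_ (sizes-broom k (a ∷ b ∷ L)) (≡.cong (ℕ._+ 0) (sizes-broom l (c ∷ d ∷ M))))
        (≡.trans (+-*-Solver.solve 4 (λ k a A m → con 1 :+ k :+ (con 1 :+ a :+ A) :+ (m :+ con 0) := m :+ (con 1 :+ (a :+ (con 1 :+ k)) :+ A)) ≡.refl k a (total (b ∷ L)) (suc l ℕ.+ total (c ∷ d ∷ M)))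
          (≡.sym (≡.cong₂ ℕ._+_ (sizes-broom l (c ∷ d ∷ M)) (sizes-paths (a ℕ.+ suc k ∷ b ∷ L))))))
      (≡.trans (≡.trans (leavesF-∷ s (t ∷ [])) (≡.cong₂ ℕ._+_ (leaves-broom k a (b ∷ L)) ≡.refl))
        (≡.trans (ℕ.+-comm (length (a ∷ b ∷ L)) (leavesF (t ∷ [])))
          (≡.sym (≡.trans (leavesF-∷ t (map pathTree (a ℕ.+ suc k ∷ b ∷ L))) (≡.cong (leavesF (t ∷ []) ℕ.+_) (leavesF-paths (a ℕ.+ suc k ∷ b ∷ L)))))))
      better
      (broom-and-paths l c d M (a ℕ.+ suc k) (b ∷ L))
      where
      open +-*-Solver using (con; _:+_; _:=_)
      s = toTree (broom k a b L)
      t = toTree (broom l c d M)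
      u = t ∷ map pathTree (a ℕ.+ suc k ∷ b ∷ L)
      Y = edge (grow^ l (vertex ⋆ legs⁺ (c ∷ d ∷ M)))
      better : BetterF (s ∷ t ∷ []) u
      better X h = ≺-resp
        (·-cong (⋆.refl {X}) (⋆.∙-congˡ {vertex} (⋆.trans
          (⋆-solve 3 (λ l A Y → l ⊕ (A ⊕ Y) ⊜ Y ⊕ (l ⊕ A)) ⋆.refl (leg (suc a ℕ.+ suc k)) (legs⁺ (b ∷ L)) Y)
          (⋆.sym (⋆.∙-cong (edge-cong (pairT-broom l (c ∷ d ∷ M))) (branches-paths (a ℕ.+ suc k ∷ b ∷ L)))))))
        (·-cong (⋆.refl {X}) (⋆.∙-congˡ {vertex} (⋆.sym (⋆.∙-cong (edge-cong (pairT-broom k (a ∷ b ∷ L)))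
          (⋆.trans (⋆.identityʳ _) (edge-cong (pairT-broom l (c ∷ d ∷ M))))))))
        (push-root X Y k (suc a) (map suc (b ∷ L))
          (⊵-⋆-strict {X} {Y} {leg (suc a)} h (proj₂ (Pos-edge (Pos-grow^ l (Pos-⋆ (Pos-x , Pos-1) (Pos-legs c (map suc (d ∷ M)))))))
            (Pos-leg₂ (suc a)) (Dom-broom l (Dom-legs (suc c) (map suc (d ∷ M))) (suc a) (s≤s a≤c)))
          (proj₁ (Pos-legs b (map suc L))))

    strict : ∀ {ts} → StrictF ts → ReducesF ts
    strict h = record { shape = shape ; sizes≡ = sizes≡ ; leaves≡ = leaves≡ ; improves = inj₂ better }
      where open StrictF h

    already : ∀ fs → ReducesF (toForest fs)
    already fs = record { shape = fs ; sizes≡ = ≡.refl ; leaves≡ = ≡.refl ; improves = inj₁ ≡.refl }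

    combineShapes : ∀ s fs → ReducesF (toTree s ∷ toForest fs)
    combineShapes (bare n) (single (bare m)) = already (star n m [])
    combineShapes (bare n) (single (broom k a b L)) =
      strict (StrictF-resp-↭ (swap _ _ ↭-refl) (broom-and-paths k a b L n []))
    combineShapes (bare n) (star a b L) = already (star n a (b ∷ L))
    combineShapes (broom k a b L) (single (bare n)) = strict (broom-and-paths k a b L n [])
    combineShapes (broom k a b L) (star n m M) = strict (broom-and-paths k a b L n (m ∷ M))
    combineShapes (broom k a b L) (single (broom l c d M)) with ℕ.≤-total a c
    ... | inj₁ a≤c = strict (two-brooms k a b L l c d M a≤c)
    ... | inj₂ c≤a = strict (StrictF-resp-↭ (swap _ _ ↭-refl) (two-brooms l c d M k a b L c≤a))

    ReducesF-weaken : ∀ {ts us} → sizes ts ≡ sizes us → leavesF ts ≡ leavesF us → Improves ts us → ReducesF us → ReducesF ts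
    ReducesF-weaken e f h i = record
      { shape = shape ; sizes≡ = ≡.trans e sizes≡ ; leaves≡ = ≡.trans f leaves≡ ; improves = Improves-trans h improves }
      where open ReducesF i

    mutual
      reduce : ∀ t → Reduces t
      reduce (node []) = record { shape = bare 0 ; size≡ = ≡.refl ; leaves≡ = ≡.refl ; improves = inj₁ ≡.refl }
      reduce (node (t ∷ ts)) with reduceF t ts
      ... | record { shape = single (bare n) ; sizes≡ = e ; leaves≡ = f ; improves = i } = record
        { shape = bare (suc n) ; size≡ = ≡.cong suc e ; leaves≡ = ≡.cong (ℕ._+ 0) f ; improves = wrap i }
      ... | record { shape = single (broom k a b L) ; sizes≡ = e ; leaves≡ = f ; improves = i } = record
        { shape = broom (suc k) a b L ; size≡ = ≡.cong suc e ; leaves≡ = ≡.cong (ℕ._+ 0) f ; improves = wrap i }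
      ... | record { shape = star a b L ; sizes≡ = e ; leaves≡ = f ; improves = i } = record
        { shape = broom 0 a b L ; size≡ = ≡.cong suc e ; leaves≡ = ≡.cong (ℕ._+ 0) f ; improves = wrap i }

      wrap : ∀ {ts us} → Improves ts us → node ts ≡ node us ⊎ Better (node ts) (node us)
      wrap (inj₁ e) = inj₁ (≡.cong node e)
      wrap (inj₂ h) = inj₂ h

      reduceF : ∀ t ts → ReducesF (t ∷ ts)
      reduceF t [] = record
        { shape = single shape ; sizes≡ = ≡.cong (ℕ._+ 0) size≡ ; leaves≡ = leaves≡ ; improves = head improves }
        where
        open Reduces (reduce t)
        head : t ≡ toTree shape ⊎ Better t (toTree shape) → Improves (t ∷ []) (toTree shape ∷ [])
        head (inj₁ e) = inj₁ (≡.cong (_∷ []) e)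
        head (inj₂ h) = inj₂ (BetterF-head {t} {toTree shape} [] h)
      reduceF t (u ∷ us) = ReducesF-weaken {t ∷ u ∷ us} {toTree s ∷ u ∷ us}
        (≡.cong (ℕ._+ sizes (u ∷ us)) (Reduces.size≡ r))
        (≡.trans (leavesF-∷ t (u ∷ us)) (≡.trans (≡.cong (ℕ._+ leavesF (u ∷ us)) (Reduces.leaves≡ r)) (≡.sym (leavesF-∷ (toTree s) (u ∷ us)))))
        (head (Reduces.improves r))
        (ReducesF-weaken {toTree s ∷ u ∷ us} {toTree s ∷ toForest fs}
          (≡.cong (size (toTree s) ℕ.+_) (ReducesF.sizes≡ rs))
          (≡.trans (leavesF-∷ (toTree s) (u ∷ us)) (≡.trans (≡.cong (leavesF (toTree s ∷ []) ℕ.+_) (ReducesF.leaves≡ rs)) (≡.sym (leavesF-∷ (toTree s) (toForest fs)))))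
          (tail (ReducesF.improves rs))
          (combineShapes s fs))
        where
        r = reduce t
        s = Reduces.shape r
        rs = reduceF u us
        fs = ReducesF.shape rs
        head : t ≡ toTree s ⊎ Better t (toTree s) → Improves (t ∷ u ∷ us) (toTree s ∷ u ∷ us)
        head (inj₁ e) = inj₁ (≡.cong (_∷ u ∷ us) e)
        head (inj₂ h) = inj₂ (BetterF-head {t} {toTree s} (u ∷ us) h)
        tail : Improves (u ∷ us) (toForest fs) → Improves (toTree s ∷ u ∷ us) (toTree s ∷ toForest fs)
        tail (inj₁ e) = inj₁ (≡.cong (toTree s ∷_) e)
        tail (inj₂ h) = inj₂ (BetterF-tail (toTree s) {u ∷ us} {toForest fs} h)

    legs⁺-↭ : ∀ {L M} → L ↭ M → legs⁺ L ≋ legs⁺ M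
    legs⁺-↭ {L} {M} p = ⋆.trans (⋆.sym (branches-paths L)) (⋆.trans (branches-↭ (map⁺ pathTree p)) (branches-paths M))

    Lighter : List ℕ → List ℕ → Set (c ⊔ ℓ)
    Lighter L M = ∀ X → Pos² X → X · (vertex ⋆ legs⁺ M) ≺ X · (vertex ⋆ legs⁺ L)

    record Balances (L : List ℕ) (N l : ℕ) : Set (c ⊔ ℓ) where
      field
        total≡ : total (balanced N l) ≡ N
        length≡ : length (balanced N l) ≡ suc l
        lighter : L ↭ balanced N l ⊎ Lighter L (balanced N l)

    -- The recursion runs on n, a strict bound for the square sum, which each transfer of a vertex
    -- decreases.
    balance : ∀ n L N l → square-sum L ℕ.< n → total L ≡ N → length L ≡ suc l → Balances L N l
    balance (suc n) (a ∷ L) N l (s≤s h) ht hl with extract-min a L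
    ... | m , R , p , m≤R with find-excess m R m≤R
    ... | inj₁ (c′ , R′ , p′ , m<c) = record
      { total≡ = total≡ ; length≡ = length≡ ; lighter = inj₂ (extend lighter) }
      where
      q : a ∷ L ↭ m ∷ suc c′ ∷ R′
      q = ↭-trans p (prep m p′)
      M = suc m ∷ c′ ∷ R′
      open Balances (balance n M N l
        (ℕ.<-≤-trans (square-sum-step R′ m<c) (≡.subst (ℕ._≤ n) (square-sum-↭ q) h))
        (≡.trans (≡.cong suc (≡.trans (ℕ.+-assoc 1 m (suc c′ ℕ.+ total R′)) (≡.sym (ℕ.+-suc m _)))) (≡.trans (≡.sym (total-↭ q)) ht))
        (≡.trans (≡.sym (↭-length q)) hl))
      step : Lighter (a ∷ L) M
      step X i = ≺-resp refl (·-cong (⋆.refl {X}) (⋆.∙-congˡ {vertex} (⋆.sym (legs⁺-↭ q))))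
        (balance-step X (legs⁺ R′) (suc m) (suc c′) (proj₁ (Pos-⋆ʳ {X} i (Pos-legs₂ (map suc R′)))) (s≤s m<c))
      extend : M ↭ balanced N l ⊎ Lighter M (balanced N l) → Lighter (a ∷ L) (balanced N l)
      extend (inj₁ e) X i = ≺-resp (·-cong (⋆.refl {X}) (⋆.∙-congˡ {vertex} (legs⁺-↭ e))) refl (step X i)
      extend (inj₂ e) X i = ≺-≼-trans (e X i) (≺⇒≼ (step X i))
    ... | inj₂ (i , j , p′) = record
      { total≡ = ≡.trans (≡.sym (total-↭ q)) ht ; length≡ = ≡.trans (≡.sym (↭-length q)) hl ; lighter = inj₁ q }
      where
      p″ : a ∷ L ↭ replicate i (suc m) ++ replicate (suc j) m
      p″ = ↭-trans p (↭-trans (prep m p′) (↭-sym (shift m (replicate i (suc m)) (replicate j m))))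
      length-R : i ℕ.+ suc j ≡ suc l
      length-R = ≡.trans (≡.sym (≡.trans (↭-length p″) (≡.trans (length-++ (replicate i (suc m)))
        (≡.cong₂ ℕ._+_ (length-replicate i) (length-replicate (suc j)))))) hl
      total-R : i ℕ.+ suc m ℕ.* suc l ≡ N
      total-R = begin
        i ℕ.+ suc m ℕ.* suc l                              ≡⟨ ≡.cong (λ u → i ℕ.+ suc m ℕ.* u) length-R ⟨
        i ℕ.+ suc m ℕ.* (i ℕ.+ suc j)
          ≡⟨ solve 3 (λ i j m → i :+ (con 1 :+ m) :* (i :+ (con 1 :+ j)) := i :* (con 2 :+ m) :+ (con 1 :+ j) :* (con 1 :+ m)) ≡.refl i j m ⟩
        i ℕ.* suc (suc m) ℕ.+ suc j ℕ.* suc m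
          ≡⟨ ≡.cong₂ ℕ._+_ (total-replicate i (suc m)) (total-replicate (suc j) m) ⟨
        total (replicate i (suc m)) ℕ.+ total (replicate (suc j) m) ≡⟨ total-++ (replicate i (suc m)) (replicate (suc j) m) ⟨
        total (replicate i (suc m) ++ replicate (suc j) m) ≡⟨ total-↭ p″ ⟨
        total (a ∷ L)                                      ≡⟨ ht ⟩
        N                                                  ∎
        where
        open ≡.≡-Reasoning
        open +-*-Solver
      q : a ∷ L ↭ balanced N l
      q = ≡.subst (a ∷ L ↭_) (two-valued-balanced i j m length-R total-R) p″

    -- Besides the improved shape this keeps what the cycle argument needs when the centre is off
    -- the root: `collapses` tells which contexts allow the centre to move to the root, `dominates`
    -- which paths the tree itself beats. Both are measured by `a`, which will be a longest leg of
    -- the balanced star, with a + 1 vertices.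
    record Normalised (t : RTree) : Set (c ⊔ ℓ) where
      B : ℕ → RTree
      B = Btree (size t) (treeLeaves t)
      field
        p : ℕ
        p≥1 : 1 ℕ.≤ p
        bound : p ℕ.+ treeLeaves t ℕ.≤ size t
        improves : Similar t (B p) ⊎ Better t (B p)
        a : ℕ
        collapses : p ≢ 1 → ∀ X → Pos² X → X ▷ leg (suc a) → X · pairT (B 1) ≺ X · pairT (B p)
        dominates : p ≢ 1 → ∀ m → m ℕ.≤ suc a → pairT (B p) ▷ PairAlgebra.path K S m

    ▷-grow : ∀ {n p} → Pos² p → (∀ m → m ℕ.≤ n → p ▷ PairAlgebra.path K S m) → ∀ m → m ℕ.≤ n → grow p ▷ PairAlgebra.path K S m
    ▷-grow {p = p} h i zero _ = ▷-free {grow p} (proj₁ (Pos-grow (proj₂ h)))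
    ▷-grow {p = p} h i (suc m) m<n = ▷-vertex {edge p} {leg m} (▷-edge {p} {PairAlgebra.path K S m} (i m (ℕ.<⇒≤ m<n)))

    ▷-grow^ : ∀ k {n p} → Pos² p → (∀ m → m ℕ.≤ n → p ▷ PairAlgebra.path K S m) → ∀ m → m ℕ.≤ n → grow^ k p ▷ PairAlgebra.path K S m
    ▷-grow^ zero h i = i
    ▷-grow^ (suc k) {p = p} h i = ▷-grow (Pos-grow^ k h) (▷-grow^ k h i)

    -- At the centre the leg a alone reaches the bound, and the second leg makes it strict. Each
    -- vertex in front raises the beaten length by one, so the bound survives.
    dominate-broom : ∀ k a b R m → m ℕ.≤ suc a → pairT (hang k (node (map pathTree (a ∷ b ∷ R)))) ▷ PairAlgebra.path K S m
    dominate-broom k a b R m m≤a =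
      ▷-resp (⋆.sym (pairT-broom k (a ∷ b ∷ R))) (▷-grow^ k Pos-star star▷ m m≤a)
      where
      A = map suc (b ∷ R)
      Pos-star : Pos² (vertex ⋆ legs⁺ (a ∷ b ∷ R))
      Pos-star = Pos-⋆ (Pos-x , Pos-1) (Pos-legs a A)
      star▷ : ∀ m → m ℕ.≤ suc a → vertex ⋆ legs⁺ (a ∷ b ∷ R) ▷ PairAlgebra.path K S m
      star▷ zero _ = ▷-free {vertex ⋆ legs⁺ (a ∷ b ∷ R)} (proj₁ Pos-star)
      star▷ (suc m) m<a = ▷-vertex {legs⁺ (a ∷ b ∷ R)} {leg m} (▷-resp (⋆.comm (legs A) (leg (suc a)))
        (⊵-⋆-strict {legs A} {leg (suc a)} {leg m} (Pos-legs b (map suc R)) (Pos-leg₂ (suc a)) (Pos-leg₂ m) (leg-⊵ (ℕ.<⇒≤ m<a))))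

    -- All legs but a move back to the root, where a reappears lengthened by the k + 1 edges;
    -- balancing then gives the tree for p = 1. The move is already strict, so balancing may leave
    -- the value unchanged.
    collapse-broom : ∀ k a b R {N l} → total (a ∷ b ∷ R) ≡ N → length (a ∷ b ∷ R) ≡ suc l →
      ∀ X → Pos² X → X ▷ leg (suc a) →
      X · pairT (node (map pathTree (balanced (suc k ℕ.+ N) l))) ≺ X · pairT (hang (suc k) (node (map pathTree (a ∷ b ∷ R))))
    collapse-broom k a b R {N} {l} ht hl X h X▷ = ≼-≺-trans (weak (Balances.lighter bal)) (≺-resp
      (·-cong (⋆.refl {X}) (⋆.∙-congˡ {vertex} (⋆.∙-congˡ {leg (suc a ℕ.+ suc k)} (⋆.identityʳ (legs A)))))
      (·-cong (⋆.refl {X}) (⋆.trans (⋆.∙-congˡ {vertex} (⋆.identityʳ _)) (⋆.sym (pairT-broom (suc k) (a ∷ b ∷ R)))))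
      (push-root X free k (suc a) A (▷-resp (⋆.sym (⋆.identityʳ X)) X▷) (proj₁ (Pos-legs b (map suc R)))))
      where
      A = map suc (b ∷ R)
      L = a ℕ.+ suc k ∷ b ∷ R
      bal = balance _ L (suc k ℕ.+ N) l ℕ.≤-refl
        (≡.trans (solve 3 (λ a k t → con 1 :+ (a :+ (con 1 :+ k)) :+ t := con 1 :+ k :+ (con 1 :+ a :+ t)) ≡.refl a k (total (b ∷ R))) (≡.cong (suc k ℕ.+_) ht))
        hl
        where open +-*-Solver
      weak : L ↭ balanced (suc k ℕ.+ N) l ⊎ Lighter L (balanced (suc k ℕ.+ N) l) →
        X · pairT (node (map pathTree (balanced (suc k ℕ.+ N) l))) ≼ X · (vertex ⋆ legs⁺ L)
      weak (inj₁ e) = ≼-reflexive (·-cong (⋆.refl {X}) (⋆.∙-congˡ {vertex} (⋆.trans (branches-paths (balanced (suc k ℕ.+ N) l)) (⋆.sym (legs⁺-↭ {L} {balanced (suc k ℕ.+ N) l} e)))))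
      weak (inj₂ e) = ≼-trans (≼-reflexive (·-cong (⋆.refl {X}) (⋆.∙-congˡ {vertex} (branches-paths (balanced (suc k ℕ.+ N) l))))) (≺⇒≼ (e X h))

    length≤total : ∀ L → length L ℕ.≤ total L
    length≤total [] = z≤n
    length≤total (a ∷ L) = s≤s (ℕ.≤-trans (length≤total L) (ℕ.m≤n+m _ a))

    -- The alternative `k ≡ 0 ⊎ 1 ℕ.≤ l` says that a centre off the root has at least two legs, as
    -- both domination and collapse require.
    normalise-balanced : ∀ t k l N M → balanced N l ≡ M → size t ≡ suc k ℕ.+ N → treeLeaves t ≡ suc l →
      total M ≡ N → length M ≡ suc l → k ≡ 0 ⊎ 1 ℕ.≤ l →
      Similar t (hang k (node (map pathTree M))) ⊎ Better t (hang k (node (map pathTree M))) → Normalised t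
    normalise-balanced t k l N M eq hs hl ht hM side h = record
      { p = suc k ; p≥1 = s≤s z≤n
      ; bound = ≡.subst₂ ℕ._≤_ (≡.cong (suc k ℕ.+_) (≡.trans hM (≡.sym hl))) (≡.trans (≡.cong (suc k ℕ.+_) ht) (≡.sym hs))
          (ℕ.+-monoʳ-≤ (suc k) (length≤total M))
      ; improves = ≡.subst (λ u → Similar t u ⊎ Better t u) (≡.sym B-p) h
      ; a = head M
      ; collapses = λ p≢1 X i j → ≺-resp (·-cong (⋆.refl {X}) (pairT-≡ (≡.sym B-1))) (·-cong (⋆.refl {X}) (pairT-≡ (≡.sym B-p)))
          (collapse k M side p≢1 ht hM X i j)
      ; dominates = λ p≢1 m m≤a → ▷-resp (pairT-≡ (≡.sym B-p)) (dominate M side p≢1 hM m m≤a) }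
      where
      head : List ℕ → ℕ
      head [] = 0
      head (a ∷ _) = a
      pairT-≡ : ∀ {t u} → t ≡ u → pairT t ≋ pairT u
      pairT-≡ ≡.refl = ⋆.refl
      B : ℕ → RTree
      B = Btree (size t) (treeLeaves t)
      B-at : ∀ p → B p ≡ Btree (suc k ℕ.+ N) (suc l) p
      B-at p = ≡.cong₂ (λ n l → Btree n l p) hs hl
      B-p : B (suc k) ≡ hang k (node (map pathTree M))
      B-p = ≡.trans (B-at (suc k)) (≡.trans
        (Btree-broom (suc k ℕ.+ N) l k (≡.trans (ℕ.m+n∸n≡m (suc k ℕ.+ N ℕ.∸ suc k) 1) (ℕ.m+n∸m≡n (suc k) N)))
        (≡.cong (λ M → hang k (node (map pathTree M))) eq))
      B-1 : B 1 ≡ node (map pathTree (balanced (k ℕ.+ N) l))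
      B-1 = ≡.trans (B-at 1) (Btree-broom (suc k ℕ.+ N) l 0 (ℕ.m+n∸n≡m (k ℕ.+ N) 1))

      dominate : ∀ M → k ≡ 0 ⊎ 1 ℕ.≤ l → suc k ≢ 1 → length M ≡ suc l →
        ∀ m → m ℕ.≤ suc (head M) → pairT (hang k (node (map pathTree M))) ▷ PairAlgebra.path K S m
      dominate _ (inj₁ ≡.refl) p≢1 _ = contradiction ≡.refl p≢1
      dominate (a ∷ []) (inj₂ (s≤s z≤n)) _ ()
      dominate (a ∷ b ∷ R) (inj₂ _) _ _ = dominate-broom k a b R

      collapse : ∀ k M → k ≡ 0 ⊎ 1 ℕ.≤ l → suc k ≢ 1 → total M ≡ N → length M ≡ suc l →
        ∀ X → Pos² X → X ▷ leg (suc (head M)) →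
        X · pairT (node (map pathTree (balanced (k ℕ.+ N) l))) ≺ X · pairT (hang k (node (map pathTree M)))
      collapse zero _ _ p≢1 _ _ = contradiction ≡.refl p≢1
      collapse (suc k) (a ∷ []) (inj₂ (s≤s z≤n)) _ _ ()
      collapse (suc k) (a ∷ b ∷ R) (inj₂ _) _ ht hl = collapse-broom k a b R ht hl

    normalise-broom : ∀ t k a L → t ≡ hang k (node (map pathTree (a ∷ L))) ⊎ Better t (hang k (node (map pathTree (a ∷ L)))) →
      size t ≡ suc k ℕ.+ total (a ∷ L) → treeLeaves t ≡ length (a ∷ L) → k ≡ 0 ⊎ 1 ℕ.≤ length L → Normalised t
    normalise-broom t k a L h hs hl side =
      normalise-balanced t k (length L) (total (a ∷ L)) M ≡.refl hs hl total≡ length≡ side (improve h lighter)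
      where
      M = balanced (total (a ∷ L)) (length L)
      open Balances (balance _ (a ∷ L) (total (a ∷ L)) (length L) ℕ.≤-refl ≡.refl ≡.refl)
      T : List ℕ → RTree
      T L = hang k (node (map pathTree L))
      -- Moving the path into the context reduces the claim to balancing legs at the centre.
      value : ∀ X L → X · pairT (T L) ≈ pull k X · (vertex ⋆ legs⁺ L)
      value X L = trans (·-cong (⋆.refl {X}) (pairT-broom k L)) (·-pull k X (vertex ⋆ legs⁺ L))
      lift : Lighter (a ∷ L) M → Better (T (a ∷ L)) (T M)
      lift e X i = ≺-resp (sym (value X M)) (sym (value X (a ∷ L))) (e (pull k X) (Pos-pull k i))
      same : a ∷ L ↭ M → ∀ X → X · pairT (T (a ∷ L)) ≈ X · pairT (T M)
      same e X = trans (value X (a ∷ L)) (trans (·-cong (⋆.refl {pull k X}) (⋆.∙-congˡ {vertex} (legs⁺-↭ e))) (sym (value X M)))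
      improve : t ≡ T (a ∷ L) ⊎ Better t (T (a ∷ L)) → a ∷ L ↭ M ⊎ Lighter (a ∷ L) M → Similar t (T M) ⊎ Better t (T M)
      improve (inj₁ e) (inj₁ p) = inj₁ (similar k p e ≡.refl)
      improve (inj₁ ≡.refl) (inj₂ i) = inj₂ (lift i)
      improve (inj₂ h) (inj₁ p) = inj₂ λ X i → ≺-resp (same p X) refl (h X i)
      improve (inj₂ h) (inj₂ i) = inj₂ λ X j → ≺-≼-trans (lift i X j) (≺⇒≼ (h X j))

    normalise : ∀ t → Normalised t
    normalise (node []) = record
      { p = 1 ; p≥1 = s≤s z≤n ; bound = s≤s z≤n ; improves = inj₁ (similar 0 {[]} {[]} ↭-refl ≡.refl ≡.refl) ; a = 0
      ; collapses = λ h → contradiction ≡.refl h ; dominates = λ h → contradiction ≡.refl h }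
    normalise t@(node (c ∷ cs)) with reduce t
    ... | record { shape = bare zero ; size≡ = e } = contradiction e (not-one c)
      where
      not-one : ∀ c → suc (size c ℕ.+ sizes cs) ≢ 1
      not-one (node _) ()
    -- A path counts as a star at the root with a single leg, so that p = 1.
    ... | record { shape = bare (suc n) ; size≡ = e ; leaves≡ = f ; improves = h } =
      normalise-broom t 0 n [] h (≡.trans e (sizes-broom 0 (n ∷ [])))
        (≡.trans (≡.trans (≡.sym (ℕ.+-identityʳ _)) f) (leavesF-path (suc n))) (inj₁ ≡.refl)
    ... | record { shape = broom k a b L ; size≡ = e ; leaves≡ = f ; improves = h } =
      normalise-broom t k a (b ∷ L) h (≡.trans e (sizes-broom k (a ∷ b ∷ L)))
        (≡.trans (≡.trans (≡.sym (ℕ.+-identityʳ _)) f) (leaves-broom k a (b ∷ L))) (inj₂ (s≤s z≤n))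

-- Replacing the trees along the cycle.

module CycleReduction where
  open import Defs
  open RootedPairs
  open TreeReduction
  open EdgeLaplacians using (choose)
  open import Algebra.Bundles using (CommutativeSemiring)
  open import Data.Fin as Fin using (Fin; zero; suc)
  import Data.Fin.Properties as Fin
  open import Data.List using (List; []; _∷_; _++_; map; allFin; length)
  open import Data.List.Membership.Propositional using (_∈_)
  open import Data.List.Membership.Propositional.Properties using (∈-allFin; ∈-∃++; ∈-++⁺ˡ; ∈-++⁺ʳ; ∈-++⁻)
  open import Data.List.Properties using (map-++; ++-assoc; length-++; length-tabulate)
  open import Data.List.Relation.Unary.All as All using (All; []; _∷_)
  open import Data.List.Relation.Unary.All.Properties using (++⁺; map⁺)
  open import Data.List.Relation.Unary.Any using (here; there)
  open import Data.Nat as ℕ using (ℕ; zero; suc; s≤s)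
  import Data.Nat.Properties as ℕ
  open import Data.Product using (Σ; _×_; _,_; proj₁; proj₂)
  open import Data.Sum using (_⊎_; inj₁; inj₂)
  open import Level using (_⊔_)
  open import Relation.Nullary using (yes; no; contradiction; Dec)
  open import Relation.Binary.PropositionalEquality as ≡ using (_≡_; _≢_)
  open import Data.List.Relation.Binary.Permutation.Propositional using (_↭_)
  import Data.List.Relation.Binary.Permutation.Propositional.Properties as ↭

  argmax : ∀ {g} (f : Fin (suc g) → ℕ) → Σ (Fin (suc g)) λ j → ∀ i → f i ℕ.≤ f j
  argmax {zero} f = zero , λ { zero → ℕ.≤-refl }
  argmax {suc g} f with argmax (λ i → f (suc i))
  ... | j , h with ℕ.≤-total (f zero) (f (suc j))
  ... | inj₁ le = suc j , λ { zero → le ; (suc i) → h i }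
  ... | inj₂ ge = zero , λ { zero → ℕ.≤-refl ; (suc i) → ℕ.≤-trans (h i) ge }

  module CycleImprovement {c ℓ} (K : CommutativeSemiring c ℓ) (S : PositivityStructure K) where
    open CommutativeSemiring K using (_≈_; refl; sym; trans; reflexive)
    open PositivityStructure S
    open PairAlgebra K S
    open TreePairs K S

    pairT-Similar : ∀ {t u} → Similar t u → pairT t ≋ pairT u
    pairT-Similar (similar k {L} {M} p ≡.refl ≡.refl) =
      ⋆.trans (pairT-hang k (node (map pathTree L))) (⋆.trans (grow^-cong k (⋆.∙-congˡ {vertex} (branches-↭ (↭.map⁺ pathTree p))))
        (⋆.sym (pairT-hang k (node (map pathTree M)))))

    Pos-pairs : ∀ {a} {A : Set a} (f : A → RTree) is → All Pos² (map (λ i → pairT (f i)) is)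
    Pos-pairs f [] = []
    Pos-pairs f (i ∷ is) = Pos-pairT (f i) ∷ Pos-pairs f is

    Rooted-pairs : ∀ {a} {A : Set a} (f : A → RTree) is → All Rooted (map (λ i → pairT (f i)) is)
    Rooted-pairs f [] = []
    Rooted-pairs f (i ∷ is) = Rooted-pairT (f i) ∷ Rooted-pairs f is

    -- P is the condition on the context under which the replacement is known to help: positivity
    -- for the distinguished tree, and domination of legs as well for the others.
    replace-in-cycle : ∀ {q} (P : Pair → Set q) us {t t′} vs → P (context (chain (vs ++ us))) →
      Similar t t′ ⊎ (∀ X → P X → X · pairT t′ ≺ X · pairT t) →
      (Similar t t′ × cycle (us ++ pairT t′ ∷ vs) ≈ cycle (us ++ pairT t ∷ vs)) ⊎
      cycle (us ++ pairT t′ ∷ vs) ≺ cycle (us ++ pairT t ∷ vs)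
    replace-in-cycle P us {t} {t′} vs h (inj₁ s) = inj₁ (s ,
      trans (cycle-context-at us (pairT t′) vs)
        (trans (·-cong (⋆.refl {context (chain (vs ++ us))}) (⋆.sym (pairT-Similar s))) (sym (cycle-context-at us (pairT t) vs))))
    replace-in-cycle P us {t} {t′} vs h (inj₂ b) = inj₂
      (≺-resp (sym (cycle-context-at us (pairT t′) vs)) (sym (cycle-context-at us (pairT t) vs)) (b _ h))

    module Replacement {g} (t u : Fin g → RTree) where
      T U : Fin g → Pair
      T i = pairT (t i)
      U i = pairT (u i)

      -- One strict replacement makes the whole comparison strict. Failing that, all replaced trees
      -- were similar to their final forms, which is the information behind the equality case.
      data Outcome (is : List (Fin g)) (new old : List Pair) : Set (c ⊔ ℓ) where
        same : (∀ i → i ∈ is → Similar (t i) (u i)) → cycle new ≈ cycle old → Outcome is new old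
        less : cycle new ≺ cycle old → Outcome is new old

      Outcome-trans : ∀ is js {new mid old} → Outcome is mid old → Outcome js new mid → Outcome (is ++ js) new old
      Outcome-trans is js (same s e) (same s′ e′) = same both (trans e′ e)
        where
        both : ∀ i → i ∈ is ++ js → Similar (t i) (u i)
        both i h with ∈-++⁻ is h
        ... | inj₁ h′ = s i h′
        ... | inj₂ h′ = s′ i h′
      Outcome-trans is js (same _ e) (less h) = less (≺-resp refl e h)
      Outcome-trans is js (less h) (same _ e) = less (≺-resp (sym e) refl h)
      Outcome-trans is js (less h) (less h′) = less (≺-≼-trans h′ (≺⇒≼ h))

      Outcome-≈ : ∀ {is new new′ old old′} → cycle new ≈ cycle new′ → cycle old ≈ cycle old′ → Outcome is new old → Outcome is new′ old′
      Outcome-≈ e f (same s h) = same s (trans (sym e) (trans h f))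
      Outcome-≈ e f (less h) = less (≺-resp e f h)

      singleton : ∀ i new old → (Similar (t i) (u i) × cycle new ≈ cycle old) ⊎ cycle new ≺ cycle old → Outcome (i ∷ []) new old
      singleton i _ _ (inj₁ (s , e)) = same (λ { _ (here ≡.refl) → s }) e
      singleton i _ _ (inj₂ h) = less h

      module _ (j : Fin g) (Dominated : Set) (n : ℕ)
        (J▷ : Dominated → ∀ m → m ℕ.≤ n → U j ▷ path m)
        (rel : ∀ i → Similar (t i) (u i) ⊎ (∀ X → Pos² X × (Dominated → ∀ m → m ℕ.≤ n → X ▷ leg m) → X · U i ≺ X · T i))
        (rel-j : Similar (t j) (u j) ⊎ (∀ X → Pos² X → X · U j ≺ X · T j))
        where

        -- Every context contains the tree at j in its final form, whence the domination hypothesis.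
        replace-others : ∀ (done : List (Fin g)) rest → Outcome rest (U j ∷ map U done ++ map U rest) (U j ∷ map U done ++ map T rest)
        replace-others done [] = same (λ _ ()) refl
        replace-others done (i ∷ rest) = Outcome-trans (i ∷ []) rest {mid = U j ∷ map U done ++ U i ∷ map T rest} step
          (Outcome-≈ {rest} (reflexive (≡.cong cycle (shuffle (map U rest)))) (reflexive (≡.cong cycle (shuffle (map T rest)))) (replace-others (done ++ i ∷ []) rest))
          where
          shuffle : ∀ vs → U j ∷ map U (done ++ i ∷ []) ++ vs ≡ U j ∷ map U done ++ U i ∷ vs
          shuffle vs = ≡.cong (U j ∷_) (≡.trans (≡.cong (_++ vs) (map-++ U done (i ∷ []))) (++-assoc (map U done) (U i ∷ []) vs))
          ctx = context (chain (map T rest ++ U j ∷ map U done))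
          Pos-ctx : ∀ rest → Pos² (context (chain (map T rest ++ U j ∷ map U done)))
          Pos-ctx [] = Pos-context (Pos-pairT (u j) ∷ Pos-pairs u done)
          Pos-ctx (i ∷ rest) = Pos-context (++⁺ (Pos-pairs t (i ∷ rest)) (Pos-pairT (u j) ∷ Pos-pairs u done))
          beats : Dominated → ∀ m → m ℕ.≤ n → ctx ▷ leg m
          beats d m m≤n = context-▷ {m} {chain (map T rest ++ U j ∷ map U done)}
            (beats-chain (map T rest) (map U done) (J▷ d) (Pos-pairT (u j)) (Rooted-pairs t rest) (Pos-pairs u done) m m≤n)
          step : Outcome (i ∷ []) (U j ∷ map U done ++ U i ∷ map T rest) (U j ∷ map U done ++ T i ∷ map T rest)
          step = singleton i _ _ (replace-in-cycle (λ X → Pos² X × (Dominated → ∀ m → m ℕ.≤ n → X ▷ leg m)) (U j ∷ map U done) {t i} {u i} (map T rest)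
            (Pos-ctx rest , beats) (rel i))

        -- This happens while all other trees are still the original ones. Its context must be
        -- positive, which takes a second cycle vertex.
        replace-j : ∀ ls rs → 1 ℕ.≤ length (rs ++ ls) → Outcome (j ∷ []) (map T ls ++ U j ∷ map T rs) (map T ls ++ T j ∷ map T rs)
        replace-j ls rs h = singleton j _ _ (replace-in-cycle Pos² (map T ls) {t j} {u j} (map T rs)
          (≡.subst (λ vs → Pos² (context (chain vs))) (map-++ T rs ls) (Pos-ctx (rs ++ ls) h)) rel-j)
          where
          Pos-ctx : ∀ is → 1 ℕ.≤ length is → Pos² (context (chain (map T is)))
          Pos-ctx (i ∷ is) _ = Pos-context (Pos-pairs t (i ∷ is))

        replace-all : 2 ℕ.≤ g → ((∀ i → Similar (t i) (u i)) × cycle (map U (allFin g)) ≈ cycle (map T (allFin g))) ⊎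
          cycle (map U (allFin g)) ≺ cycle (map T (allFin g))
        replace-all 2≤g with ∈-∃++ (∈-allFin j)
        ... | ls , rs , eq = finish (Outcome-trans (j ∷ []) (rs ++ ls) {mid = map T ls ++ U j ∷ map T rs}
            (Outcome-≈ {j ∷ []} refl (reflexive (≡.cong cycle (≡.sym (mapped T)))) (replace-j ls rs enough))
            (Outcome-≈ {rs ++ ls} (trans (rotate U) (reflexive (≡.cong cycle (≡.sym (mapped U))))) (rotate T) (replace-others [] (rs ++ ls))))
          where
          mapped : ∀ V → map V (allFin g) ≡ map V ls ++ V j ∷ map V rs
          mapped V = ≡.trans (≡.cong (map V) eq) (map-++ V ls (j ∷ rs))
          rotate : ∀ V → cycle (U j ∷ map V (rs ++ ls)) ≈ cycle (map V ls ++ U j ∷ map V rs)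
          rotate V = trans (reflexive (≡.cong (λ vs → cycle (U j ∷ vs)) (map-++ V rs ls))) (cycle-rotate (U j ∷ map V rs) (map V ls))
          enough : 1 ℕ.≤ length (rs ++ ls)
          enough = ℕ.≤-pred (≡.subst (2 ℕ.≤_) (≡.trans (≡.sym (length-tabulate {n = g} (λ i → i))) (≡.trans (≡.cong length eq)
            (≡.trans (length-++ ls) (≡.trans (ℕ.+-comm (length ls) (suc (length rs))) (≡.cong suc (≡.sym (length-++ rs))))))) 2≤g)
          finish : Outcome (j ∷ rs ++ ls) (map U (allFin g)) (map T (allFin g)) →
            ((∀ i → Similar (t i) (u i)) × cycle (map U (allFin g)) ≈ cycle (map T (allFin g))) ⊎ cycle (map U (allFin g)) ≺ cycle (map T (allFin g))
          finish (less h) = inj₂ h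
          finish (same s e) = inj₁ ((λ i → s i (locate i)) , e)
            where
            locate : ∀ i → i ∈ j ∷ rs ++ ls
            locate i with ∈-++⁻ ls (≡.subst (i ∈_) eq (∈-allFin i))
            ... | inj₁ h = there (∈-++⁺ʳ rs h)
            ... | inj₂ (here e) = here e
            ... | inj₂ (there h) = there (∈-++⁺ˡ h)

    record Optimum {g} (t : Fin g → RTree) : Set (c ⊔ ℓ) where
      field p : Fin g → ℕ
      B : Fin g → RTree
      B i = Btree (size (t i)) (treeLeaves (t i)) (p i)
      field
        p≥1 : ∀ i → 1 ℕ.≤ p i
        bound : ∀ i → p i ℕ.+ treeLeaves (t i) ℕ.≤ size (t i)
        at-most-one : ∀ i j → p i ≢ 1 → p j ≢ 1 → i ≡ j
        outcome : ((∀ i → Similar (t i) (B i)) × cycle (map (λ i → pairT (B i)) (allFin g)) ≈ cycle (map (λ i → pairT (t i)) (allFin g))) ⊎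
          cycle (map (λ i → pairT (B i)) (allFin g)) ≺ cycle (map (λ i → pairT (t i)) (allFin g))

    optimum : ∀ {g} → 2 ℕ.≤ g → (t : Fin g → RTree) → Optimum t
    optimum {suc g} 2≤g t = record
      { p = p ; p≥1 = p≥1 ; bound = bound ; at-most-one = at-most-one
      ; outcome = Replacement.replace-all t B j (N.p j ≢ 1) (suc (N.a j)) J▷ rel rel-j 2≤g }
      where
      module N (i : Fin (suc g)) = Normalised (normalise (t i))
      -- Among the trees whose centre is off the cycle, the one with the longest legs keeps its shape.
      key : Fin (suc g) → ℕ
      key i = choose (N.p i ℕ.≟ 1) 0 (suc (N.a i))
      j = proj₁ (argmax key)
      p : Fin (suc g) → ℕ
      p i = choose (i Fin.≟ j) (N.p i) 1
      B : Fin (suc g) → RTree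
      B i = Btree (size (t i)) (treeLeaves (t i)) (p i)
      pj : p j ≡ N.p j
      pj with j Fin.≟ j
      ... | yes _ = ≡.refl
      ... | no ¬e = contradiction ≡.refl ¬e
      -- The successor in `key` separates centres off the cycle from the value 0 of the rest: as
      -- soon as one exists the maximum is positive, so j is one of them.
      dominated : ∀ i → N.p i ≢ 1 → N.p j ≢ 1 × N.a i ℕ.≤ N.a j
      dominated i p≢1 = go (N.p j ℕ.≟ 1) (N.p i ℕ.≟ 1) (proj₂ (argmax key) i)
        where
        go : ∀ (dj : Dec (N.p j ≡ 1)) (di : Dec (N.p i ≡ 1)) → choose di 0 (suc (N.a i)) ℕ.≤ choose dj 0 (suc (N.a j)) → N.p j ≢ 1 × N.a i ℕ.≤ N.a j
        go _ (yes e) _ = contradiction e p≢1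
        go (no ¬e) (no _) (s≤s h) = ¬e , h
      p≥1 : ∀ i → 1 ℕ.≤ p i
      p≥1 i with i Fin.≟ j
      ... | yes _ = N.p≥1 i
      ... | no _ = ℕ.≤-refl
      bound : ∀ i → p i ℕ.+ treeLeaves (t i) ℕ.≤ size (t i)
      bound i with i Fin.≟ j
      ... | yes _ = N.bound i
      ... | no _ = ℕ.≤-trans (ℕ.+-monoˡ-≤ (treeLeaves (t i)) (N.p≥1 i)) (N.bound i)
      at-most-one : ∀ i i′ → p i ≢ 1 → p i′ ≢ 1 → i ≡ i′
      at-most-one i i′ h h′ with i Fin.≟ j | i′ Fin.≟ j
      ... | yes ≡.refl | yes ≡.refl = ≡.refl
      ... | no _ | _ = contradiction ≡.refl h
      ... | yes _ | no _ = contradiction ≡.refl h′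
      J▷ : N.p j ≢ 1 → ∀ m → m ℕ.≤ suc (N.a j) → pairT (B j) ▷ path m
      J▷ = ≡.subst (λ q → N.p j ≢ 1 → ∀ m → m ℕ.≤ suc (N.a j) → pairT (Btree (size (t j)) (treeLeaves (t j)) q) ▷ path m) (≡.sym pj) (N.dominates j)
      rel-j : Similar (t j) (B j) ⊎ (∀ X → Pos² X → X · pairT (B j) ≺ X · pairT (t j))
      rel-j = ≡.subst (λ q → let u = Btree (size (t j)) (treeLeaves (t j)) q in Similar (t j) u ⊎ (∀ X → Pos² X → X · pairT u ≺ X · pairT (t j))) (≡.sym pj) (N.improves j)
      Allowed : Pair → Set (c ⊔ ℓ)
      Allowed X = Pos² X × (N.p j ≢ 1 → ∀ m → m ℕ.≤ suc (N.a j) → X ▷ leg m)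
      rel : ∀ i → Similar (t i) (B i) ⊎ (∀ X → Allowed X → X · pairT (B i) ≺ X · pairT (t i))
      rel i with i Fin.≟ j
      ... | yes _ = weaken (N.improves i)
        where
        weaken : ∀ {u} → Similar (t i) u ⊎ Better (t i) u → Similar (t i) u ⊎ (∀ X → Allowed X → X · pairT u ≺ X · pairT (t i))
        weaken (inj₁ s) = inj₁ s
        weaken (inj₂ h) = inj₂ λ X k → h X (proj₁ k)
      ... | no _ with N.p i ℕ.≟ 1
      ... | yes e = weaken (≡.subst (λ q → let u = Btree (size (t i)) (treeLeaves (t i)) q in Similar (t i) u ⊎ Better (t i) u) e (N.improves i))
        where
        weaken : ∀ {u} → Similar (t i) u ⊎ Better (t i) u → Similar (t i) u ⊎ (∀ X → Allowed X → X · pairT u ≺ X · pairT (t i))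
        weaken (inj₁ s) = inj₁ s
        weaken (inj₂ h) = inj₂ λ X k → h X (proj₁ k)
      -- Always the strict alternative: collapsing gains strictly even if the tree had its normal
      -- form from the start.
      ... | no p≢1 = inj₂ λ X k → collapse X k (N.improves i)
        where
        Bp = Btree (size (t i)) (treeLeaves (t i))
        collapse : ∀ X → Allowed X → Similar (t i) (Bp (N.p i)) ⊎ Better (t i) (Bp (N.p i)) → X · pairT (Bp 1) ≺ X · pairT (t i)
        collapse X (h , k) improves = ≺-≼-trans
          (N.collapses i p≢1 X h (k (proj₁ (dominated i p≢1)) (suc (N.a i)) (s≤s (proj₂ (dominated i p≢1)))))
          (weak improves)
          where
          weak : Similar (t i) (Bp (N.p i)) ⊎ Better (t i) (Bp (N.p i)) → X · pairT (Bp (N.p i)) ≼ X · pairT (t i)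
          weak (inj₁ s) = ≼-reflexive (·-cong (⋆.refl {X}) (⋆.sym (pairT-Similar s)))
          weak (inj₂ b) = ≺⇒≼ (b X h)

-- The determinant of a unicyclic graph as a cycle of pairs.

module UnicyclicDeterminants where
  open import Defs
  open Determinants
  open EdgeLaplacians
  open RootedPairs
  open TreeReduction
  open import Algebra.Bundles using (CommutativeRing; CommutativeSemiring)
  open import Data.Fin as Fin using (Fin; zero; suc; toℕ; fromℕ<)
  import Data.Fin.Properties as Fin
  open import Data.List using (List; []; _∷_; _++_; map)
  open import Data.List.Properties using (++-assoc)
  open import Data.List.Relation.Unary.All as All using (All; []; _∷_)
  open import Data.List.Relation.Unary.All.Properties using (++⁺)
  open import Data.List.Relation.Binary.Pointwise using (Pointwise; []; _∷_)
  open import Data.List.Membership.Propositional using (_∉_)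
  open import Data.List.Relation.Unary.Any using (here; there)
  open import Data.Nat as ℕ using (ℕ; zero; suc; z≤n; s≤s)
  import Data.Nat.Properties as ℕ
  open import Data.Product using (_×_; _,_; proj₁; proj₂)
  open import Data.Sum using (_⊎_; inj₁; inj₂)
  open import Data.Unit.Polymorphic using (⊤; tt)
  open import Data.List.Relation.Unary.Unique.Propositional using (Unique)
  open import Data.List.Relation.Unary.AllPairs using ([]; _∷_)
  open import Level using (_⊔_)
  open import Relation.Nullary using (yes; no; contradiction; Dec)
  open import Relation.Binary.PropositionalEquality as ≡ using (_≡_; _≢_)
  open import Data.List.Relation.Binary.Permutation.Propositional using (_↭_; ↭-sym; ↭-trans; prep; ↭-reflexive)
  open import Data.List.Relation.Binary.Permutation.Propositional.Properties using (++-comm; shift)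

  trivialPositivity : ∀ {c ℓ} (K : CommutativeSemiring c ℓ) → CommutativeSemiring.Carrier K → PositivityStructure K
  trivialPositivity K x = record
    { x = x ; Pos = λ _ → ⊤ ; Pos-1 = tt ; Pos-x = tt ; Pos-resp = λ _ _ → tt ; Pos-+ = λ _ _ → tt ; Pos-* = λ _ _ → tt }

  Avoids : ℕ → List (ℕ × ℕ) → Set
  Avoids b = All (λ (u , v) → u ≢ b × v ≢ b)

  forestEdges-All : ∀ (Q : ℕ → Set) p o ts → Q p → (∀ v → o ℕ.≤ v → v ℕ.< o ℕ.+ sizes ts → Q v) →
    All (λ (u , v) → Q u × Q v) (forestEdges p o ts)
  forestEdges-All Q p o [] hp h = []
  forestEdges-All Q p o (node cs ∷ ts) hp h =
    (hp , h o ℕ.≤-refl (ℕ.m<m+n o (s≤s z≤n))) ∷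
    ++⁺ (forestEdges-All Q o (suc o) cs (h o ℕ.≤-refl (ℕ.m<m+n o (s≤s z≤n)))
          (λ v o<v v< → h v (ℕ.<⇒≤ o<v) (ℕ.<-≤-trans v< (ℕ.≤-trans (ℕ.≤-reflexive (≡.sym (ℕ.+-suc o (sizes cs))))
            (ℕ.+-monoʳ-≤ o (ℕ.m≤m+n (suc (sizes cs)) (sizes ts)))))))
        (forestEdges-All Q p (o ℕ.+ suc (sizes cs)) ts hp
          (λ v h₁ h₂ → h v (ℕ.≤-trans (ℕ.m≤m+n o _) h₁) (≡.subst (v ℕ.<_) (ℕ.+-assoc o (suc (sizes cs)) (sizes ts)) h₂)))

  allTreeEdges-All : ∀ (Q : ℕ → Set) o ts → (∀ v → o ℕ.≤ v → v ℕ.< o ℕ.+ sizes ts → Q v) →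
    All (λ (u , v) → Q u × Q v) (allTreeEdges o ts)
  allTreeEdges-All Q o [] h = []
  allTreeEdges-All Q o (node cs ∷ ts) h = ++⁺
    (forestEdges-All Q o (suc o) cs (h o ℕ.≤-refl (ℕ.m<m+n o (s≤s z≤n)))
      (λ v o<v v< → h v (ℕ.<⇒≤ o<v) (ℕ.<-≤-trans v< (ℕ.≤-trans (ℕ.≤-reflexive (≡.sym (ℕ.+-suc o (sizes cs))))
        (ℕ.+-monoʳ-≤ o (ℕ.m≤m+n (suc (sizes cs)) (sizes ts)))))))
    (allTreeEdges-All Q (o ℕ.+ suc (sizes cs)) ts
      (λ v h₁ h₂ → h v (ℕ.≤-trans (ℕ.m≤m+n o _) h₁) (≡.subst (v ℕ.<_) (ℕ.+-assoc o (suc (sizes cs)) (sizes ts)) h₂)))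

  rootLabels-≥ : ∀ o ts → All (o ℕ.≤_) (rootLabels o ts)
  rootLabels-≥ o [] = []
  rootLabels-≥ o (t ∷ ts) = ℕ.≤-refl ∷ All.map (ℕ.≤-trans (ℕ.m≤m+n o _)) (rootLabels-≥ (o ℕ.+ size t) ts)

  rootLabels-< : ∀ o ts → All (ℕ._< o ℕ.+ sizes ts) (rootLabels o ts)
  rootLabels-< o [] = []
  rootLabels-< o (node cs ∷ ts) = ℕ.m<m+n o (s≤s z≤n) ∷
    ≡.subst (λ m → All (ℕ._< m) (rootLabels (o ℕ.+ suc (sizes cs)) ts)) (ℕ.+-assoc o (suc (sizes cs)) (sizes ts)) (rootLabels-< (o ℕ.+ suc (sizes cs)) ts)

  rootLabels-unique : ∀ o ts → Unique (rootLabels o ts)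
  rootLabels-unique o [] = []
  rootLabels-unique o (node cs ∷ ts) =
    All.map (λ h → ℕ.<⇒≢ (ℕ.<-≤-trans (ℕ.m<m+n o (s≤s z≤n)) h)) (rootLabels-≥ (o ℕ.+ suc (sizes cs)) ts)
    ∷ rootLabels-unique (o ℕ.+ suc (sizes cs)) ts

  ≢-flip : ∀ {q : ℕ} {ys} → All (q ≢_) ys → All (_≢ q) ys
  ≢-flip {q} = All.map {P = q ≢_} {Q = _≢ q} (λ h e → h (≡.sym e))

  ∉⇒All-≢ : ∀ (v : ℕ) ls → v ∉ ls → All (_≢ v) ls
  ∉⇒All-≢ v [] h = []
  ∉⇒All-≢ v (l ∷ ls) h = (λ e → h (here (≡.sym e))) ∷ ∉⇒All-≢ v ls (λ k → h (there k))

  cycleGo-avoids : ∀ {r q} ys → r ≢ q → All (_≢ q) ys → Avoids q (cycleGo r ys)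
  cycleGo-avoids [] r≢q [] = []
  cycleGo-avoids (y ∷ []) r≢q (h ∷ []) = (h , r≢q) ∷ []
  cycleGo-avoids (y ∷ z ∷ zs) r≢q (h ∷ h′ ∷ hs) = (h , h′) ∷ cycleGo-avoids (z ∷ zs) r≢q (h′ ∷ hs)

  module Elimination {c ℓ} (R : CommutativeRing c ℓ) (x : CommutativeRing.Carrier R) where
    open CommutativeRing R hiding (zero)
    open import Algebra.Properties.Ring ring
    open import Relation.Binary.Reasoning.Setoid setoid
    open import Algebra.Solver.Ring.NaturalCoefficients.Default commutativeSemiring
    open Determinant R
    open GraphDeterminant R hiding (Pair; _⋆_; _≋_)
    K = commutativeSemiring
    open PairAlgebra K (trivialPositivity K x)
    open TreePairs K (trivialPositivity K x)

    dead : Pair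
    dead = 1# , 0#

    set : ℕ → Pair → (ℕ → Pair) → ℕ → Pair
    set b p w v = choose (v ℕ.≟ b) p (w v)

    set-≡ : ∀ b p w → set b p w b ≡ p
    set-≡ b p w with b ℕ.≟ b
    ... | yes _ = ≡.refl
    ... | no ¬e = contradiction ≡.refl ¬e

    set-≢ : ∀ b p w {v} → v ≢ b → set b p w v ≡ w v
    set-≢ b p w {v} v≢b with v ℕ.≟ b
    ... | yes e = contradiction e v≢b
    ... | no _ = ≡.refl

    ≡⇒≋ : ∀ {p q : Pair} → p ≡ q → p ≋ q
    ≡⇒≋ ≡.refl = ⋆.refl

    χ-avoids : ∀ {b} e → proj₁ e ≢ b × proj₂ e ≢ b → χ e b ≈ 0#
    χ-avoids (u , v) (u≢b , v≢b) = trans (+-cong (δ-≢ u≢b) (-‿cong (δ-≢ v≢b))) (-‿inverseʳ 0#)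

    lap-avoids : ∀ {b} es → Avoids b es → ∀ j → lap es b j ≈ 0#
    lap-avoids [] [] j = refl
    lap-avoids (e ∷ es) (h ∷ hs) j = begin
      χ e _ * χ e j + lap es _ j   ≈⟨ +-cong (*-congʳ (χ-avoids e h)) (lap-avoids es hs j) ⟩
      0# * χ e j + 0#              ≈⟨ trans (+-identityʳ _) (zeroˡ _) ⟩
      0#                           ∎

    -- The Laplacian vanishes in row b, so f can be pulled out of that row; what is left is the unit
    -- vector that `dead` produces.
    isolate : ∀ n (b : Fin n) {w es} → Avoids (toℕ b) es → Z n w es ≈ proj₁ (w (toℕ b)) * Z n (set (toℕ b) dead w) es
    isolate n b {w} {es} h = begin
      Z n w es
        ≈⟨ row-linear n {m w} {m w′} {m w′} b f 0# row off off ⟩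
      f * Z n w′ es + 0# * Z n w′ es   ≈⟨ +-congˡ (zeroˡ _) ⟩
      f * Z n w′ es + 0#               ≈⟨ +-identityʳ _ ⟩
      f * Z n w′ es                    ∎
      where
      f = proj₁ (w (toℕ b))
      w′ = set (toℕ b) dead w
      m : (ℕ → Pair) → Matrix n
      m w i j = entry w es (toℕ i) (toℕ j)
      off : ∀ i → i ≢ b → ∀ j → m w i j ≈ m w′ i j
      off i i≢b j = let e = ≡⇒≋ (set-≢ (toℕ b) dead w (λ p → i≢b (Fin.toℕ-injective p))) in
        +-cong (*-congˡ (sym (proj₁ e))) (*-congʳ (sym (proj₂ e)))
      row : ∀ j → m w b j ≈ f * m w′ b j + 0# * m w′ b j
      row j = begin
        k * f + proj₂ (w (toℕ b)) * l    ≈⟨ +-congˡ (*-congˡ (lap-avoids es h (toℕ j))) ⟩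
        k * f + proj₂ (w (toℕ b)) * 0#
          ≈⟨ solve 4 (λ k f d l → k :* f :+ d :* con 0 := f :* (k :* con 1 :+ con 0 :* l) :+ con 0 :* (k :* con 1 :+ con 0 :* l)) refl k f (proj₂ (w (toℕ b))) l ⟩
        f * (k * 1# + 0# * l) + 0# * (k * 1# + 0# * l)
          ≈⟨ +-cong (*-congˡ (same j)) (*-congˡ (same j)) ⟩
        f * m w′ b j + 0# * m w′ b j ∎
        where
        k = δ (toℕ b) (toℕ j)
        l = lap es (toℕ b) (toℕ j)
        same : ∀ j → δ (toℕ b) (toℕ j) * 1# + 0# * lap es (toℕ b) (toℕ j) ≈ m w′ b j
        same j = let e = ≡⇒≋ (set-≡ (toℕ b) dead w) in +-cong (*-congˡ (sym (proj₁ e))) (*-congʳ (sym (proj₂ e)))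

    contract-avoids : ∀ a {b} es → Avoids b es → map (contractE a b) es ≡ es
    contract-avoids a [] [] = ≡.refl
    contract-avoids a {b} ((u , v) ∷ es) ((u≢b , v≢b) ∷ h) =
      ≡.cong₂ _∷_ (≡.cong₂ _,_ (fixed u u≢b) (fixed v v≢b)) (contract-avoids a es h)
      where
      fixed : ∀ u → u ≢ b → contract a b u ≡ u
      fixed u u≢b with u ℕ.≟ b
      ... | yes e = contradiction e u≢b
      ... | no _ = ≡.refl

    contractW-b : ∀ a b w → contractW a b w b ≡ dead
    contractW-b a b w with b ℕ.≟ b
    ... | yes _ = ≡.refl
    ... | no ¬e = contradiction ≡.refl ¬e

    contractW-a : ∀ {a b} w → a ≢ b → contractW a b w a ≡ w a ⋆ w b
    contractW-a {a} {b} w a≢b with a ℕ.≟ b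
    ... | yes e = contradiction e a≢b
    ... | no _ with a ℕ.≟ a
    ... | yes _ = ≡.refl
    ... | no ¬e = contradiction ≡.refl ¬e

    contractW-other : ∀ {a b} w {v} → v ≢ a → v ≢ b → contractW a b w v ≡ w v
    contractW-other {a} {b} w {v} v≢a v≢b with v ℕ.≟ b
    ... | yes e = contradiction e v≢b
    ... | no _ with v ℕ.≟ a
    ... | yes e = contradiction e v≢a
    ... | no _ = ≡.refl

    -- Deleting the edge isolates b and yields the factor f, contracting it yields the pair
    -- `w a ⋆ w b`. By linearity in the pair at a these add up, and f times `w a` plus `w a ⋆ w b`
    -- is `w a ⋆ edge (w b)`.
    eliminate-leaf : ∀ n {a b w es} → a ℕ.< n → b ℕ.< n → a ≢ b → Avoids b es →
      Z n w ((a , b) ∷ es) ≈ Z n (set b dead (set a (w a ⋆ edge (w b)) w)) es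
    eliminate-leaf n {a} {b} {w} {es} a<n b<n a≢b h = ≡.subst₂ (λ a b → a ≢ b → Avoids b es → Z n w ((a , b) ∷ es) ≈ Z n (set b dead (set a (w a ⋆ edge (w b)) w)) es)
      (Fin.toℕ-fromℕ< a<n) (Fin.toℕ-fromℕ< b<n) go a≢b h
      where
      α = fromℕ< a<n
      β = fromℕ< b<n
      A = toℕ α
      B = toℕ β
      go : A ≢ B → Avoids B es → Z n w ((A , B) ∷ es) ≈ Z n (set B dead (set A (w A ⋆ edge (w B)) w)) es
      go A≢B h = begin
        Z n w ((A , B) ∷ es)
          ≈⟨ deletion-contraction n (λ p → A≢B (≡.cong toℕ p)) w es ⟩
        Z n w es + Z n w₂ (map (contractE A B) es)
          ≈⟨ +-cong (isolate n β {w} {es} h) (trans (reflexive (≡.cong (Z n w₂) (contract-avoids A es h))) (sym (*-identityˡ _))) ⟩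
        f * Z n w₁ es + 1# * Z n w₂ es
          ≈⟨ row-pair-linear n α {w′} {w₁} {w₂} f 1# es linear₁ linear₂ off₁ off₂ ⟨
        Z n w′ es ∎
        where
        f = proj₁ (w B)
        d = proj₂ (w B)
        w₁ = set B dead w
        w₂ = contractW A B w
        wA = set A (w A ⋆ edge (w B)) w
        w′ = set B dead wA
        w′A : w′ A ≡ w A ⋆ edge (w B)
        w′A = ≡.trans (set-≢ B dead wA A≢B) (set-≡ A (w A ⋆ edge (w B)) w)
        w₁A : w₁ A ≡ w A
        w₁A = set-≢ B dead w A≢B
        w₂A : w₂ A ≡ w A ⋆ w B
        w₂A = contractW-a w A≢B
        linear₁ : proj₁ (w′ A) ≈ f * proj₁ (w₁ A) + 1# * proj₁ (w₂ A)
        linear₁ rewrite w′A | w₁A | w₂A =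
          solve 4 (λ F D f d → F :* (f :+ d) :+ f :* D := f :* F :+ con 1 :* (F :* d :+ f :* D)) refl (proj₁ (w A)) (proj₂ (w A)) f d
        linear₂ : proj₂ (w′ A) ≈ f * proj₂ (w₁ A) + 1# * proj₂ (w₂ A)
        linear₂ rewrite w′A | w₁A | w₂A =
          solve 3 (λ D f d → D :* (f :+ d) := f :* D :+ con 1 :* (D :* d)) refl (proj₂ (w A)) f d
        off₁ : ∀ i → i ≢ α → w′ (toℕ i) ≋ w₁ (toℕ i)
        off₁ i i≢α = cases (toℕ i ℕ.≟ B)
          where
          cases : Dec (toℕ i ≡ B) → w′ (toℕ i) ≋ w₁ (toℕ i)
          cases (yes e) = ≡⇒≋ (≡.trans (≡.trans (≡.cong w′ e) (set-≡ B dead wA)) (≡.sym (≡.trans (≡.cong w₁ e) (set-≡ B dead w))))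
          cases (no ¬e) = ≡⇒≋ (≡.trans (≡.trans (set-≢ B dead wA ¬e) (set-≢ A (w A ⋆ edge (w B)) w (λ p → i≢α (Fin.toℕ-injective p)))) (≡.sym (set-≢ B dead w ¬e)))
        off₂ : ∀ i → i ≢ α → w′ (toℕ i) ≋ w₂ (toℕ i)
        off₂ i i≢α = cases (toℕ i ℕ.≟ B)
          where
          cases : Dec (toℕ i ≡ B) → w′ (toℕ i) ≋ w₂ (toℕ i)
          cases (yes e) = ≡⇒≋ (≡.trans (≡.trans (≡.cong w′ e) (set-≡ B dead wA)) (≡.sym (≡.trans (≡.cong w₂ e) (contractW-b A B w))))
          cases (no ¬e) = ≡⇒≋ (≡.trans (≡.trans (set-≢ B dead wA ¬e) (set-≢ A (w A ⋆ edge (w B)) w (λ p → i≢α (Fin.toℕ-injective p))))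
            (≡.sym (contractW-other w (λ p → i≢α (Fin.toℕ-injective p)) ¬e)))

    record ForestElimination (n : ℕ) (w : ℕ → Pair) (p o : ℕ) (ts : List RTree) (rest : List Edge) : Set (c ⊔ ℓ) where
      field
        w′ : ℕ → Pair
        Z≈ : Z n w (forestEdges p o ts ++ rest) ≈ Z n w′ rest
        parent : w′ p ≋ w p ⋆ branches ts
        block : ∀ v → o ℕ.≤ v → v ℕ.< o ℕ.+ sizes ts → w′ v ≋ dead
        outside : ∀ v → v ≢ p → v ℕ.< o ⊎ o ℕ.+ sizes ts ℕ.≤ v → w′ v ≋ w v

    AvoidsBlock : ℕ → ℕ → List Edge → Set
    AvoidsBlock o o′ es = ∀ v → o ℕ.≤ v → v ℕ.< o′ → Avoids v es

    -- A child is a leaf only once its own subtree is gone. Preorder lists the edge to the child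
    -- first, so this edge is moved behind those of the subtree.
    eliminate-forest : ∀ n w p o ts rest → p ℕ.< o → o ℕ.+ sizes ts ℕ.≤ n →
      (∀ v → o ℕ.≤ v → v ℕ.< o ℕ.+ sizes ts → w v ≋ vertex) → AvoidsBlock o (o ℕ.+ sizes ts) rest →
      ForestElimination n w p o ts rest
    eliminate-forest n w p o [] rest p<o o≤n hw hr = record
      { w′ = w ; Z≈ = refl ; parent = ⋆.sym (⋆.identityʳ (w p))
      ; block = λ v h₁ h₂ → contradiction (ℕ.≤-<-trans h₁ (≡.subst (v ℕ.<_) (ℕ.+-identityʳ o) h₂)) (ℕ.<-irrefl ≡.refl)
      ; outside = λ _ _ _ → ⋆.refl }
    eliminate-forest n w p o (node cs ∷ ts) rest p<o o≤n hw hr = record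
      { w′ = E₃.w′
      ; Z≈ = begin
          Z n w (((p , o) ∷ (C ++ D)) ++ rest)    ≈⟨ Z-↭ n w (reorder C D) ⟩
          Z n w (C ++ (p , o) ∷ (D ++ rest))      ≈⟨ E₁.Z≈ ⟩
          Z n E₁.w′ ((p , o) ∷ (D ++ rest))       ≈⟨ eliminate-leaf n {w = E₁.w′} p<n o<n (ℕ.<⇒≢ p<o) avoids-o ⟩
          Z n w₂ (D ++ rest)                      ≈⟨ E₃.Z≈ ⟩
          Z n E₃.w′ rest                          ∎
      ; parent = ⋆.trans E₃.parent (⋆.trans (⋆.∙-congʳ {branches ts} w₂-p) (⋆.assoc (w p) (edge (pairT (node cs))) (branches ts)))
      ; block = block
      ; outside = outside }
      where
      s = suc (sizes cs)
      C = forestEdges o (suc o) cs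
      D = forestEdges p (o ℕ.+ s) ts
      o+s : suc o ℕ.+ sizes cs ≡ o ℕ.+ s
      o+s = ≡.sym (ℕ.+-suc o (sizes cs))
      end : o ℕ.+ s ℕ.+ sizes ts ≡ o ℕ.+ (s ℕ.+ sizes ts)
      end = ℕ.+-assoc o s (sizes ts)
      o<n : o ℕ.< n
      o<n = ℕ.<-≤-trans (ℕ.m<m+n o (s≤s z≤n)) o≤n
      p<n : p ℕ.< n
      p<n = ℕ.<-trans p<o o<n
      mid≤end : o ℕ.+ s ℕ.≤ o ℕ.+ (s ℕ.+ sizes ts)
      mid≤end = ℕ.+-monoʳ-≤ o (ℕ.m≤m+n s (sizes ts))
      o<mid : o ℕ.< o ℕ.+ s
      o<mid = ℕ.m<m+n o (s≤s z≤n)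

      reorder : ∀ C D → ((p , o) ∷ (C ++ D)) ++ rest ↭ C ++ (p , o) ∷ (D ++ rest)
      reorder C D = ↭-trans (prep (p , o) (↭-reflexive (++-assoc C D rest))) (↭-sym (shift (p , o) C (D ++ rest)))

      D-avoids : ∀ v → v ≢ p → v ℕ.< o ℕ.+ s → Avoids v D
      D-avoids v v≢p v<mid = forestEdges-All (λ u → u ≢ v) p (o ℕ.+ s) ts (λ e → v≢p (≡.sym e))
        (λ u h _ e → ℕ.<⇒≱ v<mid (≡.subst (o ℕ.+ s ℕ.≤_) e h))

      elimination₁ = eliminate-forest n w o (suc o) cs ((p , o) ∷ (D ++ rest)) ℕ.≤-refl
        (ℕ.≤-trans (ℕ.≤-reflexive o+s) (ℕ.≤-trans mid≤end o≤n))
        (λ v h₁ h₂ → hw v (ℕ.<⇒≤ h₁) (ℕ.<-≤-trans (≡.subst (v ℕ.<_) o+s h₂) mid≤end))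
        (λ v h₁ h₂ → let h₃ = ≡.subst (v ℕ.<_) o+s h₂ in
          (ℕ.<⇒≢ (ℕ.<-trans p<o h₁) , ℕ.<⇒≢ h₁) ∷
          ++⁺ (D-avoids v (λ e → ℕ.<⇒≢ (ℕ.<-trans p<o h₁) (≡.sym e)) h₃) (hr v (ℕ.<⇒≤ h₁) (ℕ.<-≤-trans h₃ mid≤end)))
      module E₁ = ForestElimination elimination₁

      avoids-o : Avoids o (D ++ rest)
      avoids-o = ++⁺ (D-avoids o (λ e → ℕ.<⇒≢ p<o (≡.sym e)) o<mid) (hr o ℕ.≤-refl (ℕ.<-≤-trans o<mid mid≤end))

      q : Pair
      q = E₁.w′ p ⋆ edge (E₁.w′ o)
      w₂ : ℕ → Pair
      w₂ = set o dead (set p q E₁.w′)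
      w₂-other : ∀ v → v ≢ p → v ≢ o → w₂ v ≋ E₁.w′ v
      w₂-other v v≢p v≢o = ≡⇒≋ (≡.trans (set-≢ o dead (set p q E₁.w′) v≢o) (set-≢ p q E₁.w′ v≢p))
      w₂-o : w₂ o ≋ dead
      w₂-o = ≡⇒≋ (set-≡ o dead (set p q E₁.w′))
      w₂-p : w₂ p ≋ w p ⋆ edge (pairT (node cs))
      w₂-p = ⋆.trans (≡⇒≋ (≡.trans (set-≢ o dead (set p q E₁.w′) (ℕ.<⇒≢ p<o)) (set-≡ p q E₁.w′)))
        (⋆.∙-cong (E₁.outside p (ℕ.<⇒≢ p<o) (inj₁ (ℕ.m<n⇒m<1+n p<o)))
          (edge-cong (⋆.trans E₁.parent (⋆.∙-congʳ {branches cs} (hw o ℕ.≤-refl (ℕ.<-≤-trans o<mid mid≤end))))))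

      after-mid : ∀ v → o ℕ.+ s ℕ.≤ v → w₂ v ≋ w v
      after-mid v h = ⋆.trans (w₂-other v (λ e → ℕ.<⇒≢ (ℕ.<-trans p<o o<v) (≡.sym e)) (λ e → ℕ.<⇒≢ o<v (≡.sym e)))
        (E₁.outside v (λ e → ℕ.<⇒≢ o<v (≡.sym e)) (inj₂ (≡.subst (ℕ._≤ v) (≡.sym o+s) h)))
        where
        o<v : o ℕ.< v
        o<v = ℕ.<-≤-trans o<mid h

      elimination₃ = eliminate-forest n w₂ p (o ℕ.+ s) ts rest (ℕ.<-trans p<o o<mid)
        (≡.subst (ℕ._≤ n) (≡.sym end) o≤n)
        (λ v h₁ h₂ → ⋆.trans (after-mid v h₁) (hw v (ℕ.≤-trans (ℕ.<⇒≤ o<mid) h₁) (≡.subst (v ℕ.<_) end h₂)))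
        (λ v h₁ h₂ → hr v (ℕ.≤-trans (ℕ.<⇒≤ o<mid) h₁) (≡.subst (v ℕ.<_) end h₂))
      module E₃ = ForestElimination elimination₃

      block : ∀ v → o ℕ.≤ v → v ℕ.< o ℕ.+ (s ℕ.+ sizes ts) → E₃.w′ v ≋ dead
      block v h₁ h₂ with v ℕ.<? o ℕ.+ s
      ... | no v≮ = E₃.block v (ℕ.≮⇒≥ v≮) (≡.subst (v ℕ.<_) (≡.sym end) h₂)
      ... | yes v< = ⋆.trans (E₃.outside v v≢p (inj₁ v<)) (cases (ℕ.m≤n⇒m<n∨m≡n h₁))
        where
        v≢p : v ≢ p
        v≢p e = ℕ.<⇒≢ (ℕ.<-≤-trans p<o h₁) (≡.sym e)
        cases : o ℕ.< v ⊎ o ≡ v → w₂ v ≋ dead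
        cases (inj₂ ≡.refl) = w₂-o
        cases (inj₁ o<v) = ⋆.trans (w₂-other v v≢p (λ e → ℕ.<⇒≢ o<v (≡.sym e))) (E₁.block v o<v (≡.subst (v ℕ.<_) (≡.sym o+s) v<))

      outside : ∀ v → v ≢ p → v ℕ.< o ⊎ o ℕ.+ (s ℕ.+ sizes ts) ℕ.≤ v → E₃.w′ v ≋ w v
      outside v v≢p (inj₁ v<o) = ⋆.trans (E₃.outside v v≢p (inj₁ (ℕ.<-trans v<o o<mid)))
        (⋆.trans (w₂-other v v≢p (ℕ.<⇒≢ v<o)) (E₁.outside v (ℕ.<⇒≢ v<o) (inj₁ (ℕ.m<n⇒m<1+n v<o))))
      outside v v≢p (inj₂ h) = ⋆.trans (E₃.outside v v≢p (inj₂ (≡.subst (ℕ._≤ v) (≡.sym end) h)))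
        (after-mid v (ℕ.≤-trans mid≤end h))

    record TreesElimination (n : ℕ) (w : ℕ → Pair) (o : ℕ) (ts : List RTree) (rest : List Edge) : Set (c ⊔ ℓ) where
      field
        w′ : ℕ → Pair
        Z≈ : Z n w (allTreeEdges o ts ++ rest) ≈ Z n w′ rest
        roots : Pointwise (λ r t → w′ r ≋ pairT t) (rootLabels o ts) ts
        others : ∀ v → o ℕ.≤ v → v ℕ.< o ℕ.+ sizes ts → v ∉ rootLabels o ts → w′ v ≋ dead
        outside : ∀ v → v ℕ.< o ⊎ o ℕ.+ sizes ts ℕ.≤ v → w′ v ≋ w v

    eliminate-trees : ∀ n w o ts rest → o ℕ.+ sizes ts ℕ.≤ n →
      (∀ v → o ℕ.≤ v → v ℕ.< o ℕ.+ sizes ts → w v ≋ vertex) →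
      (∀ v → o ℕ.≤ v → v ℕ.< o ℕ.+ sizes ts → v ∉ rootLabels o ts → Avoids v rest) →
      TreesElimination n w o ts rest
    eliminate-trees n w o [] rest o≤n hw hr = record
      { w′ = w ; Z≈ = refl ; roots = []
      ; others = λ v h₁ h₂ → contradiction (ℕ.≤-<-trans h₁ (≡.subst (v ℕ.<_) (ℕ.+-identityʳ o) h₂)) (ℕ.<-irrefl ≡.refl)
      ; outside = λ _ _ → ⋆.refl }
    eliminate-trees n w o (node cs ∷ ts) rest o≤n hw hr = record
      { w′ = E₂.w′
      ; Z≈ = begin
          Z n w ((forestEdges o (suc o) cs ++ D) ++ rest)   ≈⟨ Z-↭ n w (↭-reflexive (++-assoc (forestEdges o (suc o) cs) D rest)) ⟩
          Z n w (forestEdges o (suc o) cs ++ (D ++ rest))   ≈⟨ E₁.Z≈ ⟩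
          Z n E₁.w′ (D ++ rest)                             ≈⟨ E₂.Z≈ ⟩
          Z n E₂.w′ rest                                    ∎
      ; roots = ⋆.trans (E₂.outside o (inj₁ o<mid))
          (⋆.trans E₁.parent (⋆.∙-congʳ {branches cs} (hw o ℕ.≤-refl (ℕ.<-≤-trans o<mid mid≤end)))) ∷ E₂.roots
      ; others = others
      ; outside = outside }
      where
      s = suc (sizes cs)
      D = allTreeEdges (o ℕ.+ s) ts
      o+s : suc o ℕ.+ sizes cs ≡ o ℕ.+ s
      o+s = ≡.sym (ℕ.+-suc o (sizes cs))
      end : o ℕ.+ s ℕ.+ sizes ts ≡ o ℕ.+ (s ℕ.+ sizes ts)
      end = ℕ.+-assoc o s (sizes ts)
      mid≤end : o ℕ.+ s ℕ.≤ o ℕ.+ (s ℕ.+ sizes ts)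
      mid≤end = ℕ.+-monoʳ-≤ o (ℕ.m≤m+n s (sizes ts))
      o<mid : o ℕ.< o ℕ.+ s
      o<mid = ℕ.m<m+n o (s≤s z≤n)

      not-root : ∀ v → o ℕ.< v → v ℕ.< o ℕ.+ s → v ∉ rootLabels o (node cs ∷ ts)
      not-root v o<v v<mid (here e) = ℕ.<⇒≢ o<v (≡.sym e)
      not-root v o<v v<mid (there h) = ℕ.<⇒≱ v<mid (All.lookup (rootLabels-≥ (o ℕ.+ s) ts) h)

      elimination₁ = eliminate-forest n w o (suc o) cs (D ++ rest) ℕ.≤-refl
        (ℕ.≤-trans (ℕ.≤-reflexive o+s) (ℕ.≤-trans mid≤end o≤n))
        (λ v h₁ h₂ → hw v (ℕ.<⇒≤ h₁) (ℕ.<-≤-trans (≡.subst (v ℕ.<_) o+s h₂) mid≤end))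
        (λ v h₁ h₂ → let h₃ = ≡.subst (v ℕ.<_) o+s h₂ in
          ++⁺ (allTreeEdges-All (_≢ v) (o ℕ.+ s) ts (λ u h _ e → ℕ.<⇒≱ h₃ (≡.subst (o ℕ.+ s ℕ.≤_) e h)))
              (hr v (ℕ.<⇒≤ h₁) (ℕ.<-≤-trans h₃ mid≤end) (not-root v h₁ h₃)))
      module E₁ = ForestElimination elimination₁

      elimination₂ = eliminate-trees n E₁.w′ (o ℕ.+ s) ts rest (≡.subst (ℕ._≤ n) (≡.sym end) o≤n)
        (λ v h₁ h₂ → ⋆.trans (E₁.outside v (λ e → ℕ.<⇒≢ (ℕ.<-≤-trans o<mid h₁) (≡.sym e)) (inj₂ (≡.subst (ℕ._≤ v) (≡.sym o+s) h₁)))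
          (hw v (ℕ.≤-trans (ℕ.<⇒≤ o<mid) h₁) (≡.subst (v ℕ.<_) end h₂)))
        (λ v h₁ h₂ v∉ → hr v (ℕ.≤-trans (ℕ.<⇒≤ o<mid) h₁) (≡.subst (v ℕ.<_) end h₂)
          (λ { (here e) → ℕ.<⇒≢ (ℕ.<-≤-trans o<mid h₁) (≡.sym e) ; (there h) → v∉ h }))
      module E₂ = TreesElimination elimination₂

      others : ∀ v → o ℕ.≤ v → v ℕ.< o ℕ.+ (s ℕ.+ sizes ts) → v ∉ rootLabels o (node cs ∷ ts) → E₂.w′ v ≋ dead
      others v h₁ h₂ v∉ with v ℕ.<? o ℕ.+ s
      ... | yes v< = ⋆.trans (E₂.outside v (inj₁ v<))
        (E₁.block v (ℕ.≤∧≢⇒< h₁ (λ e → v∉ (here (≡.sym e)))) (≡.subst (v ℕ.<_) (≡.sym o+s) v<))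
      ... | no v≮ = E₂.others v (ℕ.≮⇒≥ v≮) (≡.subst (v ℕ.<_) (≡.sym end) h₂) (λ h → v∉ (there h))

      outside : ∀ v → v ℕ.< o ⊎ o ℕ.+ (s ℕ.+ sizes ts) ℕ.≤ v → E₂.w′ v ≋ w v
      outside v (inj₁ v<o) = ⋆.trans (E₂.outside v (inj₁ (ℕ.<-trans v<o o<mid)))
        (E₁.outside v (ℕ.<⇒≢ v<o) (inj₁ (ℕ.m<n⇒m<1+n v<o)))
      outside v (inj₂ h) = ⋆.trans (E₂.outside v (inj₂ (≡.subst (ℕ._≤ v) (≡.sym end) h)))
        (E₁.outside v (λ e → ℕ.<⇒≢ (ℕ.<-≤-trans o<mid mid≤v) (≡.sym e)) (inj₂ (≡.subst (ℕ._≤ v) (≡.sym o+s) mid≤v)))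
        where
        mid≤v : o ℕ.+ s ℕ.≤ v
        mid≤v = ℕ.≤-trans mid≤end h

    det-one : ∀ n {M : Matrix n} → (∀ i → M i i ≈ 1#) → (∀ i j → i ≢ j → M i j ≈ 0#) → detᴿ n M ≈ 1#
    det-one zero h₁ h₀ = refl
    det-one (suc n) {M} h₁ h₀ = begin
      detᴿ (suc n) M
        ≈⟨ sum-single zero (λ j → sg (toℕ j) * (M zero j * detᴿ n (minor M zero j)))
             (λ j j≢0 → trans (*-congˡ (trans (*-congʳ (h₀ zero j (λ e → j≢0 (≡.sym e)))) (zeroˡ _))) (zeroʳ (sg (toℕ j)))) ⟩
      1# * (M zero zero * detᴿ n (minor M zero zero))
        ≈⟨ *-congˡ (*-cong (h₁ zero) (det-one n (λ i → h₁ (suc i)) (λ i j i≢j → h₀ (suc i) (suc j) (λ e → i≢j (Fin.suc-injective e))))) ⟩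
      1# * (1# * 1#)  ≈⟨ trans (*-identityˡ _) (*-identityˡ _) ⟩
      1#              ∎

    -- L lists the vertices not yet eliminated.
    record Support (n : ℕ) (w : ℕ → Pair) (L : List ℕ) : Set ℓ where
      constructor support
      field
        unique : Unique L
        bounded : All (ℕ._< n) L
        elsewhere : ∀ v → v ℕ.< n → v ∉ L → w v ≋ dead

    Z-single : ∀ n {w r} → Support n w (r ∷ []) → Z n w [] ≈ proj₁ (w r)
    Z-single n {w} {r} (support _ (r<n ∷ []) h) = begin
      Z n w []                       ≈⟨ reflexive (≡.cong (λ r → Z n w []) (≡.sym r≡)) ⟩
      Z n w []                       ≈⟨ isolate n ρ {w} {[]} [] ⟩
      proj₁ (w (toℕ ρ)) * Z n w₁ []  ≈⟨ *-cong (reflexive (≡.cong (λ r → proj₁ (w r)) r≡)) one ⟩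
      proj₁ (w r) * 1#               ≈⟨ *-identityʳ _ ⟩
      proj₁ (w r)                    ∎
      where
      ρ = fromℕ< r<n
      r≡ : toℕ ρ ≡ r
      r≡ = Fin.toℕ-fromℕ< r<n
      w₁ = set (toℕ ρ) dead w
      all-dead : ∀ (i : Fin n) → w₁ (toℕ i) ≋ dead
      all-dead i = cases (toℕ i ℕ.≟ toℕ ρ)
        where
        cases : Dec (toℕ i ≡ toℕ ρ) → w₁ (toℕ i) ≋ dead
        cases (yes e) = ≡⇒≋ (≡.trans (≡.cong w₁ e) (set-≡ (toℕ ρ) dead w))
        cases (no ¬e) = ⋆.trans (≡⇒≋ (set-≢ (toℕ ρ) dead w ¬e))
          (h (toℕ i) (Fin.toℕ<n i) (λ { (here e) → ¬e (≡.trans e (≡.sym r≡)) }))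
      entry≈ : ∀ i j → entry w₁ [] (toℕ i) (toℕ j) ≈ δ (toℕ i) (toℕ j)
      entry≈ i j = begin
        δ (toℕ i) (toℕ j) * proj₁ (w₁ (toℕ i)) + proj₂ (w₁ (toℕ i)) * 0#
          ≈⟨ +-cong (trans (*-congˡ (proj₁ (all-dead i))) (*-identityʳ _)) (zeroʳ _) ⟩
        δ (toℕ i) (toℕ j) + 0#   ≈⟨ +-identityʳ _ ⟩
        δ (toℕ i) (toℕ j)        ∎
      one : Z n w₁ [] ≈ 1#
      one = det-one n {λ i j → entry w₁ [] (toℕ i) (toℕ j)} (λ i → trans (entry≈ i i) (δ-refl (toℕ i)))
        (λ i j i≢j → trans (entry≈ i j) (δ-≢ (λ e → i≢j (Fin.toℕ-injective e))))

    Z-lap-cong : ∀ n w {es es′} → (∀ i j → lap es i j ≈ lap es′ i j) → Z n w es ≈ Z n w es′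
    Z-lap-cong n w {es} {es′} h = det-cong n {λ i j → entry w es (toℕ i) (toℕ j)} {λ i j → entry w es′ (toℕ i) (toℕ j)}
      (λ i j → +-congˡ (*-congˡ (h (toℕ i) (toℕ j))))

    Z-flip : ∀ n w a b es → Z n w ((a , b) ∷ es) ≈ Z n w ((b , a) ∷ es)
    Z-flip n w a b es = Z-lap-cong n w {(a , b) ∷ es} {(b , a) ∷ es} (λ i j → +-congʳ (begin
      χ (a , b) i * χ (a , b) j        ≈⟨ *-cong (negated i) (negated j) ⟩
      - χ (b , a) i * - χ (b , a) j    ≈⟨ -‿distribˡ-* _ _ ⟨
      - (χ (b , a) i * - χ (b , a) j)  ≈⟨ -‿cong (-‿distribʳ-* _ _) ⟨
      - - (χ (b , a) i * χ (b , a) j)  ≈⟨ -‿involutive _ ⟩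
      χ (b , a) i * χ (b , a) j        ∎))
      where
      negated : ∀ i → χ (a , b) i ≈ - χ (b , a) i
      negated i = begin
        δ a i - δ b i          ≈⟨ +-comm _ _ ⟩
        - δ b i + δ a i        ≈⟨ +-congˡ (-‿involutive _) ⟨
        - δ b i + - - δ a i    ≈⟨ -‿+-comm _ _ ⟩
        - (δ b i - δ a i)      ∎

    Z-loop : ∀ n w a es → Z n w ((a , a) ∷ es) ≈ Z n w es
    Z-loop n w a es = Z-lap-cong n w {(a , a) ∷ es} {es} (λ i j → trans (+-congʳ (trans (*-congʳ (-‿inverseʳ (δ a i))) (zeroˡ _))) (+-identityˡ _))

    map-updated : ∀ {w w′ : ℕ → Pair} {ys} → All (λ v → w′ v ≡ w v) ys → map w′ ys ≡ map w ys
    map-updated [] = ≡.refl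
    map-updated (h ∷ hs) = ≡.cong₂ _∷_ h (map-updated hs)

    -- With the edge between r and q gone, q is an end of a path; removing end vertices as leaves
    -- follows the recursion of `open-chain`.
    open-value : ∀ n w r q qs → Support n w (r ∷ q ∷ qs) → Z n w (cycleGo r (q ∷ qs)) ≈ open-chain (w q) (map w qs) (w r)
    open-value n w r q [] (support ((r≢q ∷ []) ∷ _) (r<n ∷ q<n ∷ []) h) = begin
      Z n w ((q , r) ∷ [])        ≈⟨ Z-flip n w q r [] ⟩
      Z n w ((r , q) ∷ [])        ≈⟨ eliminate-leaf n {w = w} r<n q<n r≢q [] ⟩
      Z n w′ []                   ≈⟨ Z-single n (support ([] ∷ []) (r<n ∷ []) dead-elsewhere) ⟩
      proj₁ (w′ r)                ≈⟨ reflexive (≡.cong proj₁ (≡.trans (set-≢ q dead w₁ r≢q) (set-≡ r (w r ⋆ edge (w q)) w))) ⟩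
      w r · edge (w q)            ∎
      where
      w₁ = set r (w r ⋆ edge (w q)) w
      w′ = set q dead w₁
      dead-elsewhere : ∀ v → v ℕ.< n → v ∉ r ∷ [] → w′ v ≋ dead
      dead-elsewhere v v<n v∉ = cases (v ℕ.≟ q)
        where
        cases : Dec (v ≡ q) → w′ v ≋ dead
        cases (yes ≡.refl) = ≡⇒≋ (set-≡ q dead w₁)
        cases (no v≢q) = ⋆.trans (≡⇒≋ (≡.trans (set-≢ q dead w₁ v≢q) (set-≢ r (w r ⋆ edge (w q)) w (λ e → v∉ (here e)))))
          (h v v<n (λ { (here e) → v∉ (here e) ; (there (here e)) → v≢q e }))
    open-value n w r q (y ∷ ys) (support ((r≢q ∷ r≢y ∷ r∉) ∷ (q≢y ∷ q∉) ∷ y∉ ∷ uniq) (r<n ∷ q<n ∷ y<n ∷ ys<n) h) = begin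
      Z n w ((q , y) ∷ cycleGo r (y ∷ ys))   ≈⟨ Z-flip n w q y (cycleGo r (y ∷ ys)) ⟩
      Z n w ((y , q) ∷ cycleGo r (y ∷ ys))
        ≈⟨ eliminate-leaf n {w = w} y<n q<n y≢q (cycleGo-avoids (y ∷ ys) r≢q (y≢q ∷ ≢-flip q∉)) ⟩
      Z n w′ (cycleGo r (y ∷ ys))
        ≈⟨ open-value n w′ r y ys (support ((r≢y ∷ r∉) ∷ y∉ ∷ uniq) (r<n ∷ y<n ∷ ys<n) dead-elsewhere) ⟩
      open-chain (w′ y) (map w′ ys) (w′ r)
        ≈⟨ reflexive (≡.trans (≡.cong₂ (λ a b → open-chain a b (w′ r)) w′y (map-updated (unchanged-all y∉ q∉))) (≡.cong (open-chain (w y ⋆ edge (w q)) (map w ys)) (unchanged r≢q r≢y))) ⟩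
      open-chain (w y ⋆ edge (w q)) (map w ys) (w r) ∎
      where
      y≢q : y ≢ q
      y≢q e = q≢y (≡.sym e)
      w₁ = set y (w y ⋆ edge (w q)) w
      w′ = set q dead w₁
      w′y : w′ y ≡ w y ⋆ edge (w q)
      w′y = ≡.trans (set-≢ q dead w₁ y≢q) (set-≡ y (w y ⋆ edge (w q)) w)
      unchanged : ∀ {v} → v ≢ q → v ≢ y → w′ v ≡ w v
      unchanged v≢q v≢y = ≡.trans (set-≢ q dead w₁ v≢q) (set-≢ y (w y ⋆ edge (w q)) w v≢y)
      unchanged-all : ∀ {vs} → All (y ≢_) vs → All (q ≢_) vs → All (λ v → w′ v ≡ w v) vs
      unchanged-all [] [] = []
      unchanged-all (a ∷ as) (b ∷ bs) = unchanged (λ e → b (≡.sym e)) (λ e → a (≡.sym e)) ∷ unchanged-all as bs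
      dead-elsewhere : ∀ v → v ℕ.< n → v ∉ r ∷ y ∷ ys → w′ v ≋ dead
      dead-elsewhere v v<n v∉ = cases (v ℕ.≟ q)
        where
        cases : Dec (v ≡ q) → w′ v ≋ dead
        cases (yes ≡.refl) = ≡⇒≋ (set-≡ q dead w₁)
        cases (no v≢q) = ⋆.trans (≡⇒≋ (unchanged v≢q (λ e → v∉ (there (here e)))))
          (h v v<n (λ { (here e) → v∉ (here e) ; (there (here e)) → v≢q e ; (there (there h)) → v∉ (there h) }))

    contract-cycle : ∀ {r q} qs → r ≢ q → All (q ≢_) qs → map (contractE r q) (cycleGo r (q ∷ qs)) ≡ cycleGo r (r ∷ qs)
    contract-cycle {r} {q} qs r≢q q∉ = go qs q∉
      where
      contract-q : contract r q q ≡ r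
      contract-q with q ℕ.≟ q
      ... | yes _ = ≡.refl
      ... | no ¬e = contradiction ≡.refl ¬e
      contract-≢ : ∀ {v} → v ≢ q → contract r q v ≡ v
      contract-≢ {v} v≢q with v ℕ.≟ q
      ... | yes e = contradiction e v≢q
      ... | no _ = ≡.refl
      go : ∀ qs → All (q ≢_) qs → map (contractE r q) (cycleGo r (q ∷ qs)) ≡ cycleGo r (r ∷ qs)
      go [] [] = ≡.cong (_∷ []) (≡.cong₂ _,_ contract-q (contract-≢ r≢q))
      go (y ∷ ys) (q≢y ∷ q∉) = ≡.cong₂ _∷_ (≡.cong₂ _,_ contract-q (contract-≢ (λ e → q≢y (≡.sym e))))
        (contract-avoids r (cycleGo r (y ∷ ys)) (cycleGo-avoids (y ∷ ys) r≢q ((λ e → q≢y (≡.sym e)) ∷ ≢-flip q∉)))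

    -- Deletion opens the cycle to a path; contraction shortens it, through a double edge, down to a
    -- loop with zero Laplacian. The induction therefore passes through graphs that are not simple.
    cycle-value : ∀ n w r rs → Support n w (r ∷ rs) → Z n w (cycleGo r (r ∷ rs)) ≈ cycle (map w (r ∷ rs))
    cycle-value n w r [] h = begin
      Z n w ((r , r) ∷ [])   ≈⟨ Z-loop n w r [] ⟩
      Z n w []               ≈⟨ Z-single n h ⟩
      proj₁ (w r)
        ≈⟨ solve 2 (λ f d → f := f :* (con 1 :+ con 0) :+ d :* con 0 :+ f :* con 0 :+ d :* (con 0 :+ con 0)) refl (proj₁ (w r)) (proj₂ (w r)) ⟩
      cycle (w r ∷ [])       ∎
    cycle-value n w r (q ∷ qs) S@(support ((r≢q ∷ r∉) ∷ q∉ ∷ uniq) (r<n ∷ q<n ∷ qs<n) h) = begin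
      Z n w ((r , q) ∷ cycleGo r (q ∷ qs))
        ≈⟨ dc ⟩
      Z n w (cycleGo r (q ∷ qs)) + Z n w′ (map (contractE r q) (cycleGo r (q ∷ qs)))
        ≈⟨ +-cong (open-value n w r q qs S)
             (trans (reflexive (≡.cong (Z n w′) (contract-cycle qs r≢q q∉)))
               (cycle-value n w′ r qs (support (r∉ ∷ uniq) (r<n ∷ qs<n) dead-elsewhere))) ⟩
      open-chain (w q) (map w qs) (w r) + cycle (map w′ (r ∷ qs))
        ≈⟨ +-congˡ (reflexive (≡.cong cycle (≡.cong₂ _∷_ (contractW-a w r≢q) (map-updated (unchanged-all r∉ q∉))))) ⟩
      open-chain (w q) (map w qs) (w r) + cycle (w r ⋆ w q ∷ map w qs)
        ≈⟨ cycle-deletion-contraction (w r) (w q) (map w qs) ⟨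
      cycle (map w (r ∷ q ∷ qs)) ∎
      where
      w′ = contractW r q w
      es = cycleGo r (q ∷ qs)
      dc : Z n w ((r , q) ∷ es) ≈ Z n w es + Z n w′ (map (contractE r q) es)
      dc = ≡.subst₂ (λ r′ q′ → Z n w ((r′ , q′) ∷ es) ≈ Z n w es + Z n (contractW r′ q′ w) (map (contractE r′ q′) es))
        (Fin.toℕ-fromℕ< r<n) (Fin.toℕ-fromℕ< q<n)
        (deletion-contraction n (λ e → r≢q (≡.trans (≡.sym (Fin.toℕ-fromℕ< r<n)) (≡.trans (≡.cong toℕ e) (Fin.toℕ-fromℕ< q<n)))) w es)
      unchanged-all : ∀ {vs} → All (r ≢_) vs → All (q ≢_) vs → All (λ v → w′ v ≡ w v) vs
      unchanged-all [] [] = []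
      unchanged-all (a ∷ as) (b ∷ bs) = contractW-other w (λ e → a (≡.sym e)) (λ e → b (≡.sym e)) ∷ unchanged-all as bs
      dead-elsewhere : ∀ v → v ℕ.< n → v ∉ r ∷ qs → w′ v ≋ dead
      dead-elsewhere v v<n v∉ = cases (v ℕ.≟ q)
        where
        cases : Dec (v ≡ q) → w′ v ≋ dead
        cases (yes ≡.refl) = ≡⇒≋ (contractW-b r q w)
        cases (no v≢q) = ⋆.trans (≡⇒≋ (contractW-other w (λ e → v∉ (here e)) v≢q))
          (h v v<n (λ { (here e) → v∉ (here e) ; (there (here e)) → v≢q e ; (there (there h)) → v∉ (there h) }))

    chain-cong : ∀ {us vs} → Pointwise _≋_ us vs → chain us ≈ₛ chain vs
    chain-cong [] = mk≈ₛ refl refl refl refl refl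
    chain-cong (e ∷ es) = ◁-cong e (chain-cong es)

    cycle-cong : ∀ {us vs} → Pointwise _≋_ us vs → cycle us ≈ cycle vs
    cycle-cong es = let mk≈ₛ _ p _ _ s = chain-cong es in +-cong p s

    Z-unicyclic : ∀ t ts → Z (sizes (t ∷ ts)) (λ _ → vertex) (cycleEdges (rootLabels 0 (t ∷ ts)) ++ allTreeEdges 0 (t ∷ ts)) ≈
      cycle (map pairT (t ∷ ts))
    Z-unicyclic t ts = begin
      Z n (λ _ → vertex) (C ++ allTreeEdges 0 (t ∷ ts))   ≈⟨ Z-↭ n (λ _ → vertex) (++-comm C (allTreeEdges 0 (t ∷ ts))) ⟩
      Z n (λ _ → vertex) (allTreeEdges 0 (t ∷ ts) ++ C)   ≈⟨ E.Z≈ ⟩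
      Z n E.w′ C
        ≈⟨ cycle-value n E.w′ 0 (rootLabels (size t) ts) (support (rootLabels-unique 0 (t ∷ ts)) (rootLabels-< 0 (t ∷ ts)) (λ v → E.others v z≤n)) ⟩
      cycle (map E.w′ (rootLabels 0 (t ∷ ts)))            ≈⟨ cycle-cong (values E.roots) ⟩
      cycle (map pairT (t ∷ ts))                          ∎
      where
      n = sizes (t ∷ ts)
      C = cycleEdges (rootLabels 0 (t ∷ ts))
      elimination = eliminate-trees n (λ _ → vertex) 0 (t ∷ ts) C ℕ.≤-refl (λ _ _ _ → ⋆.refl)
        (λ v _ _ v∉ → cycleGo-avoids (rootLabels 0 (t ∷ ts)) (λ e → v∉ (here (≡.sym e))) (∉⇒All-≢ v (rootLabels 0 (t ∷ ts)) v∉))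
      module E = TreesElimination elimination
      values : ∀ {rs us} → Pointwise (λ r t → E.w′ r ≋ pairT t) rs us → Pointwise _≋_ (map E.w′ rs) (map pairT us)
      values [] = []
      values (e ∷ es) = e ∷ values es

-- From the defined Laplacian coefficients to the weighted determinant.

module CharacteristicPolynomials where
  open import Defs
  open Determinants
  open EdgeLaplacians
  open AlternatingPolynomials
  open import Algebra.Bundles using (CommutativeRing)
  open import Data.Bool using (true; false; if_then_else_; T; _∧_)
  open import Data.Unit using (tt)
  open import Data.Fin as Fin using (Fin; zero; suc; toℕ; fromℕ<; punchIn)
  import Data.Fin.Properties as Fin
  open import Data.Integer as ℤ using (ℤ; +_; -_; 0ℤ; 1ℤ)
  import Data.Integer.Properties as ℤ
  open import Data.Integer.Solver using (module +-*-Solver)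
  open import Data.List using (List; []; _∷_; map; foldr; tabulate; length)
  open import Data.List.Relation.Unary.All using (All; []; _∷_)
  open import Data.Nat as ℕ using (ℕ; zero; suc; z≤n; s≤s; _≡ᵇ_)
  import Data.Nat.Properties as ℕ
  open import Data.Product using (_×_; _,_; proj₁)
  open import Data.Sum using (_⊎_; inj₁; inj₂)
  open import Relation.Nullary using (yes; no; contradiction; Dec; ¬_)
  open import Relation.Binary.PropositionalEquality as ≡ using (_≡_; _≢_)
  open import Algebra.Properties.CommutativeMonoid.Sum ℕ.+-0-commutativeMonoid using () renaming (sum to sumF; sum-remove to sumF-remove; sum-cong-≗ to sumF-cong; sum-replicate-zero to sumF-zero; ∑-distrib-+ to sumF-+)

  private module R where
    open CommutativeRing polyRing public hiding (zero)
    open import Algebra.Properties.Ring ring public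
    open import Algebra.Properties.Semiring.Sum semiring public using (sum)
  open _≈ₚ_
  open Determinant polyRing using (sg; detᴿ; det-cong; det-neg)
  open GraphDeterminant polyRing using (δ; χ; lap; entry; Z)

  constant : ℤ → Poly
  constant a = a ∷ []

  constant-* : ∀ a p → constant a *ₚ p ≈ₚ scaleₚ a p
  constant-* a p = R.trans (R.+-congˡ {scaleₚ a p} {0ℤ ∷ []} {[]} (coeffs≡ λ { zero → ≡.refl ; (suc k) → ≡.refl })) (R.+-identityʳ _)

  sg-constant : ∀ k → sg k ≈ₚ constant (sgn k)
  sg-constant zero = R.refl
  sg-constant (suc k) = R.trans (R.-‿cong (sg-constant k)) (coeffs≡ λ { zero → ℤ.-1*i≡-i (sgn k) ; (suc j) → ≡.refl })

  scale-sgn : ∀ k p → scaleₚ (sgn k) p ≈ₚ sg k *ₚ p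
  scale-sgn k p = R.sym (R.trans (R.*-congʳ (sg-constant k)) (constant-* (sgn k) p))

  det-detᴿ : ∀ n M → det n M ≈ₚ detᴿ n M
  det-detᴿ zero M = R.refl
  det-detᴿ (suc n) M = fold (λ i → i)
    where
    term : Fin (suc n) → Poly
    term j = scaleₚ (sgn (toℕ j)) (M zero j *ₚ det n (λ r c → M (suc r) (punchIn j c)))
    termᴿ : Fin (suc n) → Poly
    termᴿ j = sg (toℕ j) *ₚ (M zero j *ₚ detᴿ n (λ r c → M (suc r) (punchIn j c)))
    fold : ∀ {m} (f : Fin m → Fin (suc n)) → foldr _+ₚ_ [] (map term (tabulate f)) ≈ₚ R.sum (λ i → termᴿ (f i))
    fold {zero} f = R.refl
    fold {suc m} f = R.+-cong
      (R.trans (scale-sgn (toℕ j) _) (R.*-congˡ {x = sg (toℕ j)} (R.*-congˡ {x = M zero j} (det-detᴿ n (λ r c → M (suc r) (punchIn j c))))))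
      (fold (λ i → f (suc i)))
      where j = f zero

  -- Multiplicities, degrees and the incidence form of the Laplacian

  Proper : ℕ → ℕ × ℕ → Set
  Proper n (a , b) = a ≢ b × a ℕ.< n × b ℕ.< n

  SameEdge : ℕ × ℕ → ℕ × ℕ → Set
  SameEdge (i , j) (a , b) = (a ≡ i × b ≡ j) ⊎ (a ≡ j × b ≡ i)

  ≡ᵇ-refl : ∀ a → (a ≡ᵇ a) ≡ true
  ≡ᵇ-refl zero = ≡.refl
  ≡ᵇ-refl (suc a) = ≡ᵇ-refl a

  ≡ᵇ-≢ : ∀ {a b} → a ≢ b → (a ≡ᵇ b) ≡ false
  ≡ᵇ-≢ {a} {b} a≢b with a ≡ᵇ b in eq
  ... | true = contradiction (ℕ.≡ᵇ⇒≡ a b (≡.subst T (≡.sym eq) tt)) a≢b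
  ... | false = ≡.refl

  hit-same : ∀ {i j e} → SameEdge (i , j) e → hit i j e ≡ 1
  hit-same {i} {j} (inj₁ (≡.refl , ≡.refl)) rewrite ≡ᵇ-refl i | ≡ᵇ-refl j = ≡.refl
  hit-same {i} {j} (inj₂ (≡.refl , ≡.refl)) rewrite ≡ᵇ-refl i | ≡ᵇ-refl j with (j ≡ᵇ i) ∧ (i ≡ᵇ j)
  ... | true = ≡.refl
  ... | false = ≡.refl

  ∧-false : ∀ {a i b j} → ¬ (a ≡ i × b ≡ j) → ((a ≡ᵇ i) ∧ (b ≡ᵇ j)) ≡ false
  ∧-false {a} {i} {b} {j} h with a ℕ.≟ i
  ... | no a≢i rewrite ≡ᵇ-≢ a≢i = ≡.refl
  ... | yes ≡.refl rewrite ≡ᵇ-refl a = ≡ᵇ-≢ (λ e → h (≡.refl , e))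

  hit-different : ∀ {i j e} → ¬ SameEdge (i , j) e → hit i j e ≡ 0
  hit-different {i} {j} {a , b} h
    rewrite ∧-false {a} {i} {b} {j} (λ p → h (inj₁ p)) | ∧-false {a} {j} {b} {i} (λ p → h (inj₂ p)) = ≡.refl

  sumℕ-tabulate : ∀ {n m} (f : Fin n → ℕ) (g : Fin m → Fin n) → sumℕ (map f (tabulate g)) ≡ sumF (λ i → f (g i))
  sumℕ-tabulate {m = zero} f g = ≡.refl
  sumℕ-tabulate {m = suc m} f g = ≡.cong (f (g zero) ℕ.+_) (sumℕ-tabulate f (λ i → g (suc i)))

  sumF-single : ∀ {n} (k : Fin n) (f : Fin n → ℕ) → (∀ j → j ≢ k → f j ≡ 0) → sumF f ≡ f k
  sumF-single {suc n} k f h = ≡.trans (sumF-remove {i = k} f)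
    (≡.trans (≡.cong (f k ℕ.+_) (≡.trans (sumF-cong (λ j → h (punchIn k j) (Fin.punchInᵢ≢i k j))) (sumF-zero n))) (ℕ.+-identityʳ _))

  incidence : ℕ → ℕ × ℕ → ℕ
  incidence i (a , b) = choose (i ℕ.≟ a) 1 0 ℕ.+ choose (i ℕ.≟ b) 1 0

  row-hits : ∀ {n i} e → Proper n e → sumF {n} (λ j → hit i (toℕ j) e) ≡ incidence i e
  row-hits {n} {i} (a , b) (a≢b , a<n , b<n) with i ℕ.≟ a | i ℕ.≟ b
  ... | yes ≡.refl | yes ≡.refl = contradiction ≡.refl a≢b
  ... | yes ≡.refl | no _ = ≡.trans (sumF-single (fromℕ< b<n) (λ j → hit i (toℕ j) (a , b)) (λ j j≢b → hit-different {i} {toℕ j} {a , b} λ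
          { (inj₁ (_ , e)) → j≢b (Fin.toℕ-injective (≡.trans (≡.sym e) (≡.sym (Fin.toℕ-fromℕ< b<n)))) ; (inj₂ (_ , e)) → a≢b (≡.sym e) }))
      (hit-same {i} {toℕ (fromℕ< b<n)} (inj₁ (≡.refl , ≡.sym (Fin.toℕ-fromℕ< b<n))))
  ... | no _ | yes ≡.refl = ≡.trans (sumF-single (fromℕ< a<n) (λ j → hit i (toℕ j) (a , b)) (λ j j≢a → hit-different {i} {toℕ j} {a , b} λ
          { (inj₂ (e , _)) → j≢a (Fin.toℕ-injective (≡.trans (≡.sym e) (≡.sym (Fin.toℕ-fromℕ< a<n)))) ; (inj₁ (e , _)) → a≢b e }))
      (hit-same {i} {toℕ (fromℕ< a<n)} (inj₂ (≡.sym (Fin.toℕ-fromℕ< a<n) , ≡.refl)))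
  ... | no i≢a | no i≢b = ≡.trans (sumF-cong {n} (λ j → hit-different {i} {toℕ j} {a , b} λ
          { (inj₁ (e , _)) → i≢a (≡.sym e) ; (inj₂ (_ , e)) → i≢b (≡.sym e) })) (sumF-zero n)

  deg-incidence : ∀ n es i → All (Proper n) es → deg (mkGraph n es) i ≡ sumℕ (map (incidence i) es)
  deg-incidence n es i h = ≡.trans (sumℕ-tabulate {n} {n} (λ j → mult (mkGraph n es) i (toℕ j)) (λ j → j)) (go es h)
    where
    go : ∀ es → All (Proper n) es → sumF {n} (λ j → sumℕ (map (hit i (toℕ j)) es)) ≡ sumℕ (map (incidence i) es)
    go [] [] = sumF-zero n
    go (e ∷ es) (h ∷ hs) = ≡.trans (sumF-+ {n} (λ j → hit i (toℕ j) e) (λ j → sumℕ (map (hit i (toℕ j)) es)))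
      (≡.cong₂ ℕ._+_ (row-hits e h) (go es hs))

  δ-constant : ∀ a i → δ a i ≈ₚ constant (choose (a ℕ.≟ i) 1ℤ 0ℤ)
  δ-constant a i with a ℕ.≟ i
  ... | yes _ = R.refl
  ... | no _ = coeffs≡ λ { zero → ≡.refl ; (suc k) → ≡.refl }

  χℤ : ℕ × ℕ → ℕ → ℤ
  χℤ (a , b) i = choose (a ℕ.≟ i) 1ℤ 0ℤ ℤ.- choose (b ℕ.≟ i) 1ℤ 0ℤ

  χ-constant : ∀ e i → χ e i ≈ₚ constant (χℤ e i)
  χ-constant (a , b) i = R.trans (R.+-cong (δ-constant a i) (R.-‿cong (δ-constant b i)))
    (coeffs≡ λ { zero → ≡.cong (λ u → choose (a ℕ.≟ i) 1ℤ 0ℤ ℤ.+ u) (ℤ.-1*i≡-i (choose (b ℕ.≟ i) 1ℤ 0ℤ)) ; (suc k) → ≡.refl })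

  lapℤ : List (ℕ × ℕ) → ℕ → ℕ → ℤ
  lapℤ [] i j = 0ℤ
  lapℤ (e ∷ es) i j = χℤ e i ℤ.* χℤ e j ℤ.+ lapℤ es i j

  lap-constant : ∀ es i j → lap es i j ≈ₚ constant (lapℤ es i j)
  lap-constant [] i j = coeffs≡ λ { zero → ≡.refl ; (suc k) → ≡.refl }
  lap-constant (e ∷ es) i j = R.trans (R.+-cong
      (R.trans (R.*-cong (χ-constant e i) (χ-constant e j)) (constant-* (χℤ e i) (constant (χℤ e j))))
      (lap-constant es i j))
    (coeffs≡ λ { zero → ≡.refl ; (suc k) → ≡.refl })

  χℤ-diagonal : ∀ {n} e i → Proper n e → χℤ e i ℤ.* χℤ e i ≡ + incidence i e
  χℤ-diagonal (a , b) i (a≢b , _) with a ℕ.≟ i | b ℕ.≟ i | i ℕ.≟ a | i ℕ.≟ b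
  ... | yes ≡.refl | yes ≡.refl | _ | _ = contradiction ≡.refl a≢b
  ... | yes p | _ | no q | _ = contradiction (≡.sym p) q
  ... | no p | _ | yes q | _ = contradiction (≡.sym q) p
  ... | _ | yes p | _ | no q = contradiction (≡.sym p) q
  ... | _ | no p | _ | yes q = contradiction (≡.sym q) p
  ... | yes _ | no _ | yes _ | no _ = ≡.refl
  ... | no _ | yes _ | no _ | yes _ = ≡.refl
  ... | no _ | no _ | no _ | no _ = ≡.refl

  χℤ-off-diagonal : ∀ {n} e i j → Proper n e → i ≢ j → χℤ e i ℤ.* χℤ e j ≡ - (+ hit i j e)
  χℤ-off-diagonal (a , b) i j (a≢b , _) i≢j with a ℕ.≟ i | b ℕ.≟ i | a ℕ.≟ j | b ℕ.≟ j
  ... | yes ≡.refl | yes ≡.refl | _ | _ = contradiction ≡.refl a≢b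
  ... | _ | _ | yes ≡.refl | yes ≡.refl = contradiction ≡.refl a≢b
  ... | yes ≡.refl | _ | yes ≡.refl | _ = contradiction ≡.refl i≢j
  ... | _ | yes ≡.refl | _ | yes ≡.refl = contradiction ≡.refl i≢j
  ... | yes ≡.refl | no _ | no _ | yes ≡.refl = ≡.sym (≡.cong (λ u → - (+ u)) (hit-same {i} {j} (inj₁ (≡.refl , ≡.refl))))
  ... | no _ | yes ≡.refl | yes ≡.refl | no _ = ≡.sym (≡.cong (λ u → - (+ u)) (hit-same {i} {j} (inj₂ (≡.refl , ≡.refl))))
  ... | no p | no q | c | d = ≡.sym (≡.cong (λ u → - (+ u)) (hit-different {i} {j} {a , b} λ { (inj₁ (e , _)) → p e ; (inj₂ (_ , e)) → q e }))
  ... | yes p | no q | no r | no s = ≡.sym (≡.cong (λ u → - (+ u)) (hit-different {i} {j} {a , b} λ { (inj₁ (_ , e)) → s e ; (inj₂ (e , _)) → r e }))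
  ... | no p | yes q | no r | no s = ≡.sym (≡.cong (λ u → - (+ u)) (hit-different {i} {j} {a , b} λ { (inj₁ (e , _)) → p e ; (inj₂ (e , _)) → r e }))

  lapℤ-diagonal : ∀ {n} es i → All (Proper n) es → lapℤ es i i ≡ + sumℕ (map (incidence i) es)
  lapℤ-diagonal [] i [] = ≡.refl
  lapℤ-diagonal (e ∷ es) i (h ∷ hs) = ≡.trans (≡.cong₂ ℤ._+_ (χℤ-diagonal e i h) (lapℤ-diagonal es i hs)) (≡.sym (ℤ.pos-+ (incidence i e) _))

  lapℤ-off-diagonal : ∀ {n} es i j → All (Proper n) es → i ≢ j → lapℤ es i j ≡ - (+ sumℕ (map (hit i j) es))
  lapℤ-off-diagonal [] i j [] _ = ≡.refl
  lapℤ-off-diagonal (e ∷ es) i j (h ∷ hs) i≢j = ≡.trans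
    (≡.cong₂ ℤ._+_ (χℤ-off-diagonal e i j h i≢j) (lapℤ-off-diagonal es i j hs i≢j))
    (≡.trans (≡.sym (ℤ.neg-distrib-+ (+ hit i j e) _)) (≡.cong -_ (≡.sym (ℤ.pos-+ (hit i j e) _))))

  laplacian-lapℤ : ∀ n es (i j : Fin n) → All (Proper n) es → laplacian (mkGraph n es) i j ≡ lapℤ es (toℕ i) (toℕ j)
  laplacian-lapℤ n es i j h with toℕ i ℕ.≟ toℕ j
  ... | yes e rewrite e | ≡ᵇ-refl (toℕ j) = ≡.trans (≡.cong +_ (deg-incidence n es (toℕ j) h)) (≡.sym (lapℤ-diagonal es (toℕ j) h))
  ... | no ¬e rewrite ≡ᵇ-≢ ¬e = ≡.sym (lapℤ-off-diagonal es (toℕ i) (toℕ j) h ¬e)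

  xₚ : Poly
  xₚ = proj₁ xₐ

  charEntry : (G : Graph) → Fin (order G) → Fin (order G) → Poly
  charEntry G i j = (if toℕ i ≡ᵇ toℕ j then 0ℤ ∷ 1ℤ ∷ [] else []) +ₚ ((- laplacian G i j) ∷ [])

  charEntry-entry : ∀ n es (i j : Fin n) → All (Proper n) es →
    charEntry (mkGraph n es) i j ≈ₚ R.- entry (λ _ → xₚ , 1ℤ ∷ []) es (toℕ i) (toℕ j)
  charEntry-entry n es i j h = R.trans (R.+-cong (diagonal (toℕ i ℕ.≟ toℕ j)) off)
    (R.-‿+-comm (δ (toℕ i) (toℕ j) *ₚ xₚ) (R.1# *ₚ lap es (toℕ i) (toℕ j)))
    where
    diagonal : Dec (toℕ i ≡ toℕ j) → (if toℕ i ≡ᵇ toℕ j then 0ℤ ∷ 1ℤ ∷ [] else []) ≈ₚ R.- (δ (toℕ i) (toℕ j) *ₚ xₚ)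
    choice : ∀ {b} → (toℕ i ≡ᵇ toℕ j) ≡ b → (if toℕ i ≡ᵇ toℕ j then 0ℤ ∷ 1ℤ ∷ [] else []) ≈ₚ (if b then 0ℤ ∷ 1ℤ ∷ [] else [])
    choice e = R.reflexive (≡.cong (λ b → if b then 0ℤ ∷ 1ℤ ∷ [] else []) e)
    diagonal (yes e) = R.trans (choice (≡.trans (≡.cong (_≡ᵇ toℕ j) e) (≡ᵇ-refl (toℕ j))))
      (R.sym (R.trans (R.-‿cong (R.trans (R.*-congʳ (R.trans (R.reflexive (≡.cong (λ a → δ a (toℕ j)) e)) (GraphDeterminant.δ-refl polyRing (toℕ j)))) (R.*-identityˡ xₚ)))
        (coeffs≡ λ { zero → ≡.refl ; (suc zero) → ≡.refl ; (suc (suc k)) → ≡.refl })))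
    diagonal (no ¬e) = R.trans (choice (≡ᵇ-≢ ¬e))
      (R.sym (R.trans (R.-‿cong (R.trans (R.*-congʳ (GraphDeterminant.δ-≢ polyRing ¬e)) (R.zeroˡ xₚ))) R.-0#≈0#))
    off : (- laplacian (mkGraph n es) i j) ∷ [] ≈ₚ R.- (R.1# *ₚ lap es (toℕ i) (toℕ j))
    off = R.sym (R.trans (R.-‿cong (R.trans (R.*-identityˡ _) (lap-constant es (toℕ i) (toℕ j))))
      (coeffs≡ λ { zero → ≡.trans (ℤ.-1*i≡-i _) (≡.cong -_ (≡.sym (laplacian-lapℤ n es i j h))) ; (suc k) → ≡.refl }))

  -- With x = -λ the matrix λI - L is -(xI + L), and the pair (x , 1) at each vertex gives xI + L.
  charPoly-Z : ∀ n es → All (Proper n) es → charPoly (mkGraph n es) ≈ₚ sg n *ₚ Z n (λ _ → xₚ , 1ℤ ∷ []) es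
  charPoly-Z n es h = R.trans (det-detᴿ n (charEntry (mkGraph n es)))
    (R.trans (det-cong n {charEntry (mkGraph n es)} {λ i j → R.- entry (λ _ → xₚ , 1ℤ ∷ []) es (toℕ i) (toℕ j)} (λ i j → charEntry-entry n es i j h))
      (det-neg n (λ i j → entry (λ _ → xₚ , 1ℤ ∷ []) es (toℕ i) (toℕ j))))

  sgn² : ∀ k → sgn k ℤ.* sgn k ≡ 1ℤ
  sgn² zero = ≡.refl
  sgn² (suc k) = ≡.trans (solve 1 (λ s → :- s :* :- s := s :* s) ≡.refl (sgn k)) (sgn² k)
    where open +-*-Solver

  sgn-+ : ∀ j k → sgn (j ℕ.+ k) ≡ sgn j ℤ.* sgn k
  sgn-+ zero k = ≡.sym (ℤ.*-identityˡ _)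
  sgn-+ (suc j) k = ≡.trans (≡.cong -_ (sgn-+ j k)) (ℤ.neg-distribˡ-* (sgn j) (sgn k))

  -- The signs of k and n combine to that of n - k, so c_k is the coefficient of the power n - k of
  -- x = -λ in p.
  lapCoeff-coeff : ∀ n es k p → k ℕ.≤ n → charPoly (mkGraph n es) ≈ₚ sg n *ₚ p →
    lapCoeff (mkGraph n es) k ≡ sgn (n ℕ.∸ k) ℤ.* coeff p (n ℕ.∸ k)
  lapCoeff-coeff n es k p k≤n h = begin
    sgn k ℤ.* coeff (charPoly (mkGraph n es)) m     ≡⟨ ≡.cong (sgn k ℤ.*_) (at (R.trans h (R.sym (scale-sgn n p))) m) ⟩
    sgn k ℤ.* coeff (scaleₚ (sgn n) p) m            ≡⟨ ≡.cong (sgn k ℤ.*_) (coeff-scale (sgn n) p m) ⟩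
    sgn k ℤ.* (sgn n ℤ.* coeff p m)                 ≡⟨ ≡.cong (λ s → sgn k ℤ.* (s ℤ.* coeff p m)) (≡.trans (≡.cong sgn (≡.sym (ℕ.m+[n∸m]≡n k≤n))) (sgn-+ k m)) ⟩
    sgn k ℤ.* (sgn k ℤ.* sgn m ℤ.* coeff p m)
      ≡⟨ solve 3 (λ s t c → s :* (s :* t :* c) := s :* s :* (t :* c)) ≡.refl (sgn k) (sgn m) (coeff p m) ⟩
    sgn k ℤ.* sgn k ℤ.* (sgn m ℤ.* coeff p m)       ≡⟨ ≡.cong (ℤ._* (sgn m ℤ.* coeff p m)) (sgn² k) ⟩
    1ℤ ℤ.* (sgn m ℤ.* coeff p m)                    ≡⟨ ℤ.*-identityˡ _ ⟩
    sgn m ℤ.* coeff p m                             ∎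
    where
    open ≡.≡-Reasoning
    open +-*-Solver
    m = n ℕ.∸ k

  length-+ : ∀ {m} p q → length p ℕ.≤ m → length q ℕ.≤ m → length (p +ₚ q) ℕ.≤ m
  length-+ [] q hp hq = hq
  length-+ (a ∷ p) [] hp hq = hp
  length-+ (a ∷ p) (b ∷ q) (s≤s hp) (s≤s hq) = s≤s (length-+ p q hp hq)

  length-scale : ∀ a p → length (scaleₚ a p) ≡ length p
  length-scale a [] = ≡.refl
  length-scale a (b ∷ p) = ≡.cong suc (length-scale a p)

  length-* : ∀ {m n} p q → length p ℕ.≤ m → length q ℕ.≤ suc n → length (p *ₚ q) ℕ.≤ m ℕ.+ n
  length-* [] q hp hq = z≤n
  length-* {suc m} {n} (a ∷ p) q (s≤s hp) hq = length-+ (scaleₚ a q) (0ℤ ∷ (p *ₚ q))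
    (≡.subst (ℕ._≤ suc m ℕ.+ n) (≡.sym (length-scale a q)) (ℕ.≤-trans hq (s≤s (ℕ.m≤n+m n m))))
    (s≤s (length-* p q hp hq))

  length-det : ∀ n M → (∀ i j → length (M i j) ℕ.≤ 2) → length (det n M) ℕ.≤ suc n
  length-det zero M h = s≤s z≤n
  length-det (suc n) M h = go (λ i → i)
    where
    go : ∀ {m} (f : Fin m → Fin (suc n)) →
      length (foldr _+ₚ_ [] (map (λ j → scaleₚ (sgn (toℕ j)) (M zero j *ₚ det n (λ r c → M (suc r) (punchIn j c)))) (tabulate f))) ℕ.≤ suc (suc n)
    go {zero} f = z≤n
    go {suc m} f = length-+ (scaleₚ (sgn (toℕ (f zero))) (product (f zero))) _
      (≡.subst (ℕ._≤ suc (suc n)) (≡.sym (length-scale (sgn (toℕ (f zero))) (product (f zero))))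
        (length-* (M zero (f zero)) (det n (λ r c → M (suc r) (punchIn (f zero) c))) (h zero (f zero))
          (length-det n (λ r c → M (suc r) (punchIn (f zero) c)) (λ i j → h (suc i) (punchIn (f zero) j)))))
      (go (λ i → f (suc i)))
      where
      product : Fin (suc n) → Poly
      product j = M zero j *ₚ det n (λ r c → M (suc r) (punchIn j c))

  coeff-beyond : ∀ p k → length p ℕ.≤ k → coeff p k ≡ 0ℤ
  coeff-beyond [] k h = ≡.refl
  coeff-beyond (a ∷ p) (suc k) (s≤s h) = coeff-beyond p k h

  -- The c_k with k ≤ n control degrees up to n only; this closes the gap to equality of
  -- polynomials.
  charPoly-beyond : ∀ G k → order G ℕ.< k → coeff (charPoly G) k ≡ 0ℤ
  charPoly-beyond G k h = coeff-beyond (charPoly G) k (ℕ.≤-trans (length-det (order G) (charEntry G) (λ i j → bound (toℕ i ≡ᵇ toℕ j) i j)) h)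
    where
    bound : ∀ b i j → length ((if b then 0ℤ ∷ 1ℤ ∷ [] else []) +ₚ ((- laplacian G i j) ∷ [])) ℕ.≤ 2
    bound true i j = ℕ.≤-refl
    bound false i j = s≤s z≤n

-- Simplicity of the graphs, and invariance under isomorphism.

module GraphInvariance where
  open import Defs
  open Determinants
  open EdgeLaplacians
  open AlternatingPolynomials
  open TreeReduction
  open UnicyclicDeterminants
  open CharacteristicPolynomials
  open import Algebra.Bundles using (CommutativeRing)
  open import Data.Fin as Fin using (Fin; zero; suc; toℕ)
  import Data.Fin.Properties as Fin
  open import Data.Fin.Permutation using (↔⇒≡)
  open import Data.Integer as ℤ using (ℤ; +_)
  import Data.Integer.Properties as ℤ
  open import Data.List using (List; []; _∷_; _++_; map)
  open import Data.List.Membership.Propositional using (_∉_)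
  open import Data.List.Relation.Unary.Any using (here; there)
  open import Data.List.Relation.Unary.All as All using (All; []; _∷_)
  open import Data.List.Relation.Unary.All.Properties using (++⁺)
  open import Data.List.Relation.Unary.AllPairs using (AllPairs; []; _∷_)
  import Data.List.Relation.Unary.AllPairs.Properties as AllPairs
  open import Data.List.Relation.Unary.Unique.Propositional using (Unique)
  open import Data.List.Relation.Binary.Pointwise using (Pointwise; []; _∷_)
  open import Data.Nat as ℕ using (ℕ; zero; suc; z≤n; s≤s; _≡ᵇ_; _<ᵇ_)
  import Data.Nat.Properties as ℕ
  open import Data.Nat.ListAction.Properties using (sum-↭)
  open import Data.Product using (_×_; _,_; proj₁; proj₂)
  open import Data.Sum using (inj₁; inj₂)
  open import Function.Bundles using (_↔_; Inverse)
  open import Relation.Nullary using (yes; no; Dec; ¬_)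
  open import Relation.Binary.PropositionalEquality as ≡ using (_≡_; _≢_)
  open import Data.List.Relation.Binary.Permutation.Propositional.Properties using (++-comm; map⁺)
  open import Algebra.Properties.CommutativeMonoid.Sum ℕ.+-0-commutativeMonoid using () renaming (sum to sumF; sum-cong-≗ to sumF-cong; sum-permute to sumF-permute)

  open _≈ₚ_

  -- Simplicity of the unicyclic graphs

  Distinct : ℕ × ℕ → ℕ × ℕ → Set
  Distinct e e′ = ¬ SameEdge e e′

  Simple : List (ℕ × ℕ) → Set
  Simple = AllPairs Distinct

  distinct-second : ∀ {u v es} → Avoids v es → All (Distinct (u , v)) es
  distinct-second {u} {v} = All.map λ { (a≢v , b≢v) (inj₁ (_ , e)) → b≢v e ; (a≢v , b≢v) (inj₂ (e , _)) → a≢v e }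

  distinct-first : ∀ {u v es} → Avoids u es → All (Distinct (u , v)) es
  distinct-first = All.map λ { (a≢u , b≢u) (inj₁ (e , _)) → a≢u e ; (a≢u , b≢u) (inj₂ (_ , e)) → b≢u e }

  sameEdge? : ∀ e e′ → Dec (SameEdge e e′)
  sameEdge? (i , j) (a , b) with a ℕ.≟ i | b ℕ.≟ j | a ℕ.≟ j | b ℕ.≟ i
  ... | yes p | yes q | _ | _ = yes (inj₁ (p , q))
  ... | _ | _ | yes p | yes q = yes (inj₂ (p , q))
  ... | no p | _ | no r | _ = no λ { (inj₁ (e , _)) → p e ; (inj₂ (e , _)) → r e }
  ... | no p | _ | _ | no s = no λ { (inj₁ (e , _)) → p e ; (inj₂ (_ , e)) → s e }
  ... | _ | no q | no r | _ = no λ { (inj₁ (_ , e)) → q e ; (inj₂ (e , _)) → r e }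
  ... | _ | no q | _ | no s = no λ { (inj₁ (_ , e)) → q e ; (inj₂ (_ , e)) → s e }

  -- Isomorphisms preserve adjacency, whereas the Laplacian counts multiplicities; without repeated
  -- edges the former determines the latter.
  mult≤1 : ∀ es i j → Simple es → sumℕ (map (hit i j) es) ℕ.≤ 1
  mult≤1 [] i j [] = z≤n
  mult≤1 (e ∷ es) i j (d ∷ ds) with sameEdge? (i , j) e
  ... | no ¬same rewrite hit-different {i} {j} {e} ¬same = mult≤1 es i j ds
  ... | yes same rewrite hit-same {i} {j} {e} same = ℕ.≤-reflexive (≡.cong suc (none es d))
    where
    joint : ∀ {i j e e′} → SameEdge (i , j) e → SameEdge (i , j) e′ → SameEdge e e′
    joint (inj₁ (≡.refl , ≡.refl)) s = s
    joint (inj₂ (≡.refl , ≡.refl)) (inj₁ (p , q)) = inj₂ (p , q)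
    joint (inj₂ (≡.refl , ≡.refl)) (inj₂ (p , q)) = inj₁ (p , q)
    none : ∀ es → All (Distinct e) es → sumℕ (map (hit i j) es) ≡ 0
    none [] [] = ≡.refl
    none (e′ ∷ es) (h ∷ hs) = ≡.cong₂ ℕ._+_ (hit-different {i} {j} {e′} (λ s → h (joint same s))) (none es hs)

  -- The second end of a tree edge is a child, with a label in the block of the forest. Edges that
  -- avoid this label are distinct from the edge.
  forestEdges-seconds : ∀ (Q : ℕ → Set) p o ts → (∀ v → o ℕ.≤ v → v ℕ.< o ℕ.+ sizes ts → Q v) →
    All (λ e → Q (proj₂ e)) (forestEdges p o ts)
  forestEdges-seconds Q p o [] h = []
  forestEdges-seconds Q p o (node cs ∷ ts) h =
    h o ℕ.≤-refl (ℕ.m<m+n o (s≤s z≤n)) ∷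
    ++⁺ (forestEdges-seconds Q o (suc o) cs
          (λ v o<v v< → h v (ℕ.<⇒≤ o<v) (ℕ.<-≤-trans v< (ℕ.≤-trans (ℕ.≤-reflexive (≡.sym (ℕ.+-suc o (sizes cs))))
            (ℕ.+-monoʳ-≤ o (ℕ.m≤m+n (suc (sizes cs)) (sizes ts)))))))
        (forestEdges-seconds Q p (o ℕ.+ suc (sizes cs)) ts
          (λ v h₁ h₂ → h v (ℕ.≤-trans (ℕ.m≤m+n o _) h₁) (≡.subst (v ℕ.<_) (ℕ.+-assoc o (suc (sizes cs)) (sizes ts)) h₂)))

  forestEdges-increasing : ∀ p o ts → p ℕ.< o → All (λ (u , v) → u ℕ.< v) (forestEdges p o ts)
  forestEdges-increasing p o [] p<o = []
  forestEdges-increasing p o (node cs ∷ ts) p<o = p<o ∷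
    ++⁺ (forestEdges-increasing o (suc o) cs ℕ.≤-refl) (forestEdges-increasing p (o ℕ.+ suc (sizes cs)) ts (ℕ.≤-trans p<o (ℕ.m≤m+n o _)))

  simple-forest : ∀ p o ts → p ℕ.< o → Simple (forestEdges p o ts)
  simple-forest p o [] p<o = []
  simple-forest p o (node cs ∷ ts) p<o =
    ++⁺ (distinct-first (forestEdges-All (_≢ p) o (suc o) cs (λ e → ℕ.<⇒≢ p<o (≡.sym e))
          (λ v h _ e → ℕ.<⇒≢ (ℕ.<-trans p<o h) (≡.sym e))))
        (distinct-second (forestEdges-All (_≢ o) p (o ℕ.+ s) ts (ℕ.<⇒≢ p<o)
          (λ v h _ e → ℕ.<⇒≢ (ℕ.<-≤-trans (ℕ.m<m+n o (s≤s z≤n)) h) (≡.sym e))))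
    ∷ AllPairs.++⁺ (simple-forest o (suc o) cs ℕ.≤-refl) (simple-forest p (o ℕ.+ s) ts (ℕ.≤-trans p<o (ℕ.m≤m+n o _)))
        (All.map distinct-second (forestEdges-seconds (λ v → Avoids v (forestEdges p (o ℕ.+ s) ts)) o (suc o) cs
          (λ v h₁ h₂ → forestEdges-All (_≢ v) p (o ℕ.+ s) ts (λ e → ℕ.<⇒≢ (ℕ.<-trans p<o h₁) e)
            (λ u h₃ _ e → ℕ.<⇒≢ (ℕ.<-≤-trans (≡.subst (v ℕ.<_) (≡.sym (ℕ.+-suc o (sizes cs))) h₂) h₃) (≡.sym e)))))
    where s = suc (sizes cs)

  allTreeEdges-seconds : ∀ (Q : ℕ → Set) o ts → (∀ v → o ℕ.≤ v → v ℕ.< o ℕ.+ sizes ts → v ∉ rootLabels o ts → Q v) →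
    All (λ e → Q (proj₂ e)) (allTreeEdges o ts)
  allTreeEdges-seconds Q o [] h = []
  allTreeEdges-seconds Q o (node cs ∷ ts) h = ++⁺
    (forestEdges-seconds Q o (suc o) cs (λ v h₁ h₂ → let h₃ = ≡.subst (v ℕ.<_) (≡.sym (ℕ.+-suc o (sizes cs))) h₂ in
      h v (ℕ.<⇒≤ h₁) (ℕ.<-≤-trans h₃ (ℕ.+-monoʳ-≤ o (ℕ.m≤m+n s (sizes ts))))
        λ { (here e) → ℕ.<⇒≢ h₁ (≡.sym e) ; (there k) → ℕ.<⇒≱ h₃ (All.lookup (rootLabels-≥ (o ℕ.+ s) ts) k) }))
    (allTreeEdges-seconds Q (o ℕ.+ s) ts (λ v h₁ h₂ v∉ → h v (ℕ.≤-trans (ℕ.m≤m+n o s) h₁) (≡.subst (v ℕ.<_) (ℕ.+-assoc o s (sizes ts)) h₂)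
      λ { (here e) → ℕ.<⇒≢ (ℕ.<-≤-trans (ℕ.m<m+n o (s≤s z≤n)) h₁) (≡.sym e) ; (there k) → v∉ k }))
    where s = suc (sizes cs)

  simple-trees : ∀ o ts → Simple (allTreeEdges o ts)
  simple-trees o [] = []
  simple-trees o (node cs ∷ ts) = AllPairs.++⁺ (simple-forest o (suc o) cs ℕ.≤-refl) (simple-trees (o ℕ.+ s) ts)
    (All.map distinct-second (forestEdges-seconds (λ v → Avoids v (allTreeEdges (o ℕ.+ s) ts)) o (suc o) cs
      (λ v h₁ h₂ → allTreeEdges-All (_≢ v) (o ℕ.+ s) ts
        (λ u h₃ _ e → ℕ.<⇒≢ (ℕ.<-≤-trans (≡.subst (v ℕ.<_) (≡.sym (ℕ.+-suc o (sizes cs))) h₂) h₃) (≡.sym e)))))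
    where s = suc (sizes cs)

  simple-path : ∀ r x xs → All (r ≢_) (x ∷ xs) → Unique (x ∷ xs) → Simple (cycleGo r (x ∷ xs))
  simple-path r x [] _ _ = [] ∷ []
  simple-path r x (y ∷ ys) (r≢x ∷ r∉) (x∉ ∷ u) = distinct-first (cycleGo-avoids (y ∷ ys) r≢x (≢-flip x∉)) ∷ simple-path r y ys r∉ u

  -- Two roots would give a double edge; the third keeps the first edge apart from the second and
  -- from the closing one.
  simple-cycle : ∀ r y z zs → Unique (r ∷ y ∷ z ∷ zs) → Simple (cycleGo r (r ∷ y ∷ z ∷ zs))
  simple-cycle r y z zs ((r≢y ∷ r≢z ∷ r∉) ∷ (y≢z ∷ y∉) ∷ u) =
    ((λ { (inj₁ (e , _)) → r≢y (≡.sym e) ; (inj₂ (_ , e)) → r≢z (≡.sym e) })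
      ∷ distinct-second (cycleGo-avoids (z ∷ zs) r≢y ((λ e → y≢z (≡.sym e)) ∷ ≢-flip y∉)))
    ∷ simple-path r y (z ∷ zs) (r≢y ∷ r≢z ∷ r∉) ((y≢z ∷ y∉) ∷ u)

  graphOf : List RTree → Graph
  graphOf ts = mkGraph (sizes ts) (cycleEdges (rootLabels 0 ts) ++ allTreeEdges 0 ts)

  mult-graphOf : ∀ t u v ts i j → mult (graphOf (t ∷ u ∷ v ∷ ts)) i j ℕ.≤ 1
  mult-graphOf t u v ts i j = ≡.subst (ℕ._≤ 1) (sum-↭ (map⁺ (hit i j) (++-comm A C)))
    (mult≤1 (A ++ C) i j (AllPairs.++⁺ (simple-trees 0 us) (simple-cycle 0 _ _ _ (rootLabels-unique 0 us))
      (All.map distinct-second (allTreeEdges-seconds (λ v → Avoids v C) 0 us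
        (λ v _ _ v∉ → cycleGo-avoids (rootLabels 0 us) (λ e → v∉ (here (≡.sym e))) (∉⇒All-≢ v (rootLabels 0 us) v∉))))))
    where
    us = t ∷ u ∷ v ∷ ts
    A = allTreeEdges 0 us
    C = cycleEdges (rootLabels 0 us)

  proper-path : ∀ n r x xs → r ℕ.< n → All (ℕ._< n) (x ∷ xs) → All (r ≢_) (x ∷ xs) → Unique (x ∷ xs) → All (Proper n) (cycleGo r (x ∷ xs))
  proper-path n r x [] r<n (x<n ∷ []) (r≢x ∷ []) _ = ((λ e → r≢x (≡.sym e)) , x<n , r<n) ∷ []
  proper-path n r x (y ∷ ys) r<n (x<n ∷ y<n ∷ h) (_ ∷ r∉) ((x≢y ∷ _) ∷ u) =
    (x≢y , x<n , y<n) ∷ proper-path n r y ys r<n (y<n ∷ h) r∉ u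

  proper-graphOf : ∀ t u ts → All (Proper (sizes (t ∷ u ∷ ts))) (edges (graphOf (t ∷ u ∷ ts)))
  proper-graphOf t u ts = ++⁺ (cycle-proper _ _ (rootLabels-< 0 us) (rootLabels-unique 0 us))
    (All.map combine (All.zip (increasing 0 us , allTreeEdges-All (ℕ._< n) 0 us (λ _ _ h → h))))
    where
    us = t ∷ u ∷ ts
    n = sizes us
    combine : ∀ {e} → proj₁ e ℕ.< proj₂ e × (proj₁ e ℕ.< n × proj₂ e ℕ.< n) → Proper n e
    combine (lt , h) = ℕ.<⇒≢ lt , h
    increasing : ∀ o ts → All (λ (u , v) → u ℕ.< v) (allTreeEdges o ts)
    increasing o [] = []
    increasing o (node cs ∷ ts) = ++⁺ (forestEdges-increasing o (suc o) cs ℕ.≤-refl) (increasing _ ts)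
    cycle-proper : ∀ y ys → All (ℕ._< n) (0 ∷ y ∷ ys) → Unique (0 ∷ y ∷ ys) → All (Proper n) (cycleGo 0 (0 ∷ y ∷ ys))
    cycle-proper y ys (r<n ∷ y<n ∷ h) ((r≢y ∷ r∉) ∷ u) = (r≢y , r<n , y<n) ∷ proper-path n 0 y ys r<n (y<n ∷ h) (r≢y ∷ r∉) u

  module _ {n : ℕ} (es es′ : List (ℕ × ℕ)) (f : Fin n ↔ Fin n)
    (simple : ∀ i j → mult (mkGraph n es) i j ℕ.≤ 1) (simple′ : ∀ i j → mult (mkGraph n es′) i j ℕ.≤ 1)
    (f-adj : ∀ i j → adj (mkGraph n es) (toℕ i) (toℕ j) ≡ adj (mkGraph n es′) (toℕ (Inverse.to f i)) (toℕ (Inverse.to f j)))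
    where
    private
      G = mkGraph n es
      H = mkGraph n es′
      φ = Inverse.to f

      bit : ∀ {a b} → a ℕ.≤ 1 → b ℕ.≤ 1 → (0 <ᵇ a) ≡ (0 <ᵇ b) → a ≡ b
      bit z≤n z≤n _ = ≡.refl
      bit (s≤s z≤n) (s≤s z≤n) _ = ≡.refl

      mult-φ : ∀ i j → mult G (toℕ i) (toℕ j) ≡ mult H (toℕ (φ i)) (toℕ (φ j))
      mult-φ i j = bit (simple _ _) (simple′ _ _) (f-adj i j)

      deg-φ : ∀ i → deg G (toℕ i) ≡ deg H (toℕ (φ i))
      deg-φ i = begin
        deg G (toℕ i)                                              ≡⟨ sumℕ-tabulate {n} {n} (λ j → mult G (toℕ i) (toℕ j)) (λ j → j) ⟩
        sumF {n} (λ j → mult G (toℕ i) (toℕ j))                    ≡⟨ sumF-cong {n} (mult-φ i) ⟩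
        sumF {n} (λ j → mult H (toℕ (φ i)) (toℕ (φ j)))            ≡⟨ sumF-permute (λ j → mult H (toℕ (φ i)) (toℕ j)) f ⟨
        sumF {n} (λ j → mult H (toℕ (φ i)) (toℕ j))                ≡⟨ sumℕ-tabulate {n} {n} (λ j → mult H (toℕ (φ i)) (toℕ j)) (λ j → j) ⟨
        deg H (toℕ (φ i))                                          ∎
        where open ≡.≡-Reasoning

      diagonal-φ : ∀ i j → (toℕ i ≡ᵇ toℕ j) ≡ (toℕ (φ i) ≡ᵇ toℕ (φ j))
      diagonal-φ i j with i Fin.≟ j
      ... | yes ≡.refl = ≡.trans (≡ᵇ-refl (toℕ i)) (≡.sym (≡ᵇ-refl (toℕ (φ i))))
      ... | no i≢j = ≡.trans (≡ᵇ-≢ (λ e → i≢j (Fin.toℕ-injective e)))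
        (≡.sym (≡ᵇ-≢ (λ e → i≢j (φ-injective (Fin.toℕ-injective e)))))
        where
        φ-injective : ∀ {i j} → φ i ≡ φ j → i ≡ j
        φ-injective e = ≡.trans (≡.sym (Inverse.strictlyInverseʳ f _)) (≡.trans (≡.cong (Inverse.from f) e) (Inverse.strictlyInverseʳ f _))

      charEntry-φ : ∀ i j → charEntry G i j ≡ charEntry H (φ i) (φ j)
      charEntry-φ i j rewrite diagonal-φ i j | deg-φ i | mult-φ i j = ≡.refl

    -- The bijection permutes rows and columns of the characteristic matrix simultaneously.
    charPoly-invariant : charPoly G ≈ₚ charPoly H
    charPoly-invariant = R.trans (det-detᴿ n (charEntry G)) (R.trans
      (D.det-cong n {charEntry G} {λ i j → charEntry H (φ i) (φ j)} (λ i j → R.reflexive (charEntry-φ i j)))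
      (R.trans (D.permute-rows-and-columns n f (charEntry H)) (R.sym (det-detᴿ n (charEntry H)))))
      where
      module R = CommutativeRing polyRing
      module D = Determinant polyRing

  isomorphic⇒sameCoeffs : ∀ G H → (∀ i j → mult G i j ℕ.≤ 1) → (∀ i j → mult H i j ℕ.≤ 1) → G ≅ H → sameCoeffs G H
  isomorphic⇒sameCoeffs (mkGraph n es) (mkGraph m es′) hG hH (f , f-adj) with ↔⇒≡ f
  ... | ≡.refl = ≡.refl , λ k k≤n → ≡.cong (sgn k ℤ.*_) (at (charPoly-invariant es es′ f hG hH f-adj) (n ℕ.∸ k))

-- Reordering siblings yields isomorphic graphs.

module Reorderings where
  open import Defs
  open EdgeLaplacians using (choose)
  open TreeReduction
  open UnicyclicDeterminants
  open CharacteristicPolynomials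
  open GraphInvariance
  open import Data.Fin as Fin using (Fin; zero; suc; toℕ; fromℕ<)
  import Data.Fin.Properties as Fin
  open import Data.Fin.Permutation using (permutation)
  open import Data.List using (List; []; _∷_; _++_; map)
  open import Data.List.Properties using (++-assoc; map-++; map-∘; map-id; map-cong)
  open import Data.List.Membership.Propositional using (_∉_)
  open import Data.List.Relation.Unary.Any using (here; there)
  open import Data.List.Relation.Unary.All as All using (All; []; _∷_)
  open import Data.List.Relation.Unary.All.Properties using (++⁺)
  open import Data.List.Relation.Binary.Pointwise using (Pointwise; []; _∷_)
  open import Data.Nat as ℕ using (ℕ; zero; suc; z≤n; s≤s; _≡ᵇ_; _<ᵇ_)
  import Data.Nat.Properties as ℕ
  open import Data.Nat.ListAction.Properties using (sum-↭)
  open import Data.Product using (_×_; _,_; proj₁; proj₂)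
  open import Data.Sum using (_⊎_; inj₁; inj₂)
  open import Relation.Nullary using (yes; no; contradiction; Dec; ¬_)
  open import Relation.Binary.PropositionalEquality as ≡ using (_≡_; _≢_)
  open import Data.List.Relation.Binary.Permutation.Propositional using (_↭_; ↭-refl; ↭-trans; prep; swap; ↭-reflexive)
  import Data.List.Relation.Binary.Permutation.Propositional as Perm
  open import Data.List.Relation.Binary.Permutation.Propositional.Properties using (++-comm; map⁺; ++⁺ˡ; ++⁺ʳ)

  relabel : (ℕ → ℕ) → ℕ × ℕ → ℕ × ℕ
  relabel σ (u , v) = σ u , σ v

  Outside : ℕ → ℕ → ℕ → Set
  Outside lo hi v = v ℕ.< lo ⊎ hi ℕ.≤ v

  OutsideE : ℕ → ℕ → List (ℕ × ℕ) → Set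
  OutsideE lo hi = All (λ (u , v) → Outside lo hi u × Outside lo hi v)

  -- Labels follow preorder, so reordering siblings shifts whole blocks of labels. Bijections of all
  -- naturals that are trivial outside an interval compose freely and extend to edges elsewhere in
  -- the graph.
  record Relabelling (lo hi : ℕ) (es es′ : List (ℕ × ℕ)) : Set where
    field
      σ τ : ℕ → ℕ
      τσ : ∀ v → τ (σ v) ≡ v
      στ : ∀ v → σ (τ v) ≡ v
      fixes : ∀ v → Outside lo hi v → σ v ≡ v
      maps : map (relabel σ) es ↭ es′

  module _ {lo hi : ℕ} where
    relabel-identity : ∀ {es es′} → es ↭ es′ → Relabelling lo hi es es′
    relabel-identity p = record
      { σ = λ v → v ; τ = λ v → v ; τσ = λ _ → ≡.refl ; στ = λ _ → ≡.refl ; fixes = λ _ _ → ≡.refl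
      ; maps = ↭-trans (↭-reflexive (map-id _)) p }

    relabel-trans : ∀ {es es′ es″} → Relabelling lo hi es es′ → Relabelling lo hi es′ es″ → Relabelling lo hi es es″
    relabel-trans {es} r s = record
      { σ = λ v → S.σ (R.σ v) ; τ = λ v → R.τ (S.τ v)
      ; τσ = λ v → ≡.trans (≡.cong R.τ (S.τσ (R.σ v))) (R.τσ v)
      ; στ = λ v → ≡.trans (≡.cong S.σ (R.στ (S.τ v))) (S.στ v)
      ; fixes = λ v h → ≡.trans (≡.cong S.σ (R.fixes v h)) (S.fixes v h)
      ; maps = ↭-trans (↭-reflexive (map-∘ es)) (↭-trans (map⁺ (relabel S.σ) R.maps) S.maps) }
      where
      module R = Relabelling r
      module S = Relabelling s

    relabel-widen : ∀ {lo′ hi′ es es′} → lo′ ℕ.≤ lo → hi ℕ.≤ hi′ → Relabelling lo hi es es′ → Relabelling lo′ hi′ es es′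
    relabel-widen h₁ h₂ r = record
      { R ; fixes = λ { v (inj₁ h) → R.fixes v (inj₁ (ℕ.<-≤-trans h h₁)) ; v (inj₂ h) → R.fixes v (inj₂ (ℕ.≤-trans h₂ h)) } }
      where module R = Relabelling r

    fixed-edges : ∀ {es es′} (r : Relabelling lo hi es es′) {fs} → OutsideE lo hi fs → map (relabel (Relabelling.σ r)) fs ≡ fs
    fixed-edges r [] = ≡.refl
    fixed-edges r ((h , h′) ∷ hs) = ≡.cong₂ _∷_ (≡.cong₂ _,_ (Relabelling.fixes r _ h) (Relabelling.fixes r _ h′)) (fixed-edges r hs)

    relabel-prefix : ∀ {es es′} A → OutsideE lo hi A → Relabelling lo hi es es′ → Relabelling lo hi (A ++ es) (A ++ es′)
    relabel-prefix {es} A h r = record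
      { R ; maps = ↭-trans (↭-reflexive (≡.trans (map-++ (relabel R.σ) A es) (≡.cong (_++ map (relabel R.σ) es) (fixed-edges r h)))) (++⁺ˡ A R.maps) }
      where module R = Relabelling r

    relabel-suffix : ∀ {es es′} B → OutsideE lo hi B → Relabelling lo hi es es′ → Relabelling lo hi (es ++ B) (es′ ++ B)
    relabel-suffix {es} B h r = record
      { R ; maps = ↭-trans (↭-reflexive (≡.trans (map-++ (relabel R.σ) es B) (≡.cong (map (relabel R.σ) es ++_) (fixed-edges r h)))) (++⁺ʳ B R.maps) }
      where module R = Relabelling r

  -- Exchanging the adjacent blocks [s, s + a) and [s + a, s + a + b)

  choose-yes : ∀ {A P : Set} (d : Dec P) {x y : A} → P → choose d x y ≡ x
  choose-yes (yes _) _ = ≡.refl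
  choose-yes (no ¬p) p = contradiction p ¬p

  choose-no : ∀ {A P : Set} (d : Dec P) {x y : A} → ¬ P → choose d x y ≡ y
  choose-no (yes p) ¬p = contradiction p ¬p
  choose-no (no _) _ = ≡.refl

  exchange : ℕ → ℕ → ℕ → ℕ → ℕ
  exchange s a b v = choose (v ℕ.<? s) v (choose (v ℕ.<? s ℕ.+ a) (v ℕ.+ b) (choose (v ℕ.<? s ℕ.+ a ℕ.+ b) (v ℕ.∸ a) v))

  module _ (s a b : ℕ) {v : ℕ} where
    exchange-low : v ℕ.< s → exchange s a b v ≡ v
    exchange-low h = choose-yes (v ℕ.<? s) h

    exchange-first : s ℕ.≤ v → v ℕ.< s ℕ.+ a → exchange s a b v ≡ v ℕ.+ b
    exchange-first h h′ = ≡.trans (choose-no (v ℕ.<? s) (ℕ.≤⇒≯ h)) (choose-yes (v ℕ.<? s ℕ.+ a) h′)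

    exchange-second : s ℕ.+ a ℕ.≤ v → v ℕ.< s ℕ.+ a ℕ.+ b → exchange s a b v ≡ v ℕ.∸ a
    exchange-second h h′ = ≡.trans (choose-no (v ℕ.<? s) (ℕ.≤⇒≯ (ℕ.≤-trans (ℕ.m≤m+n s a) h)))
      (≡.trans (choose-no (v ℕ.<? s ℕ.+ a) (ℕ.≤⇒≯ h)) (choose-yes (v ℕ.<? s ℕ.+ a ℕ.+ b) h′))

    exchange-high : s ℕ.+ a ℕ.+ b ℕ.≤ v → exchange s a b v ≡ v
    exchange-high h = ≡.trans (choose-no (v ℕ.<? s) (ℕ.≤⇒≯ (ℕ.≤-trans (ℕ.m≤m+n s a) h′)))
      (≡.trans (choose-no (v ℕ.<? s ℕ.+ a) (ℕ.≤⇒≯ h′)) (choose-no (v ℕ.<? s ℕ.+ a ℕ.+ b) (ℕ.≤⇒≯ h)))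
      where h′ = ℕ.≤-trans (ℕ.m≤m+n (s ℕ.+ a) b) h

  swap-summands : ∀ s a b → s ℕ.+ a ℕ.+ b ≡ s ℕ.+ b ℕ.+ a
  swap-summands s a b = ≡.trans (ℕ.+-assoc s a b) (≡.trans (≡.cong (s ℕ.+_) (ℕ.+-comm a b)) (≡.sym (ℕ.+-assoc s b a)))

  exchange-inverse : ∀ s a b v → exchange s b a (exchange s a b v) ≡ v
  exchange-inverse s a b v = cases (v ℕ.<? s) (v ℕ.<? s ℕ.+ a) (v ℕ.<? s ℕ.+ a ℕ.+ b)
    where
    cases : Dec (v ℕ.< s) → Dec (v ℕ.< s ℕ.+ a) → Dec (v ℕ.< s ℕ.+ a ℕ.+ b) → exchange s b a (exchange s a b v) ≡ v
    cases (yes v<s) _ _ = ≡.trans (≡.cong (exchange s b a) (exchange-low s a b v<s)) (exchange-low s b a v<s)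
    cases (no v≮s) (yes v<) _ = ≡.trans (≡.cong (exchange s b a) (exchange-first s a b (ℕ.≮⇒≥ v≮s) v<))
      (≡.trans (exchange-second s b a (ℕ.+-monoˡ-≤ b (ℕ.≮⇒≥ v≮s)) (≡.subst (v ℕ.+ b ℕ.<_) (swap-summands s a b) (ℕ.+-monoˡ-< b v<)))
        (ℕ.m+n∸n≡m v b))
    cases (no _) (no v≮) (yes v<) = ≡.trans (≡.cong (exchange s b a) (exchange-second s a b (ℕ.≮⇒≥ v≮) v<))
      (≡.trans (exchange-first s b a (≡.subst (ℕ._≤ v ℕ.∸ a) (ℕ.m+n∸n≡m s a) (ℕ.∸-monoˡ-≤ a (ℕ.≮⇒≥ v≮)))
          (≡.subst (v ℕ.∸ a ℕ.<_) (≡.trans (≡.cong (ℕ._∸ a) (swap-summands s a b)) (ℕ.m+n∸n≡m (s ℕ.+ b) a)) (ℕ.∸-monoˡ-< v< a≤v)))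
        (ℕ.m∸n+n≡m a≤v))
      where
      a≤v : a ℕ.≤ v
      a≤v = ℕ.≤-trans (ℕ.m≤n+m a s) (ℕ.≮⇒≥ v≮)
    cases (no _) (no _) (no v≮) = ≡.trans (≡.cong (exchange s b a) (exchange-high s a b (ℕ.≮⇒≥ v≮)))
      (exchange-high s b a (≡.subst (ℕ._≤ v) (swap-summands s a b) (ℕ.≮⇒≥ v≮)))

  relabel-forest : ∀ (f : ℕ → ℕ) p o p′ o′ ts → f p ≡ p′ → (∀ i → i ℕ.< sizes ts → f (o ℕ.+ i) ≡ o′ ℕ.+ i) →
    map (relabel f) (forestEdges p o ts) ≡ forestEdges p′ o′ ts
  relabel-forest f p o p′ o′ [] hp h = ≡.refl
  relabel-forest f p o p′ o′ (node cs ∷ ts) hp h = ≡.cong₂ _∷_ (≡.cong₂ _,_ hp fo)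
    (≡.trans (map-++ (relabel f) (forestEdges o (suc o) cs) _) (≡.cong₂ _++_
      (relabel-forest f o (suc o) o′ (suc o′) cs fo (λ i i< →
        ≡.trans (≡.cong f (≡.sym (ℕ.+-suc o i))) (≡.trans (h (suc i) (s≤s (ℕ.<-≤-trans i< (ℕ.m≤m+n (sizes cs) (sizes ts))))) (ℕ.+-suc o′ i))))
      (relabel-forest f p (o ℕ.+ s) p′ (o′ ℕ.+ s) ts hp (λ i i< →
        ≡.trans (≡.cong f (ℕ.+-assoc o s i)) (≡.trans (h (s ℕ.+ i) (ℕ.+-monoʳ-< s i<)) (≡.sym (ℕ.+-assoc o′ s i)))))))
    where
    s = suc (sizes cs)
    fo : f o ≡ o′
    fo = ≡.trans (≡.cong f (≡.sym (ℕ.+-identityʳ o))) (≡.trans (h 0 (s≤s z≤n)) (ℕ.+-identityʳ o′))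

  -- Exchanging the label blocks of t and u produces the right edges, listed with those of t before
  -- those of u.
  relabel-swap : ∀ p o t u ts → p ℕ.< o → Relabelling o (o ℕ.+ sizes (t ∷ u ∷ ts)) (forestEdges p o (t ∷ u ∷ ts)) (forestEdges p o (u ∷ t ∷ ts))
  relabel-swap p o t@(node cs) u@(node ds) ts p<o = record
    { σ = σ ; τ = exchange o b a ; τσ = exchange-inverse o a b ; στ = exchange-inverse o b a
    ; fixes = λ { v (inj₁ h) → exchange-low o a b h
                ; v (inj₂ h) → exchange-high o a b (ℕ.≤-trans (≡.subst (ℕ._≤ o ℕ.+ sizes (t ∷ u ∷ ts)) (≡.sym (ℕ.+-assoc o a b)) (ℕ.+-monoʳ-≤ o (ℕ.+-monoʳ-≤ a (ℕ.m≤m+n b _)))) h) }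
    ; maps = ↭-trans (↭-reflexive mapped) exchanged }
    where
    a = size t
    b = size u
    σ = exchange o a b
    σp : σ p ≡ p
    σp = exchange-low o a b p<o
    σt : ∀ i → i ℕ.< a → σ (o ℕ.+ i) ≡ o ℕ.+ b ℕ.+ i
    σt i i<a = ≡.trans (exchange-first o a b (ℕ.m≤m+n o i) (ℕ.+-monoʳ-< o i<a)) (swap-summands o i b)
    σu : ∀ i → i ℕ.< b → σ (o ℕ.+ a ℕ.+ i) ≡ o ℕ.+ i
    σu i i<b = ≡.trans (exchange-second o a b (ℕ.m≤m+n (o ℕ.+ a) i) (ℕ.+-monoʳ-< (o ℕ.+ a) i<b))
      (≡.trans (≡.cong (ℕ._∸ a) (swap-summands o a i)) (ℕ.m+n∸n≡m (o ℕ.+ i) a))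
    σts : ∀ i → σ (o ℕ.+ a ℕ.+ b ℕ.+ i) ≡ o ℕ.+ b ℕ.+ a ℕ.+ i
    σts i = ≡.trans (exchange-high o a b (ℕ.m≤m+n (o ℕ.+ a ℕ.+ b) i)) (≡.cong (ℕ._+ i) (swap-summands o a b))
    E₁ = forestEdges (o ℕ.+ b) (suc (o ℕ.+ b)) cs
    E₂ = forestEdges o (suc o) ds
    E₃ = forestEdges p (o ℕ.+ b ℕ.+ a) ts
    root : ∀ {f : ℕ → ℕ} {m k n} → (∀ i → i ℕ.< suc k → f (m ℕ.+ i) ≡ n ℕ.+ i) → f m ≡ n
    root {f} {m} {k} {n} h = ≡.trans (≡.cong f (≡.sym (ℕ.+-identityʳ m))) (≡.trans (h 0 (s≤s z≤n)) (ℕ.+-identityʳ n))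
    tree : ∀ {o o′} cs → (∀ i → i ℕ.< suc (sizes cs) → σ (o ℕ.+ i) ≡ o′ ℕ.+ i) →
      map (relabel σ) (forestEdges o (suc o) cs) ≡ forestEdges o′ (suc o′) cs
    tree {o} {o′} cs h = relabel-forest σ o (suc o) o′ (suc o′) cs (root {σ} {o} {sizes cs} h)
      (λ i i< → ≡.trans (≡.cong σ (≡.sym (ℕ.+-suc o i))) (≡.trans (h (suc i) (s≤s i<)) (ℕ.+-suc o′ i)))
    mapped : map (relabel σ) (forestEdges p o (t ∷ u ∷ ts)) ≡ (p , o ℕ.+ b) ∷ (E₁ ++ ((p , o) ∷ (E₂ ++ E₃)))
    mapped = ≡.cong₂ _∷_ (≡.cong₂ _,_ σp (root {σ} {o} {sizes cs} σt))
      (≡.trans (map-++ (relabel σ) (forestEdges o (suc o) cs) _) (≡.cong₂ _++_ (tree cs σt)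
        (≡.cong₂ _∷_ (≡.cong₂ _,_ σp (root {σ} {o ℕ.+ a} {sizes ds} σu))
          (≡.trans (map-++ (relabel σ) (forestEdges (o ℕ.+ a) (suc (o ℕ.+ a)) ds) _) (≡.cong₂ _++_ (tree ds σu)
            (relabel-forest σ p (o ℕ.+ a ℕ.+ b) p (o ℕ.+ b ℕ.+ a) ts σp (λ i _ → σts i)))))))
    exchanged : (p , o ℕ.+ b) ∷ (E₁ ++ ((p , o) ∷ (E₂ ++ E₃))) ↭ (p , o) ∷ (E₂ ++ ((p , o ℕ.+ b) ∷ (E₁ ++ E₃)))
    exchanged = begin
      X ++ (Y ++ E₃)    ≡⟨ ++-assoc X Y E₃ ⟨
      (X ++ Y) ++ E₃    ↭⟨ ++⁺ʳ E₃ (++-comm X Y) ⟩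
      (Y ++ X) ++ E₃    ≡⟨ ++-assoc Y X E₃ ⟩
      Y ++ (X ++ E₃)    ∎
      where
      open Perm.PermutationReasoning
      X = (p , o ℕ.+ b) ∷ E₁
      Y = (p , o) ∷ E₂

  -- Quantifying over the position p and o makes one reordering usable wherever the forest sits in a
  -- graph.
  record Reordered (ts us : List RTree) : Set where
    field
      sizes≡ : sizes ts ≡ sizes us
      relabelling : ∀ p o → p ℕ.< o → Relabelling o (o ℕ.+ sizes ts) (forestEdges p o ts) (forestEdges p o us)

  reordered-trans : ∀ {ts us vs} → Reordered ts us → Reordered us vs → Reordered ts vs
  reordered-trans {ts} {us} {vs} r s = record
    { sizes≡ = ≡.trans R.sizes≡ S.sizes≡
    ; relabelling = λ p o p<o → relabel-trans (R.relabelling p o p<o)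
        (≡.subst (λ n → Relabelling o (o ℕ.+ n) (forestEdges p o us) (forestEdges p o vs)) (≡.sym R.sizes≡) (S.relabelling p o p<o)) }
    where
    module R = Reordered r
    module S = Reordered s

  reordered-prep : ∀ t {ts us} → Reordered ts us → Reordered (t ∷ ts) (t ∷ us)
  reordered-prep t@(node cs) {ts} {us} r = record
    { sizes≡ = ≡.cong (size t ℕ.+_) R.sizes≡
    ; relabelling = λ p o p<o → relabel-widen (ℕ.m≤m+n o (size t)) (ℕ.≤-reflexive (ℕ.+-assoc o (size t) (sizes ts)))
        (relabel-prefix ((p , o) ∷ forestEdges o (suc o) cs)
          ((inj₁ (ℕ.<-≤-trans p<o (ℕ.m≤m+n o _)) , inj₁ (ℕ.m<m+n o (s≤s z≤n))) ∷
            forestEdges-All (Outside (o ℕ.+ size t) _) o (suc o) cs (inj₁ (ℕ.m<m+n o (s≤s z≤n)))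
              (λ v _ h → inj₁ (≡.subst (v ℕ.<_) (≡.sym (ℕ.+-suc o (sizes cs))) h)))
          (R.relabelling p (o ℕ.+ size t) (ℕ.<-≤-trans p<o (ℕ.m≤m+n o _)))) }
    where module R = Reordered r

  reordered-↭ : ∀ {ts us} → ts ↭ us → Reordered ts us
  reordered-↭ Perm.refl = record { sizes≡ = ≡.refl ; relabelling = λ _ _ _ → relabel-identity ↭-refl }
  reordered-↭ (prep t p) = reordered-prep t (reordered-↭ p)
  reordered-↭ (swap {ts} {us} t u p) = reordered-trans {t ∷ u ∷ ts} {u ∷ t ∷ ts} {u ∷ t ∷ us}
    (record { sizes≡ = ≡.trans (≡.sym (ℕ.+-assoc (size t) (size u) _)) (≡.trans (≡.cong (ℕ._+ sizes ts) (ℕ.+-comm (size t) (size u))) (ℕ.+-assoc (size u) (size t) _))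
            ; relabelling = λ q o → relabel-swap q o t u ts })
    (reordered-prep u (reordered-prep t (reordered-↭ p)))
  reordered-↭ (Perm.trans p q) = reordered-trans (reordered-↭ p) (reordered-↭ q)

  data ReorderedT : RTree → RTree → Set where
    node : ∀ {cs ds} → Reordered cs ds → ReorderedT (node cs) (node ds)

  reordered-child : ∀ {t u} → ReorderedT t u → Reordered (t ∷ []) (u ∷ [])
  reordered-child (node {cs} {ds} r) = record
    { sizes≡ = ≡.cong (λ n → suc n ℕ.+ 0) R.sizes≡
    ; relabelling = λ p o p<o → relabel-widen (ℕ.n≤1+n o)
        (ℕ.≤-reflexive (≡.trans (≡.sym (ℕ.+-suc o (sizes cs))) (≡.cong (o ℕ.+_) (≡.sym (ℕ.+-identityʳ (suc (sizes cs)))))))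
        (relabel-prefix ((p , o) ∷ []) ((inj₁ (ℕ.m<n⇒m<1+n p<o) , inj₁ ℕ.≤-refl) ∷ [])
          (relabel-suffix [] [] (R.relabelling o (suc o) ℕ.≤-refl))) }
    where module R = Reordered r

  reordered-hang : ∀ k {t u} → ReorderedT t u → ReorderedT (hang k t) (hang k u)
  reordered-hang zero r = r
  reordered-hang (suc k) r = node (reordered-child (reordered-hang k r))

  similar⇒reordered : ∀ {t u} → Similar t u → ReorderedT t u
  similar⇒reordered (similar k p ≡.refl ≡.refl) = reordered-hang k (node (reordered-↭ (map⁺ pathTree p)))

  -- Each tree is relabelled strictly below its root, so the cycle edges stay in place and travel
  -- along as `rest`.
  record ReorderedTrees (o : ℕ) (ts us : List RTree) : Set where
    field
      sizes≡ : sizes ts ≡ sizes us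
      labels≡ : rootLabels o ts ≡ rootLabels o us
      relabelling : ∀ rest → (∀ v → o ℕ.≤ v → v ℕ.< o ℕ.+ sizes ts → v ∉ rootLabels o ts → Avoids v rest) →
        Relabelling o (o ℕ.+ sizes ts) (allTreeEdges o ts ++ rest) (allTreeEdges o us ++ rest)

  avoids⇒outside : ∀ lo hi es → (∀ v → lo ℕ.≤ v → v ℕ.< hi → Avoids v es) → OutsideE lo hi es
  avoids⇒outside lo hi [] h = []
  avoids⇒outside lo hi ((u , v) ∷ es) h =
    (place u (λ k l → proj₁ (All.head (h u k l)) ≡.refl) , place v (λ k l → proj₂ (All.head (h v k l)) ≡.refl))
    ∷ avoids⇒outside lo hi es (λ w k l → All.tail (h w k l))
    where
    place : ∀ v → (lo ℕ.≤ v → ¬ v ℕ.< hi) → Outside lo hi v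
    place v k with v ℕ.<? lo
    ... | yes v<lo = inj₁ v<lo
    ... | no v≮lo = inj₂ (ℕ.≮⇒≥ (k (ℕ.≮⇒≥ v≮lo)))

  reordered-trees : ∀ o {ts us} → Pointwise ReorderedT ts us → ReorderedTrees o ts us
  reordered-trees o [] = record { sizes≡ = ≡.refl ; labels≡ = ≡.refl ; relabelling = λ _ _ → relabel-identity ↭-refl }
  reordered-trees o {node cs ∷ ts} {node ds ∷ us} (node r ∷ rs) = record
    { sizes≡ = ≡.cong₂ (λ m n → suc m ℕ.+ n) R.sizes≡ S.sizes≡
    ; labels≡ = ≡.cong (o ∷_) (≡.trans S.labels≡ (≡.cong (λ n → rootLabels (o ℕ.+ suc n) us) R.sizes≡))
    ; relabelling = relabelling }
    where
    s = suc (sizes cs)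
    module R = Reordered r
    module S = ReorderedTrees (reordered-trees (o ℕ.+ s) rs)
    C = forestEdges o (suc o) cs
    C′ = forestEdges o (suc o) ds
    mid : suc o ℕ.+ sizes cs ≡ o ℕ.+ s
    mid = ≡.sym (ℕ.+-suc o (sizes cs))
    end : o ℕ.+ s ℕ.+ sizes ts ≡ o ℕ.+ (s ℕ.+ sizes ts)
    end = ℕ.+-assoc o s (sizes ts)
    relabelling : ∀ rest → (∀ v → o ℕ.≤ v → v ℕ.< o ℕ.+ (s ℕ.+ sizes ts) → v ∉ rootLabels o (node cs ∷ ts) → Avoids v rest) →
      Relabelling o (o ℕ.+ (s ℕ.+ sizes ts)) (allTreeEdges o (node cs ∷ ts) ++ rest) (allTreeEdges o (node ds ∷ us) ++ rest)
    relabelling rest h = relabel-trans (relabel-identity (↭-reflexive (++-assoc C (allTreeEdges (o ℕ.+ s) ts) rest)))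
      (relabel-trans first (relabel-trans second (relabel-identity (↭-reflexive
        (≡.trans (≡.sym (++-assoc C′ (allTreeEdges (o ℕ.+ s) us) rest))
          (≡.cong (λ n → (C′ ++ allTreeEdges (o ℕ.+ suc n) us) ++ rest) R.sizes≡))))))
      where
      D = allTreeEdges (o ℕ.+ s) ts ++ rest
      D′ = allTreeEdges (o ℕ.+ s) us ++ rest
      first : Relabelling o (o ℕ.+ (s ℕ.+ sizes ts)) (C ++ D) (C′ ++ D)
      first = relabel-widen (ℕ.n≤1+n o) (ℕ.≤-trans (ℕ.≤-reflexive mid) (ℕ.+-monoʳ-≤ o (ℕ.m≤m+n s _)))
        (relabel-suffix D (avoids⇒outside (suc o) (suc o ℕ.+ sizes cs) D (λ v h₁ h₂ → let h₃ = ≡.subst (v ℕ.<_) mid h₂ in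
            ++⁺ (allTreeEdges-All (_≢ v) (o ℕ.+ s) ts (λ w k _ e → ℕ.<⇒≢ (ℕ.<-≤-trans h₃ k) (≡.sym e)))
              (h v (ℕ.<⇒≤ h₁) (ℕ.<-≤-trans h₃ (ℕ.+-monoʳ-≤ o (ℕ.m≤m+n s _)))
                λ { (here e) → ℕ.<⇒≢ h₁ (≡.sym e) ; (there k) → ℕ.<⇒≱ h₃ (All.lookup (rootLabels-≥ (o ℕ.+ s) ts) k) })))
          (R.relabelling o (suc o) ℕ.≤-refl))
      second : Relabelling o (o ℕ.+ (s ℕ.+ sizes ts)) (C′ ++ D) (C′ ++ D′)
      second = relabel-widen (ℕ.m≤m+n o s) (ℕ.≤-reflexive end)
        (relabel-prefix C′ (forestEdges-All (Outside (o ℕ.+ s) (o ℕ.+ s ℕ.+ sizes ts)) o (suc o) ds (inj₁ (ℕ.m<m+n o (s≤s z≤n)))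
            (λ v _ k → inj₁ (≡.subst (v ℕ.<_) (≡.trans (≡.cong (λ n → suc (o ℕ.+ n)) (≡.sym R.sizes≡)) mid) k)))
          (S.relabelling rest (λ v h₁ h₂ v∉ → h v (ℕ.≤-trans (ℕ.m≤m+n o s) h₁) (≡.subst (v ℕ.<_) end h₂)
            λ { (here e) → ℕ.<⇒≢ (ℕ.<-≤-trans (ℕ.m<m+n o (s≤s z≤n)) h₁) (≡.sym e) ; (there k) → v∉ k })))

  module _ {n : ℕ} {es es′ : List (ℕ × ℕ)} (r : Relabelling 0 n es es′) where
    open Relabelling r

    private
      σ-injective : ∀ {u v} → σ u ≡ σ v → u ≡ v
      σ-injective {u} {v} e = ≡.trans (≡.sym (τσ u)) (≡.trans (≡.cong τ e) (τσ v))

      -- If σ v were at least n, σ would fix it, and injectivity would give σ v = v.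
      σ-< : ∀ {v} → v ℕ.< n → σ v ℕ.< n
      σ-< {v} v<n with σ v ℕ.<? n
      ... | yes h = h
      ... | no h = contradiction (≡.subst (ℕ._< n) (≡.sym (σ-injective (fixes (σ v) (inj₂ (ℕ.≮⇒≥ h))))) v<n) h

      τ-< : ∀ {v} → v ℕ.< n → τ v ℕ.< n
      τ-< {v} v<n with τ v ℕ.<? n
      ... | yes h = h
      ... | no h = contradiction (≡.subst (ℕ._< n) (≡.trans (≡.sym (στ v)) (fixes (τ v) (inj₂ (ℕ.≮⇒≥ h)))) v<n) h

      ≡ᵇ-σ : ∀ u v → (σ u ≡ᵇ σ v) ≡ (u ≡ᵇ v)
      ≡ᵇ-σ u v with u ℕ.≟ v
      ... | yes ≡.refl = ≡.trans (≡ᵇ-refl (σ u)) (≡.sym (≡ᵇ-refl u))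
      ... | no u≢v = ≡.trans (≡ᵇ-≢ (λ e → u≢v (σ-injective e))) (≡.sym (≡ᵇ-≢ u≢v))

      hit-σ : ∀ i j e → hit (σ i) (σ j) (relabel σ e) ≡ hit i j e
      hit-σ i j (a , b) rewrite ≡ᵇ-σ a i | ≡ᵇ-σ b j | ≡ᵇ-σ a j | ≡ᵇ-σ b i = ≡.refl

      mult-σ : ∀ i j → mult (mkGraph n es) i j ≡ mult (mkGraph n es′) (σ i) (σ j)
      mult-σ i j = ≡.trans (≡.cong sumℕ (≡.trans (map-cong (λ e → ≡.sym (hit-σ i j e)) es) (map-∘ es)))
        (sum-↭ (map⁺ (hit (σ i) (σ j)) maps))

    relabelling⇒isomorphic : mkGraph n es ≅ mkGraph n es′
    relabelling⇒isomorphic = permutation to from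
        (λ i → Fin.toℕ-injective (≡.trans (Fin.toℕ-fromℕ< _) (≡.trans (≡.cong σ (Fin.toℕ-fromℕ< _)) (στ (toℕ i)))))
        (λ i → Fin.toℕ-injective (≡.trans (Fin.toℕ-fromℕ< _) (≡.trans (≡.cong τ (Fin.toℕ-fromℕ< _)) (τσ (toℕ i)))))
      , λ i j → ≡.cong (0 <ᵇ_) (≡.trans (mult-σ (toℕ i) (toℕ j))
          (≡.cong₂ (mult (mkGraph n es′)) (≡.sym (Fin.toℕ-fromℕ< (σ-< (Fin.toℕ<n i)))) (≡.sym (Fin.toℕ-fromℕ< (σ-< (Fin.toℕ<n j))))))
      where
      to from : Fin n → Fin n
      to i = fromℕ< (σ-< (Fin.toℕ<n i))
      from i = fromℕ< (τ-< (Fin.toℕ<n i))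

  reordered⇒isomorphic : ∀ {t u} ts us → Pointwise ReorderedT (t ∷ ts) (u ∷ us) → graphOf (t ∷ ts) ≅ graphOf (u ∷ us)
  reordered⇒isomorphic {t} {u} ts us rs = ≡.subst (λ n → graphOf (t ∷ ts) ≅ mkGraph n (edges (graphOf (u ∷ us)))) S.sizes≡
    (relabelling⇒isomorphic (relabel-trans (relabel-identity (++-comm C A)) (relabel-trans
      (S.relabelling C (λ v _ _ v∉ → cycleGo-avoids (rootLabels 0 (t ∷ ts)) (λ e → v∉ (here (≡.sym e))) (∉⇒All-≢ v (rootLabels 0 (t ∷ ts)) v∉)))
      (relabel-identity (↭-trans (++-comm A′ C) (↭-reflexive (≡.cong (λ ls → cycleEdges ls ++ A′) S.labels≡)))))))
    where
    module S = ReorderedTrees (reordered-trees 0 rs)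
    C = cycleEdges (rootLabels 0 (t ∷ ts))
    A = allTreeEdges 0 (t ∷ ts)
    A′ = allTreeEdges 0 (u ∷ us)

-- Assembly: coefficient comparison, orders of the graphs, equality case.

open import Defs
open import Data.Nat using (ℕ; _≤_; _+_)
open import Data.Fin using (Fin)
open import Data.Vec using (Vec; lookup; tabulate)
open import Data.Product using (Σ; _×_)
open import Relation.Binary.PropositionalEquality using (_≡_; _≢_)
open import Function.Bundles using (_⇔_)

open Determinants
open EdgeLaplacians
open AlternatingPolynomials
open RootedPairs
open TreeReduction
open CycleReduction
open UnicyclicDeterminants
open CharacteristicPolynomials
open GraphInvariance
open Reorderings
open import Algebra.Bundles using (CommutativeRing; CommutativeSemiring)
open import Data.Fin using (zero; suc)
open import Data.Integer as ℤ using (ℤ; +_; 0ℤ)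
import Data.Integer.Properties as ℤ
open import Data.List as List using (List; []; _∷_; _++_; map; replicate)
open import Data.List.Properties using (map-tabulate)
open import Data.List.Relation.Binary.Pointwise using (Pointwise; []; _∷_)
open import Data.List.Relation.Binary.Permutation.Propositional using (↭-sym)
open import Data.Nat as ℕ using (zero; suc; z≤n; s≤s; _/_; _%_)
import Data.Nat.Properties as ℕ
open import Data.Nat.DivMod using (m≡m%n+[m/n]*n; m%n<n; m≥n⇒m/n>0)
open import Data.Nat.Solver using (module +-*-Solver)
open import Data.Product using (_,_; proj₁; proj₂)
open import Data.Sum using (_⊎_; inj₁; inj₂)
open import Data.Vec using ([]; _∷_; toList)
open import Function.Bundles using (mk⇔)
open import Relation.Nullary using (yes; no; contradiction; ¬_)
import Relation.Binary.PropositionalEquality as ≡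

open _≈ₚ_

positivityStructure : PositivityStructure altSemiring
positivityStructure = record
  { x = xₐ ; Pos = Positive ; Pos-1 = Positive-1 ; Pos-x = Positive-x
  ; Pos-resp = λ {a} {b} → Positive-resp {a} {b} ; Pos-+ = λ {a} → Positive-+ {a} ; Pos-* = λ {a} {b} → Positive-* {a} {b} }

module A = PairAlgebra altSemiring positivityStructure
module AT = TreePairs altSemiring positivityStructure
module AC = CycleImprovement altSemiring positivityStructure
module E = Elimination polyRing xₚ
module P = PairAlgebra (CommutativeRing.commutativeSemiring polyRing) (trivialPositivity (CommutativeRing.commutativeSemiring polyRing) xₚ)
module PT = TreePairs (CommutativeRing.commutativeSemiring polyRing) (trivialPositivity (CommutativeRing.commutativeSemiring polyRing) xₚ)
module R = CommutativeRing polyRing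

-- Joins the two uses of the pair algebra: forgetting the proofs of alternation respects all its
-- operations by definition.
forget : A.Pair → P.Pair
forget (f , d) = proj₁ f , proj₁ d

mutual
  forget-pairT : ∀ t → forget (AT.pairT t) ≡ PT.pairT t
  forget-pairT (node ts) = ≡.cong (P.vertex P.⋆_) (forget-branches ts)

  forget-branches : ∀ ts → forget (AT.branches ts) ≡ PT.branches ts
  forget-branches [] = ≡.refl
  forget-branches (t ∷ ts) = ≡.cong₂ (λ p q → P.edge p P.⋆ q) (forget-pairT t) (forget-branches ts)

forgetₛ : A.State → P.State
forgetₛ (A.state Δ p q r s) = P.state (proj₁ Δ) (proj₁ p) (proj₁ q) (proj₁ r) (proj₁ s)

forget-chain : ∀ vs → forgetₛ (A.chain vs) ≡ P.chain (map forget vs)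
forget-chain [] = ≡.refl
forget-chain (v ∷ vs) = ≡.cong (forget v P.◁_) (forget-chain vs)

value : List RTree → AltPoly
value ts = A.cycle (map AT.pairT ts)

forget-value : ∀ ts → proj₁ (value ts) ≡ P.cycle (map PT.pairT ts)
forget-value ts = ≡.trans (≡.cong (λ M → P.State.p M +ₚ P.State.s M) (forget-chain (map AT.pairT ts)))
  (≡.cong P.cycle (forget-pairs ts))
  where
  forget-pairs : ∀ ts → map forget (map AT.pairT ts) ≡ map PT.pairT ts
  forget-pairs [] = ≡.refl
  forget-pairs (t ∷ ts) = ≡.cong₂ _∷_ (forget-pairT t) (forget-pairs ts)

-- With the sign of the order split off, c is det(xI + L) for x = -λ.
Represents : Graph → AltPoly → Set
Represents G c = charPoly G ≈ₚ Determinant.sg polyRing (order G) *ₚ proj₁ c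

represents-value : ∀ t u ts → Represents (graphOf (t ∷ u ∷ ts)) (value (t ∷ u ∷ ts))
represents-value t u ts = R.trans (charPoly-Z (sizes us) (edges (graphOf us)) (proper-graphOf t u ts))
  (R.*-congˡ {x = Determinant.sg polyRing (sizes us)} (R.trans (E.Z-unicyclic t (u ∷ ts)) (R.reflexive (≡.sym (forget-value us)))))
  where us = t ∷ u ∷ ts

cancel-sgn : ∀ k {a b} → sgn k ℤ.* a ≡ sgn k ℤ.* b → a ≡ b
cancel-sgn k {a} {b} h = ≡.trans (expand a) (≡.trans (≡.cong (sgn k ℤ.*_) h) (≡.sym (expand b)))
  where
  expand : ∀ a → a ≡ sgn k ℤ.* (sgn k ℤ.* a)
  expand a = ≡.trans (≡.sym (ℤ.*-identityˡ a)) (≡.trans (≡.cong (ℤ._* a) (≡.sym (sgn² k))) (ℤ.*-assoc (sgn k) (sgn k) a))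

lapCoeff-represents : ∀ G c → Represents G c → ∀ k → k ≤ order G →
  lapCoeff G k ≡ sgn (order G ℕ.∸ k) ℤ.* coeff (proj₁ c) (order G ℕ.∸ k)
lapCoeff-represents (mkGraph n es) c h k k≤n = lapCoeff-coeff n es k (proj₁ c) k≤n h

represents-beyond : ∀ G c → Represents G c → ∀ m → order G ℕ.< m → coeff (proj₁ c) m ≡ 0ℤ
represents-beyond G (c , _) h m n<m = cancel-sgn n (≡.trans (≡.sym (coeff-scale (sgn n) c m))
  (≡.trans (at (R.trans (scale-sgn n c) (R.sym h)) m)
    (≡.trans (charPoly-beyond G m n<m) (≡.sym (ℤ.*-zeroʳ (sgn n))))))
  where n = order G

module _ (G H : Graph) (order≡ : order G ≡ order H) (c d : AltPoly) (hG : Represents G c) (hH : Represents H d) (less : c A.≺ d) where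
  private
    z = proj₁ less
    n = order H

    coeff-d : ∀ m → coeff (proj₁ d) m ≡ coeff (proj₁ c) m ℤ.+ coeff (proj₁ z) m
    coeff-d m = ≡.trans (at (proj₂ (proj₂ less)) m) (coeff-+ (proj₁ c) (proj₁ z) m)

    lapCoeff-G : ∀ k → k ≤ order G → lapCoeff G k ≡ sgn (n ℕ.∸ k) ℤ.* coeff (proj₁ c) (n ℕ.∸ k)
    lapCoeff-G k k≤ = ≡.trans (lapCoeff-represents G c hG k k≤)
      (≡.cong (λ n → sgn (n ℕ.∸ k) ℤ.* coeff (proj₁ c) (n ℕ.∸ k)) order≡)

    lapCoeff-H : ∀ k → k ≤ order G → lapCoeff H k ≡ sgn (n ℕ.∸ k) ℤ.* coeff (proj₁ d) (n ℕ.∸ k)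
    lapCoeff-H k k≤ = lapCoeff-represents H d hH k (≡.subst (k ≤_) order≡ k≤)

  -- The coefficients of the remainder alternate, so the sign attached to degree n - k makes its
  -- contribution to c_k nonnegative.
  ≺⇒⪯ : G ⪯ H
  ≺⇒⪯ = order≡ , λ k k≤ → ≡.subst₂ ℤ._≤_ (≡.sym (lapCoeff-G k k≤)) (≡.sym (lapCoeff-H k k≤)) (bound (n ℕ.∸ k))
    where
    bound : ∀ m → sgn m ℤ.* coeff (proj₁ c) m ℤ.≤ sgn m ℤ.* coeff (proj₁ d) m
    bound m = begin
      sgn m ℤ.* a                        ≡⟨ ℤ.+-identityʳ (sgn m ℤ.* a) ⟨
      sgn m ℤ.* a ℤ.+ 0ℤ                 ≤⟨ ℤ.+-monoʳ-≤ (sgn m ℤ.* a) (≡.subst (0ℤ ℤ.≤_) (ℤ.*-identityˡ (sgn m ℤ.* b)) (proj₂ z m)) ⟩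
      sgn m ℤ.* a ℤ.+ sgn m ℤ.* b        ≡⟨ ℤ.*-distribˡ-+ (sgn m) a b ⟨
      sgn m ℤ.* (a ℤ.+ b)                ≡⟨ ≡.cong (sgn m ℤ.*_) (coeff-d m) ⟨
      sgn m ℤ.* coeff (proj₁ d) m        ∎
      where
      open ℤ.≤-Reasoning
      a = coeff (proj₁ c) m
      b = coeff (proj₁ z) m

  -- Equal c_k would force the two polynomials to agree, with zeros beyond degree n, although their
  -- difference has positive value at λ = -1.
  ≺⇒¬sameCoeffs : ¬ sameCoeffs G H
  ≺⇒¬sameCoeffs (_ , h) = Positive-difference {d} {c} {z} (proj₂ (proj₂ less)) (proj₁ (proj₂ less)) (coeffs≡ same)
    where
    same : ∀ m → coeff (proj₁ d) m ≡ coeff (proj₁ c) m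
    same m with m ℕ.≤? n
    ... | no m≰n = ≡.trans (represents-beyond H d hH m (ℕ.≰⇒> m≰n))
      (≡.sym (represents-beyond G c hG m (≡.subst (ℕ._< m) (≡.sym order≡) (ℕ.≰⇒> m≰n))))
    ... | yes m≤n = cancel-sgn m (≡.subst (λ m → sgn m ℤ.* coeff (proj₁ d) m ≡ sgn m ℤ.* coeff (proj₁ c) m) (ℕ.m∸[m∸n]≡n m≤n)
      (≡.trans (≡.sym (lapCoeff-H k k≤)) (≡.trans (≡.sym (h k k≤)) (lapCoeff-G k k≤))))
      where
      k = n ℕ.∸ m
      k≤ : k ≤ order G
      k≤ = ≡.subst (k ≤_) (≡.sym order≡) (ℕ.m∸n≤m n m)

sizes-replicate : ∀ r t → sizes (replicate r t) ≡ r ℕ.* size t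
sizes-replicate zero t = ≡.refl
sizes-replicate (suc r) t = ≡.cong (size t ℕ.+_) (sizes-replicate r t)

sizes-++ : ∀ ts us → sizes (ts ++ us) ≡ sizes ts ℕ.+ sizes us
sizes-++ [] us = ≡.refl
sizes-++ (t ∷ ts) us = ≡.trans (≡.cong (size t ℕ.+_) (sizes-++ ts us)) (≡.sym (ℕ.+-assoc (size t) _ _))

-- Having a vertex for each leg makes q positive. For q = 0 the truncated q - 1 would give legs with
-- one vertex too many.
size-bst : ∀ m l → suc l ≤ m → size (bst (suc m) (suc l)) ≡ suc m
size-bst m l l<m with m / suc l in eq | m≥n⇒m/n>0 l<m
... | suc q | _ = ≡.cong suc (begin
    sizes (replicate r (pathTree (suc q)) ++ replicate (suc l ℕ.∸ r) (pathTree q))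
      ≡⟨ sizes-++ (replicate r (pathTree (suc q))) _ ⟩
    sizes (replicate r (pathTree (suc q))) ℕ.+ sizes (replicate (suc l ℕ.∸ r) (pathTree q))
      ≡⟨ ≡.cong₂ ℕ._+_ (≡.trans (sizes-replicate r _) (≡.cong (r ℕ.*_) (size-pathTree (suc q))))
           (≡.trans (sizes-replicate (suc l ℕ.∸ r) _) (≡.cong ((suc l ℕ.∸ r) ℕ.*_) (size-pathTree q))) ⟩
    r ℕ.* suc (suc q) ℕ.+ (suc l ℕ.∸ r) ℕ.* suc q
      ≡⟨ solve 3 (λ r d q → r :* (con 1 :+ q) :+ d :* q := r :+ q :* (r :+ d)) ≡.refl r (suc l ℕ.∸ r) (suc q) ⟩
    r ℕ.+ suc q ℕ.* (r ℕ.+ (suc l ℕ.∸ r))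
      ≡⟨ ≡.cong (λ n → r ℕ.+ suc q ℕ.* n) (ℕ.m+[n∸m]≡n (ℕ.<⇒≤ (m%n<n m (suc l)))) ⟩
    r ℕ.+ suc q ℕ.* suc l
      ≡⟨ ≡.cong (λ q → r ℕ.+ q ℕ.* suc l) eq ⟨
    r ℕ.+ m / suc l ℕ.* suc l
      ≡⟨ m≡m%n+[m/n]*n m (suc l) ⟨
    m ∎)
  where
  open ≡.≡-Reasoning
  open +-*-Solver
  r = m % suc l

size-Btree-suc : ∀ n l p → 1 ≤ l → suc p + l ≤ n → size (Btree n l (suc p)) ≡ n
size-Btree-suc n (suc l) p _ h = begin
  size (hang p (bst (n ℕ.∸ suc p ℕ.+ 1) (suc l)))   ≡⟨ size-hang p (bst (n ℕ.∸ suc p ℕ.+ 1) (suc l)) ⟩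
  p ℕ.+ size (bst (n ℕ.∸ suc p ℕ.+ 1) (suc l))      ≡⟨ ≡.cong (λ m → p ℕ.+ size (bst m (suc l))) (ℕ.+-comm (n ℕ.∸ suc p) 1) ⟩
  p ℕ.+ size (bst (suc (n ℕ.∸ suc p)) (suc l))
    ≡⟨ ≡.cong (p ℕ.+_) (size-bst (n ℕ.∸ suc p) l (ℕ.m+n≤o⇒m≤o∸n (suc l) (≡.subst (_≤ n) (ℕ.+-comm (suc p) (suc l)) h))) ⟩
  p ℕ.+ suc (n ℕ.∸ suc p)                           ≡⟨ ℕ.+-suc p (n ℕ.∸ suc p) ⟩
  suc p ℕ.+ (n ℕ.∸ suc p)                           ≡⟨ ℕ.m+[n∸m]≡n (ℕ.≤-trans (ℕ.m≤m+n (suc p) (suc l)) h) ⟩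
  n                                                 ∎
  where open ≡.≡-Reasoning

leavesF>0 : ∀ c cs → 1 ≤ leavesF (c ∷ cs)
leavesF>0 (node []) cs = s≤s z≤n
leavesF>0 (node (d ∷ ds)) cs = ℕ.≤-trans (leavesF>0 d ds) (ℕ.m≤m+n _ _)

-- For a single vertex the bound forces p = 1. Any other tree has a leaf, and the bound then leaves
-- at least one vertex for each leg.
size-Btree : ∀ t p → 1 ≤ p → p + treeLeaves t ≤ size t → size (Btree (size t) (treeLeaves t) p) ≡ size t
size-Btree (node []) (suc zero) _ _ = ≡.refl
size-Btree (node []) (suc (suc p)) _ (s≤s ())
size-Btree (node (c ∷ cs)) (suc p) _ h = size-Btree-suc (size (node (c ∷ cs))) (leavesF (c ∷ cs)) p (leavesF>0 c cs) h

module _ {ℓ} {B : Set ℓ} where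
  map-toList : ∀ {g} (F : RTree → B) (T : Vec RTree g) → map (λ i → F (lookup T i)) (List.allFin g) ≡ map F (toList T)
  map-toList F T = ≡.trans (map-tabulate (λ i → i) (λ i → F (lookup T i))) (go T)
    where
    go : ∀ {g} (T : Vec RTree g) → List.tabulate (λ i → F (lookup T i)) ≡ map F (toList T)
    go [] = ≡.refl
    go (t ∷ T) = ≡.cong (F t ∷_) (go T)

  map-tabulate-toList : ∀ {g} (F : RTree → B) (b : Fin g → RTree) → map (λ i → F (b i)) (List.allFin g) ≡ map F (toList (tabulate b))
  map-tabulate-toList F b = ≡.trans (map-tabulate (λ i → i) (λ i → F (b i))) (go b)
    where
    go : ∀ {g} (b : Fin g → RTree) → List.tabulate (λ i → F (b i)) ≡ map F (toList (tabulate b))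
    go {zero} b = ≡.refl
    go {suc g} b = ≡.cong (F (b zero) ∷_) (go (λ i → b (suc i)))

toList-Pointwise : ∀ {g} {R : RTree → RTree → Set} (b : Fin g → RTree) (T : Vec RTree g) →
  (∀ i → R (b i) (lookup T i)) → Pointwise R (toList (tabulate b)) (toList T)
toList-Pointwise b [] h = []
toList-Pointwise b (t ∷ T) h = h zero ∷ toList-Pointwise (λ i → b (suc i)) T (λ i → h (suc i))

sizes-Pointwise : ∀ {ts us} → Pointwise (λ t u → size t ≡ size u) ts us → sizes ts ≡ sizes us
sizes-Pointwise [] = ≡.refl
sizes-Pointwise (e ∷ es) = ≡.cong₂ ℕ._+_ e (sizes-Pointwise es)

similar-sym : ∀ {t u} → Similar t u → Similar u t
similar-sym (similar k p e f) = similar k (↭-sym p) f e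

Outcome : ∀ {g} → (b : Fin g → RTree) → Vec RTree g → Set
Outcome {g} b T =
  ((∀ i → Similar (lookup T i) (b i)) × new K.≈ old) ⊎ new A.≺ old
  where
  module K = CommutativeSemiring altSemiring
  new = A.cycle (map (λ i → AT.pairT (b i)) (List.allFin g))
  old = A.cycle (map (λ i → AT.pairT (lookup T i)) (List.allFin g))

-- If all trees are similar, the graphs are isomorphic and both sides of the equivalence hold. In
-- the strict case the coefficients differ, so both sides fail.
compare : ∀ g (b : Fin (3 + g) → RTree) (T : Vec RTree (3 + g)) → (∀ i → size (b i) ≡ size (lookup T i)) → Outcome b T →
  (cyc (tabulate b) ⪯ cyc T) × (sameCoeffs (cyc (tabulate b)) (cyc T) ⇔ (cyc (tabulate b) ≅ cyc T))
compare g b T@(t₀ ∷ t₁ ∷ t₂ ∷ T′) hs outcome = cases outcome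
  where
  us = toList (tabulate (λ i → b (suc (suc (suc i)))))
  G = graphOf (b zero ∷ b (suc zero) ∷ b (suc (suc zero)) ∷ us)
  H = graphOf (t₀ ∷ t₁ ∷ t₂ ∷ toList T′)
  iso⇒same : G ≅ H → sameCoeffs G H
  iso⇒same = isomorphic⇒sameCoeffs G H (mult-graphOf (b zero) (b (suc zero)) (b (suc (suc zero))) us) (mult-graphOf t₀ t₁ t₂ (toList T′))
  cases : Outcome b T → (G ⪯ H) × (sameCoeffs G H ⇔ (G ≅ H))
  cases (inj₁ (alike , _)) = (proj₁ same , λ k k≤n → ℤ.≤-reflexive (proj₂ same k k≤n)) , mk⇔ (λ _ → iso) iso⇒same
    where
    iso : G ≅ H
    iso = reordered⇒isomorphic (b (suc zero) ∷ b (suc (suc zero)) ∷ us) (t₁ ∷ t₂ ∷ toList T′)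
      (toList-Pointwise b T (λ i → similar⇒reordered (similar-sym (alike i))))
    same = iso⇒same iso
  cases (inj₂ less) = ≺⇒⪯ G H sizes≡ c d hG hH less′ ,
    mk⇔ (λ same → contradiction same (≺⇒¬sameCoeffs G H sizes≡ c d hG hH less′)) iso⇒same
    where
    sizes≡ : order G ≡ order H
    sizes≡ = sizes-Pointwise (toList-Pointwise b T hs)
    c = value (toList (tabulate b))
    d = value (toList T)
    hG : Represents G c
    hG = represents-value (b zero) (b (suc zero)) (b (suc (suc zero)) ∷ us)
    hH : Represents H d
    hH = represents-value t₀ t₁ (t₂ ∷ toList T′)
    less′ : c A.≺ d
    less′ = ≡.subst₂ (λ us ts → A.cycle us A.≺ A.cycle ts) (map-tabulate-toList AT.pairT b) (map-toList AT.pairT T) less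

theorem2p5 : (g : ℕ) → 3 ≤ g → (T : Vec RTree g) →
    Σ (Fin g → ℕ) (λ p →
    ((i : Fin g) → 1 ≤ p i) ×
    ((i : Fin g) → p i + treeLeaves (lookup T i) ≤ size (lookup T i)) ×
    ((i j : Fin g) → p i ≢ 1 → p j ≢ 1 → i ≡ j) ×
    (cyc (tabulate (λ i → Btree (size (lookup T i)) (treeLeaves (lookup T i)) (p i))) ⪯ cyc T) ×
    (sameCoeffs (cyc (tabulate (λ i → Btree (size (lookup T i)) (treeLeaves (lookup T i)) (p i)))) (cyc T)
    ⇔ (cyc (tabulate (λ i → Btree (size (lookup T i)) (treeLeaves (lookup T i)) (p i))) ≅ cyc T)))
theorem2p5 (suc (suc (suc g))) (s≤s (s≤s (s≤s z≤n))) T = conclude (AC.optimum (s≤s (s≤s z≤n)) (lookup T))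
  where
  conclude : AC.Optimum (lookup T) → _
  conclude o = O.p , O.p≥1 , O.bound , O.at-most-one ,
    compare g O.B T (λ i → size-Btree (lookup T i) (O.p i) (O.p≥1 i) (O.bound i)) O.outcome
    where module O = AC.Optimum o
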